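{- For each $\alpha>0$ there exist $c>0$ and $n_0\in\mathbb{N}$ such that the following holds for every $n\geq n_0$. Every $n$-vertex digraph $D$ with $\delta^0(D)\geq (1/2+\alpha)n$ contains a copy of every oriented tree $T$ on $n$ vertices with $\Delta^\pm(T)\leq cn/\log n$.
   Context: A digraph $D$ has vertex set $V(D)$ and edge set $E(D)$ consisting of ordered pairs of distinct vertices; $uv\in E(D)$ means $v$ is an out-neighbour of $u$ and $u$ is an in-neighbour of $v$. The minimum semidegree is $\delta^0(D)=\min_{v\in V(D)}\min\{d^+_D(v),d^-_D(v)\}$, where $d^+_D(v)$ and $d^-_D(v)$ are the numbers of out- and in-neighbours of $v$. An oriented tree is a tree each of whose edges is given one direction. $\Delta^\pm(T)$ denotes the maximum degree of the underlying undirected tree of $T$. A copy of $T$ in $D$ is a subgraph of $D$ isomorphic to $T$ as a directed graph, i.e. an injective map $V(T)\to V(D)$ sending every edge $xy$ of $T$ to an edge of $D$ with the same direction. -}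

module Defs where

open import Data.Nat using (ℕ; zero; suc; _+_; _∸_)
open import Data.Fin using (Fin)
open import Data.Bool using (Bool; true; false; if_then_else_; _∨_)
open import Data.List using (List; map; allFin)
open import Data.Nat.ListAction using (sum)
open import Data.Product using (_×_; Σ)
open import Relation.Binary.PropositionalEquality using (_≡_)
open import Relation.Binary.Construct.Closure.ReflexiveTransitive using (Star)
open import Function.Definitions using (Injective)

record Digraph (n : ℕ) : Set where
  field
    adj     : Fin n → Fin n → Bool
    loopless : ∀ v → adj v v ≡ false
open Digraph public

countFin : (n : ℕ) → (Fin n → Bool) → ℕ
countFin n p = sum (map (λ x → if p x then 1 else 0) (allFin n))

outdeg : ∀ {n} → Digraph n → Fin n → ℕ
outdeg {n} D v = countFin n (λ w → adj D v w)

indeg : ∀ {n} → Digraph n → Fin n → ℕ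
indeg {n} D v = countFin n (λ w → adj D w v)

edgeCount : ∀ {n} → Digraph n → ℕ
edgeCount {n} D = sum (map (λ u → outdeg D u) (allFin n))

undAdj : ∀ {n} → Digraph n → Fin n → Fin n → Bool
undAdj D x y = adj D x y ∨ adj D y x

undDeg : ∀ {n} → Digraph n → Fin n → ℕ
undDeg {n} D x = countFin n (λ y → undAdj D x y)

record IsOrientedTree {n : ℕ} (T : Digraph n) : Set where
  field
    oriented  : ∀ x y → adj T x y ≡ true → adj T y x ≡ false
    connected : ∀ x y → Star (λ a b → undAdj T a b ≡ true) x y
    edges     : edgeCount T ≡ n ∸ 1

ContainsCopy : ∀ {n m} → Digraph m → Digraph n → Set
ContainsCopy {n} {m} D T =
  Σ (Fin n → Fin m) λ f → Injective _≡_ _≡_ f × (∀ x y → adj T x y ≡ true → adj D (f x) (f y) ≡ true)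

-- Cut the tree at a vertex v into two forests t₁ and t₂ of subtrees of v, with t₁ small but linear in n. A greedy,
-- derandomised embedding of t₁ makes every triple (v, w, sign) have many low-degree vertices x of t₁ whose image is a
-- sign-neighbour of v and which could be moved to w. Most of t₂ is then embedded in small subtrees: a dense digraph on the
-- unused vertices has many disjoint perfect matchings, a walk along random ones has uniform marginals, and a cheapest
-- outcome keeps the potential Σ (2 N − a) ^ q bounded, hence all semidegrees into the N unused vertices above one half.
-- The last vertices are embedded one at a time by switching: the new vertex takes the image of some x of t₁ next to the
-- image of its parent, and x moves to an unused vertex w.

module Submission where

open import Defs

-- A union bound over polynomially many tests couples the maximum degree to log n. The obstacle in
-- the almost-spanning phase is that the root of a block must be adjacent to the fixed image r of
-- its parent. A neighbourhood of r may be little more than half of the vertices, so a root drawn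
-- from it is biased, and the bias would accumulate over the blocks. Hence a vertex u is drawn
-- uniformly first, and then a centre c adjacent to both r and u: c may be biased, but its children,
-- sent to u, are not, and their subtrees make up almost the whole block. A movable vertex has at
-- most one child and its depth lies in a fixed class modulo 3, so a move respects at most two edges
-- and leaves the neighbours of all other movable vertices in place. Probabilities are averages over
-- finite sets, and inequalities are cross-multiplied over the naturals.

module Spanning where

  open import Data.Nat using (ℕ; zero; suc; _+_; _*_; _∸_; _^_; _≤_; _<_; z≤n; s≤s; _≤?_; _<?_; _≤ᵇ_; _/_; _%_; NonZero; >-nonZero)
  open import Data.Nat.Properties hiding (_≟_; suc-injective; 0≢1+n)
  open import Data.Nat.DivMod using (m/n*n≤m; m*n/n≡m; /-monoˡ-≤; m≡m%n+[m/n]*n; m%n<n)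
  open import Data.Nat.Logarithm using (⌊log₂_⌋; ⌊log₂⌋-mono-≤; ⌊log₂[2^n]⌋≡n)
  open import Data.Nat.ListAction using (sum)
  open import Data.Nat.Tactic.RingSolver using (solve-∀)
  open import Data.Fin using (Fin; zero; suc; combine; remQuot; splitAt; _↑ˡ_; _↑ʳ_)
  open import Data.Fin.Properties using (_≟_; any?; suc-injective; remQuot-combine; splitAt-↑ˡ; splitAt-↑ʳ)
  open import Data.Bool using (Bool; true; false; _∧_; _∨_; not; if_then_else_)
  open import Data.Product using (Σ; ∃; _×_; _,_; proj₁; proj₂)
  open import Data.Sum using (_⊎_; inj₁; inj₂; [_,_]′)
  open import Data.Maybe using (Maybe; just; nothing)
  open import Data.Empty using (⊥; ⊥-elim)
  open import Data.Unit using (⊤; tt)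
  open import Data.List using (List; []; _∷_; _++_; map; length; tabulate)
  open import Data.List.Properties using (length-++; map-tabulate)
  open import Data.List.Membership.Propositional using (_∈_)
  open import Data.List.Relation.Unary.Any using (Any; here; there)
  open import Data.List.Relation.Unary.All using (All; []; _∷_)
  open import Relation.Nullary using (Dec; yes; no; ⌊_⌋; contradiction)
  open import Relation.Nullary.Decidable using (_×-dec_)
  open import Relation.Binary.PropositionalEquality using (_≡_; _≢_; refl; sym; trans; cong; cong₂; subst; subst₂; module ≡-Reasoning)
  open import Function using (_∘_; id)
  open import Algebra.Properties.Semiring.Sum +-*-semiring using (∑-distrib-+; ∑-comm; *-distribˡ-sum; *-distribʳ-sum; sum-cong-≗) renaming (sum to sumF)
  import Data.Bool
  import Data.Product
  open import Data.List.Membership.Propositional.Properties using (∈-++⁻)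
  import Data.List.Relation.Unary.All as All
  import Data.List.Relation.Unary.All.Properties as All
  import Data.List.Relation.Unary.Any.Properties as Any
  open import Relation.Binary.Construct.Closure.ReflexiveTransitive using (Star; _◅_) renaming (ε to nil)

  -- Linear arithmetic by certificate: `X ≤ Y` is a combination of known inequalities with chosen
  -- multipliers, and the ring solver verifies that it yields `L ≤ R` with `slack` to spare.
  lin : ∀ {X Y L R} slack → X ≤ Y → L + Y + slack ≡ R + X → L ≤ R
  lin {X} {Y} {L} {R} slack X≤Y eq = +-cancelʳ-≤ Y L R (begin
    L + Y          ≤⟨ m≤m+n (L + Y) slack ⟩
    L + Y + slack  ≡⟨ eq ⟩
    R + X          ≤⟨ +-monoʳ-≤ R X≤Y ⟩
    R + Y          ∎)
    where open ≤-Reasoning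

  -- Indicators, finite sums and counting

  χ : Bool → ℕ
  χ b = if b then 1 else 0

  χ-∧ : ∀ a b → χ (a ∧ b) ≡ χ a * χ b
  χ-∧ false b = refl
  χ-∧ true  b = sym (+-identityʳ (χ b))

  χ≤1 : ∀ b → χ b ≤ 1
  χ≤1 false = z≤n
  χ≤1 true  = ≤-refl

  χ≢0 : ∀ {b} → 0 < χ b → b ≡ true
  χ≢0 {true} _ = refl

  ∧-true : ∀ {a b} → a ∧ b ≡ true → a ≡ true × b ≡ true
  ∧-true {true} {true} _ = refl , refl

  true-∧ : ∀ {a b} → a ≡ true → b ≡ true → a ∧ b ≡ true
  true-∧ refl refl = refl

  true≢false : ∀ {a} {P : Set a} {b} → b ≡ true → b ≡ false → P
  true≢false refl ()

  -- Opaque, so that sums never unfold during type checking and are handled only through the laws of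
  -- this block.
  opaque
    ∑ : ∀ {n} → (Fin n → ℕ) → ℕ
    ∑ = sumF

    ∑-cong : ∀ {n} {f g : Fin n → ℕ} → (∀ x → f x ≡ g x) → ∑ f ≡ ∑ g
    ∑-cong = sum-cong-≗

    ∑-mono : ∀ {n} {f g : Fin n → ℕ} → (∀ x → f x ≤ g x) → ∑ f ≤ ∑ g
    ∑-mono {zero}  h = z≤n
    ∑-mono {suc n} h = +-mono-≤ (h zero) (∑-mono (h ∘ suc))

    ∑-+ : ∀ {n} (f g : Fin n → ℕ) → ∑ (λ x → f x + g x) ≡ ∑ f + ∑ g
    ∑-+ = ∑-distrib-+

    ∑-*ˡ : ∀ {n} c (f : Fin n → ℕ) → ∑ (λ x → c * f x) ≡ c * ∑ f
    ∑-*ˡ c f = sym (*-distribˡ-sum c f)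

    ∑-*ʳ : ∀ {n} c (f : Fin n → ℕ) → ∑ (λ x → f x * c) ≡ ∑ f * c
    ∑-*ʳ c f = sym (*-distribʳ-sum c f)

    ∑-swap : ∀ {m n} (f : Fin m → Fin n → ℕ) → ∑ (λ i → ∑ (f i)) ≡ ∑ (λ j → ∑ (λ i → f i j))
    ∑-swap = ∑-comm

    ∑-const : ∀ n c → ∑ {n} (λ _ → c) ≡ n * c
    ∑-const zero    c = refl
    ∑-const (suc n) c = cong (c +_) (∑-const n c)

    ∑-zero : ∀ {n} {f : Fin n → ℕ} → (∀ x → f x ≡ 0) → ∑ f ≡ 0
    ∑-zero {n} h = trans (∑-cong h) (trans (∑-const n 0) (*-zeroʳ n))

    ∑-pos : ∀ {n} (f : Fin n → ℕ) → 0 < ∑ f → ∃ λ x → 0 < f x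
    ∑-pos {suc n} f h with f zero in eq
    ... | suc k = zero , subst (0 <_) (sym eq) (s≤s z≤n)
    ... | zero with ∑-pos (f ∘ suc) h
    ... | x , p = suc x , p

    ∑-≥ : ∀ {n} (f : Fin n → ℕ) x → f x ≤ ∑ f
    ∑-≥ f zero    = m≤m+n _ _
    ∑-≥ f (suc x) = ≤-trans (∑-≥ (f ∘ suc) x) (m≤n+m _ _)

    ∑-delta : ∀ {n} (f : Fin n → ℕ) x → (∀ y → y ≢ x → f y ≡ 0) → ∑ f ≡ f x
    ∑-delta f zero    h = trans (cong (f zero +_) (∑-zero λ y → h (suc y) λ ())) (+-identityʳ _)
    ∑-delta f (suc x) h = trans (cong (_+ ∑ (f ∘ suc)) (h zero λ ())) (∑-delta (f ∘ suc) x λ y y≢x → h (suc y) (y≢x ∘ suc-injective))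

    ∑-tabulate : ∀ n (f : Fin n → ℕ) → sum (tabulate f) ≡ ∑ f
    ∑-tabulate zero    f = refl
    ∑-tabulate (suc n) f = cong (f zero +_) (∑-tabulate n (f ∘ suc))

  cnt : ∀ {n} → (Fin n → Bool) → ℕ
  cnt p = ∑ (χ ∘ p)

  cnt-true : ∀ n → cnt {n} (λ _ → true) ≡ n
  cnt-true n = trans (∑-const n 1) (*-identityʳ n)

  cnt-mono : ∀ {n} {p q : Fin n → Bool} → (∀ x → p x ≡ true → q x ≡ true) → cnt p ≤ cnt q
  cnt-mono {p = p} {q} h = ∑-mono go
    where
    go : ∀ x → χ (p x) ≤ χ (q x)
    go x with p x | h x
    ... | false | _ = z≤n
    ... | true  | i rewrite i refl = ≤-refl

  cnt-pos : ∀ {n} (p : Fin n → Bool) → 0 < cnt p → ∃ λ x → p x ≡ true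
  cnt-pos p h with ∑-pos (χ ∘ p) h
  ... | x , q = x , χ≢0 q

  cnt-split : ∀ {n} (p q : Fin n → Bool) → cnt p ≡ cnt (λ x → p x ∧ q x) + cnt (λ x → p x ∧ not (q x))
  cnt-split p q = trans (∑-cong λ x → go (p x) (q x)) (∑-+ (λ x → χ (p x ∧ q x)) (λ x → χ (p x ∧ not (q x))))
    where
    go : ∀ a b → χ a ≡ χ (a ∧ b) + χ (a ∧ not b)
    go false b     = refl
    go true  true  = refl
    go true  false = refl

  cnt-∧∧ : ∀ {n} (u p q : Fin n → Bool) → cnt (λ x → u x ∧ p x) + cnt (λ x → u x ∧ q x) ≤ cnt u + cnt (λ x → u x ∧ (p x ∧ q x))
  cnt-∧∧ u p q = begin
    cnt (λ x → u x ∧ p x) + cnt (λ x → u x ∧ q x)  ≡⟨ ∑-+ _ _ ⟨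
    ∑ (λ x → χ (u x ∧ p x) + χ (u x ∧ q x))        ≤⟨ ∑-mono (λ x → go (u x) (p x) (q x)) ⟩
    ∑ (λ x → χ (u x) + χ (u x ∧ (p x ∧ q x)))      ≡⟨ ∑-+ _ _ ⟩
    cnt u + cnt (λ x → u x ∧ (p x ∧ q x))          ∎
    where
    open ≤-Reasoning
    go : ∀ u p q → χ (u ∧ p) + χ (u ∧ q) ≤ χ u + χ (u ∧ (p ∧ q))
    go false _     _     = z≤n
    go true  false q     = ≤-trans (χ≤1 q) (s≤s z≤n)
    go true  true  q     = ≤-refl

  _==_ : ∀ {n} → Fin n → Fin n → Bool
  x == y = ⌊ x ≟ y ⌋

  ==-refl : ∀ {n} (x : Fin n) → (x == x) ≡ true
  ==-refl x with x ≟ x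
  ... | yes _ = refl
  ... | no ne = contradiction refl ne

  ==-≡ : ∀ {n} {x y : Fin n} → (x == y) ≡ true → x ≡ y
  ==-≡ {x = x} {y} h with x ≟ y
  ... | yes eq = eq

  ==-≢ : ∀ {n} {x y : Fin n} → x ≢ y → (x == y) ≡ false
  ==-≢ {x = x} {y} ne with x ≟ y
  ... | yes eq = contradiction eq ne
  ... | no _ = refl

  infixl 6 _∖_
  _∖_ : ∀ {n} → (Fin n → Bool) → Fin n → (Fin n → Bool)
  (U ∖ u) x = U x ∧ not (x == u)

  ∖-⊆ : ∀ {n} (U : Fin n → Bool) u x → (U ∖ u) x ≡ true → U x ≡ true
  ∖-⊆ U u x h = proj₁ (∧-true h)

  ∖-self : ∀ {n} (U : Fin n → Bool) u → (U ∖ u) u ≡ false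
  ∖-self U u rewrite ==-refl u with U u
  ... | true  = refl
  ... | false = refl

  ∑-∖ : ∀ {n} (U : Fin n → Bool) (g : Fin n → ℕ) u → U u ≡ true → ∑ (λ x → χ (U x) * g x) ≡ g u + ∑ (λ x → χ ((U ∖ u) x) * g x)
  ∑-∖ U g u Uu = begin
    ∑ (λ x → χ (U x) * g x)
      ≡⟨ ∑-cong (λ x → go (U x) (x == u) x) ⟩
    ∑ (λ x → χ (U x ∧ (x == u)) * g x + χ ((U ∖ u) x) * g x)
      ≡⟨ ∑-+ _ _ ⟩
    ∑ (λ x → χ (U x ∧ (x == u)) * g x) + ∑ (λ x → χ ((U ∖ u) x) * g x)
      ≡⟨ cong (_+ ∑ (λ x → χ ((U ∖ u) x) * g x)) (trans (∑-delta _ u off) on) ⟩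
    g u + ∑ (λ x → χ ((U ∖ u) x) * g x) ∎
    where
    open ≡-Reasoning
    go : ∀ b d x → χ b * g x ≡ χ (b ∧ d) * g x + χ (b ∧ not d) * g x
    go false d     x = refl
    go true  true  x = sym (+-identityʳ _)
    go true  false x = refl
    off : ∀ y → y ≢ u → χ (U y ∧ (y == u)) * g y ≡ 0
    off y ne rewrite ==-≢ ne with U y
    ... | true  = refl
    ... | false = refl
    on : χ (U u ∧ (u == u)) * g u ≡ g u
    on rewrite Uu | ==-refl u = +-identityʳ _

  cnt-χ1 : ∀ {n} (U : Fin n → Bool) → cnt U ≡ ∑ (λ x → χ (U x) * 1)
  cnt-χ1 U = ∑-cong λ x → sym (*-identityʳ _)

  cnt-∖ : ∀ {n} (U : Fin n → Bool) u → U u ≡ true → cnt U ≡ suc (cnt (U ∖ u))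
  cnt-∖ U u Uu = trans (cnt-χ1 U) (trans (∑-∖ U (λ _ → 1) u Uu) (cong suc (sym (cnt-χ1 (U ∖ u)))))

  cnt-unique : ∀ {n} (p : Fin n → Bool) → (∀ x y → p x ≡ true → p y ≡ true → x ≡ y) → cnt p ≤ 1
  cnt-unique p h with cnt p in eq
  ... | zero  = z≤n
  ... | suc zero = ≤-refl
  ... | suc (suc k) = ⊥-elim (contra (cnt-pos p (subst (0 <_) (sym eq) (s≤s z≤n))))
    where
    contra : (∃ λ x → p x ≡ true) → ⊥
    contra (x , px) with cnt-pos (p ∖ x) (subst (0 <_) (sym (Data.Nat.Properties.suc-injective (trans (sym (cnt-∖ p x px)) eq))) (s≤s z≤n))
    ... | y , py with h x y px (∖-⊆ p x y py)
    ... | refl = true≢false py (∖-self p x)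

  -- Grouping the left-hand sum by the value y of σ, each fibre inside p has at most one element,
  -- and none unless `q y`.
  ∑-inj : ∀ {m n} (p : Fin m → Bool) (q : Fin n → Bool) (σ : Fin m → Fin n) (F : Fin n → ℕ) →
          (∀ x → p x ≡ true → q (σ x) ≡ true) →
          (∀ x y → p x ≡ true → p y ≡ true → σ x ≡ σ y → x ≡ y) →
          ∑ (λ x → χ (p x) * F (σ x)) ≤ ∑ (λ y → χ (q y) * F y)
  ∑-inj p q σ F into inj = begin
    ∑ (λ x → χ (p x) * F (σ x))
      ≡⟨ ∑-cong (λ x → sym (trans (∑-delta _ (σ x) (off x)) (on x))) ⟩
    ∑ (λ x → ∑ (λ y → χ (p x ∧ (σ x == y)) * F y))
      ≡⟨ ∑-swap _ ⟩
    ∑ (λ y → ∑ (λ x → χ (p x ∧ (σ x == y)) * F y))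
      ≡⟨ ∑-cong (λ y → ∑-*ʳ (F y) (λ x → χ (p x ∧ (σ x == y)))) ⟩
    ∑ (λ y → cnt (λ x → p x ∧ (σ x == y)) * F y)
      ≤⟨ ∑-mono (λ y → *-monoˡ-≤ (F y) (fibre y)) ⟩
    ∑ (λ y → χ (q y) * F y) ∎
    where
    open ≤-Reasoning
    off : ∀ x y → y ≢ σ x → χ (p x ∧ (σ x == y)) * F y ≡ 0
    off x y ne rewrite ==-≢ (ne ∘ sym) with p x
    ... | true  = refl
    ... | false = refl
    on : ∀ x → χ (p x ∧ (σ x == σ x)) * F (σ x) ≡ χ (p x) * F (σ x)
    on x rewrite ==-refl (σ x) with p x
    ... | true  = refl
    ... | false = refl
    fibre : ∀ y → cnt (λ x → p x ∧ (σ x == y)) ≤ χ (q y)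
    fibre y with q y in eq
    ... | true = cnt-unique _ λ x x' h h' → let (a , b) = ∧-true h ; (a' , b') = ∧-true h' in
                   inj x x' a a' (trans (==-≡ b) (sym (==-≡ b')))
    ... | false = ≤-reflexive (∑-zero λ x → none x)
      where
      none : ∀ x → χ (p x ∧ (σ x == y)) ≡ 0
      none x with p x in px | σ x ≟ y
      ... | false | _ = refl
      ... | true  | no _ = refl
      ... | true  | yes refl = true≢false (into x px) eq

  cnt-inj : ∀ {m n} (p : Fin m → Bool) (q : Fin n → Bool) (σ : Fin m → Fin n) →
          (∀ x → p x ≡ true → q (σ x) ≡ true) →
          (∀ x y → p x ≡ true → p y ≡ true → σ x ≡ σ y → x ≡ y) → cnt p ≤ cnt q
  cnt-inj p q σ into inj = subst₂ _≤_ (sym (cnt-χ1 p)) (sym (cnt-χ1 q)) (∑-inj p q σ (λ _ → 1) into inj)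

  cnt-overlap : ∀ {n} (u p q : Fin n → Bool) → (∀ x → p x ≡ true → u x ≡ true) → (∀ x → q x ≡ true → u x ≡ true) →
                cnt u < cnt p + cnt q → ∃ λ x → p x ≡ true × q x ≡ true
  cnt-overlap u p q pu qu lt with cnt-pos (λ x → p x ∧ q x) pos
    where
    go : ∀ u p q → (p ≡ true → u ≡ true) → (q ≡ true → u ≡ true) → χ p + χ q ≤ χ u + χ (p ∧ q)
    go u false false _ _ = z≤n
    go u false true  _ h rewrite h refl = ≤-refl
    go u true  false h _ rewrite h refl = ≤-refl
    go u true  true  h _ rewrite h refl = ≤-refl
    le : cnt p + cnt q ≤ cnt u + cnt (λ x → p x ∧ q x)
    le = subst₂ _≤_ (∑-+ _ _) (∑-+ _ _) (∑-mono λ x → go (u x) (p x) (q x) (pu x) (qu x))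
    pos : 0 < cnt (λ x → p x ∧ q x)
    pos = +-cancelˡ-< (cnt u) 0 _ (<-≤-trans (subst (_< cnt p + cnt q) (sym (+-identityʳ _)) lt) le)
  ... | x , h = x , ∧-true h

  -- This replaces a random draw with weights w: if every x of positive weight cost more than the
  -- weighted mean, the weighted sum would exceed itself.
  min≤avg : ∀ {n} (w c : Fin n → ℕ) → 0 < ∑ w → ∃ λ x → 0 < w x × c x * ∑ w ≤ ∑ (λ x → w x * c x)
  min≤avg w c pos with any? (λ x → (0 <? w x) ×-dec (c x * ∑ w ≤? ∑ (λ x → w x * c x)))
  ... | yes r = r
  ... | no  ne = ⊥-elim (<-irrefl refl (begin-strict
    ∑ w * X                     <⟨ *-monoʳ-< (∑ w) {{>-nonZero pos}} (n<1+n X) ⟩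
    ∑ w * suc X                 ≡⟨ ∑-*ʳ (suc X) w ⟨
    ∑ (λ x → w x * suc X)       ≤⟨ ∑-mono each ⟩
    ∑ (λ x → ∑ w * (w x * c x)) ≡⟨ ∑-*ˡ (∑ w) _ ⟩
    ∑ w * X ∎))
    where
    open ≤-Reasoning
    X = ∑ (λ x → w x * c x)
    each : ∀ x → w x * suc X ≤ ∑ w * (w x * c x)
    each x with w x in eq
    ... | zero = z≤n
    ... | suc k = subst (suc k * suc X ≤_) (rearr (suc k) (c x) (∑ w)) (*-monoʳ-≤ (suc k)
                    (≰⇒> λ le → ne (x , subst (0 <_) (sym eq) (s≤s z≤n) , le)))
      where
      rearr : ∀ a b c → a * (b * c) ≡ c * (a * b)
      rearr = solve-∀

  min≤avg-on : ∀ {n} (p : Fin n → Bool) (c : Fin n → ℕ) → 0 < cnt p →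
               ∃ λ x → p x ≡ true × c x * cnt p ≤ ∑ (λ x → χ (p x) * c x)
  min≤avg-on p c pos with min≤avg (χ ∘ p) c pos
  ... | x , h , le = x , χ≢0 h , le

  countFin≡cnt : ∀ n (p : Fin n → Bool) → countFin n p ≡ cnt p
  countFin≡cnt n p = trans (cong sum (map-tabulate id (χ ∘ p))) (∑-tabulate n (χ ∘ p))

  -- Perfect matchings and factors of dense bipartite graphs

  record BijOn {n} (U : Fin n → Bool) (σ : Fin n → Fin n) : Set where
    field
      into : ∀ x → U x ≡ true → U (σ x) ≡ true
      inj  : ∀ x y → U x ≡ true → U y ≡ true → σ x ≡ σ y → x ≡ y

  -- A uniform vertex of U stays uniform when it is sent along a matching. The expected costs of
  -- random walks below rest on this invariance.
  ∑-BijOn : ∀ {n} {U : Fin n → Bool} {σ} → BijOn U σ → (F : Fin n → ℕ) → ∑ (λ x → χ (U x) * F (σ x)) ≤ ∑ (λ y → χ (U y) * F y)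
  ∑-BijOn {U = U} {σ} b F = ∑-inj U U σ F (BijOn.into b) (BijOn.inj b)

  -- Injectivity bounds preimages from above; applied to the complement of p, it bounds the preimage
  -- of p from below.
  cnt-∘BijOn : ∀ {n} {U : Fin n → Bool} {σ} → BijOn U σ → (p : Fin n → Bool) → cnt (λ y → U y ∧ p y) ≤ cnt (λ x → U x ∧ p (σ x))
  cnt-∘BijOn {U = U} {σ} b p = +-cancelʳ-≤ (cnt (λ x → U x ∧ not (p x))) _ _ (begin
    cnt (λ y → U y ∧ p y) + cnt (λ x → U x ∧ not (p x))
      ≡⟨ cnt-split U p ⟨
    cnt U
      ≡⟨ cnt-split U (p ∘ σ) ⟩
    cnt (λ x → U x ∧ p (σ x)) + cnt (λ x → U x ∧ not (p (σ x)))
      ≤⟨ +-monoʳ-≤ (cnt (λ x → U x ∧ p (σ x))) (cnt-inj (λ x → U x ∧ not (p (σ x))) (λ x → U x ∧ not (p x)) σ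
           (λ x h → true-∧ (BijOn.into b x (proj₁ (∧-true h))) (proj₂ (∧-true {U x} h)))
           (λ x y h h' → BijOn.inj b x y (proj₁ (∧-true h)) (proj₁ (∧-true h')))) ⟩
    cnt (λ x → U x ∧ p (σ x)) + cnt (λ x → U x ∧ not (p x)) ∎)
    where open ≤-Reasoning

  -- Start from the identity.  If x₀ is not matched along G, then fewer than |U| positions avoid x₀, so some x has
  -- both G x₀ (σ x) and G x (σ x₀); exchanging the values at x₀ and x repairs x₀ and keeps x matched.
  module Matching {n} (U : Fin n → Bool) (G : Fin n → Fin n → Bool)
    (rows : ∀ x → U x ≡ true → cnt U ≤ 2 * cnt (λ y → U y ∧ G x y))
    (cols : ∀ y → U y ≡ true → cnt U ≤ 2 * cnt (λ x → U x ∧ G x y)) where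

    bad : (Fin n → Fin n) → Fin n → Bool
    bad σ x = U x ∧ not (G x (σ x))

    exchange : (Fin n → Fin n) → Fin n → Fin n → Fin n → Fin n
    exchange σ a b x = if x == a then σ b else if x == b then σ a else σ x

    exchange-BijOn : ∀ {σ} a b → U a ≡ true → U b ≡ true → BijOn U σ → BijOn U (exchange σ a b)
    exchange-BijOn {σ} a b Ua Ub bij = record { into = into′ ; inj = inj′ }
      where
      open BijOn bij
      into′ : ∀ x → U x ≡ true → U (exchange σ a b x) ≡ true
      into′ x Ux with x ≟ a
      ... | yes _ = into b Ub
      ... | no _ with x ≟ b
      ... | yes _ = into a Ua
      ... | no  _ = into x Ux
      inj′ : ∀ x y → U x ≡ true → U y ≡ true → exchange σ a b x ≡ exchange σ a b y → x ≡ y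
      inj′ x y Ux Uy eq with x ≟ a | y ≟ a
      ... | yes refl | yes refl = refl
      ... | yes refl | no ya with y ≟ b
      ...   | yes refl = sym (inj b a Ub Ua eq)
      ...   | no yb = contradiction (sym (inj b y Ub Uy eq)) yb
      inj′ x y Ux Uy eq | no xa | yes refl with x ≟ b
      ...   | yes refl = inj b a Ub Ua (sym eq)
      ...   | no xb = contradiction (inj x b Ux Ub eq) xb
      inj′ x y Ux Uy eq | no xa | no ya with x ≟ b | y ≟ b
      ... | yes refl | yes refl = refl
      ... | yes refl | no _ = contradiction (sym (inj a y Ua Uy eq)) ya
      ... | no _ | yes refl = contradiction (inj x a Ux Ua eq) xa
      ... | no _ | no _ = inj x y Ux Uy eq

    improve : ∀ {σ} → BijOn U σ → ∀ x₀ → bad σ x₀ ≡ true → ∃ λ σ′ → BijOn U σ′ × cnt (bad σ′) < cnt (bad σ)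
    improve {σ} bij x₀ bx₀ = repair (proj₁ common) (proj₁ (proj₂ common)) (proj₂ (proj₂ common))
      where
      open BijOn bij
      Ux₀ = proj₁ (∧-true bx₀)
      notG : G x₀ (σ x₀) ≡ false
      notG with G x₀ (σ x₀) | proj₂ (∧-true {U x₀} bx₀)
      ... | false | _ = refl
      avoid : ∀ b x → (x ≡ x₀ → b ≡ false) → χ (U x ∧ b) ≤ χ ((U ∖ x₀) x ∧ b)
      avoid b x h with x ≟ x₀
      ... | no _ with U x
      ...   | true  = ≤-refl
      ...   | false = z≤n
      avoid b x h | yes eq rewrite h eq with U x
      ...   | true  = z≤n
      ...   | false = z≤n
      p q : Fin n → Bool
      p x = (U ∖ x₀) x ∧ G x₀ (σ x)
      q x = (U ∖ x₀) x ∧ G x (σ x₀)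
      p-many : cnt U ≤ 2 * cnt p
      p-many = ≤-trans (rows x₀ Ux₀) (*-monoʳ-≤ 2 (≤-trans (cnt-∘BijOn bij (G x₀)) (∑-mono λ x → avoid (G x₀ (σ x)) x λ { refl → notG })))
      q-many : cnt U ≤ 2 * cnt q
      q-many = ≤-trans (cols (σ x₀) (into x₀ Ux₀)) (*-monoʳ-≤ 2 (∑-mono λ x → avoid (G x (σ x₀)) x λ { refl → notG }))
      common : ∃ λ x → p x ≡ true × q x ≡ true
      common = cnt-overlap (U ∖ x₀) p q (λ x h → proj₁ (∧-true h)) (λ x h → proj₁ (∧-true h))
        (subst (_≤ cnt p + cnt q) (cnt-∖ U x₀ Ux₀) (*-cancelˡ-≤ 2 (subst₂ _≤_ (dbl (cnt U)) (dbl2 (cnt p) (cnt q)) (+-mono-≤ p-many q-many))))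
        where
        dbl : ∀ a → a + a ≡ 2 * a
        dbl = solve-∀
        dbl2 : ∀ a b → 2 * a + 2 * b ≡ 2 * (a + b)
        dbl2 = solve-∀
      repair : ∀ x → p x ≡ true → q x ≡ true → ∃ λ σ′ → BijOn U σ′ × cnt (bad σ′) < cnt (bad σ)
      repair x px qx = σ′ , exchange-BijOn x₀ x Ux₀ (∖-⊆ U x₀ x (proj₁ (∧-true px))) bij ,
                       subst (cnt (bad σ′) <_) (sym (cnt-∖ (bad σ) x₀ bx₀)) (s≤s (cnt-mono still))
        where
        σ′ = exchange σ x₀ x
        still : ∀ y → bad σ′ y ≡ true → (bad σ ∖ x₀) y ≡ true
        still y h with y ≟ x₀
        ... | yes refl rewrite proj₂ (∧-true {(U ∖ x₀) x} px) = true≢false (proj₂ (∧-true {U y} h)) refl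
        ... | no ne with y ≟ x
        ...   | yes refl rewrite proj₂ (∧-true {(U ∖ x₀) y} qx) = true≢false (proj₂ (∧-true {U y} h)) refl
        ...   | no _ rewrite h = refl

    Perfect : Set
    Perfect = ∃ λ σ → BijOn U σ × ∀ x → U x ≡ true → G x (σ x) ≡ true

    decide : ∀ σ → (∃ λ x → bad σ x ≡ true) ⊎ (∀ x → U x ≡ true → G x (σ x) ≡ true)
    decide σ with any? (λ x → bad σ x Data.Bool.≟ true)
    ... | yes b = inj₁ b
    ... | no none = inj₂ good
      where
      good : ∀ x → U x ≡ true → G x (σ x) ≡ true
      good x Ux with G x (σ x) in eq
      ... | true = refl
      ... | false = ⊥-elim (none (x , true-∧ Ux (cong not eq)))

    search : ∀ k σ → BijOn U σ → cnt (bad σ) < k → Perfect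
    descend : ∀ k σ → cnt (bad σ) < suc k → (∃ λ σ′ → BijOn U σ′ × cnt (bad σ′) < cnt (bad σ)) → Perfect
    settle : ∀ k σ → BijOn U σ → cnt (bad σ) < suc k → (∃ λ x → bad σ x ≡ true) ⊎ (∀ x → U x ≡ true → G x (σ x) ≡ true) → Perfect
    search (suc k) σ bij lt = settle k σ bij lt (decide σ)
    settle k σ bij lt (inj₁ (x₀ , bx₀)) = descend k σ lt (improve bij x₀ bx₀)
    settle k σ bij lt (inj₂ good) = σ , bij , good
    descend k σ lt (σ′ , bij′ , lt′) = search k σ′ bij′ (<-≤-trans lt′ (≤-pred lt))

    perfect-matching : Perfect
    perfect-matching = search (suc (cnt (bad id))) id (record { into = λ _ h → h ; inj = λ _ _ _ _ h → h }) ≤-refl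

  record Factor {n} (U : Fin n → Bool) (G : Fin n → Fin n → Bool) (ℓ : ℕ) : Set where
    field
      match    : Fin ℓ → Fin n → Fin n
      bij      : ∀ i → BijOn U (match i)
      along    : ∀ i x → U x ≡ true → G x (match i x) ≡ true
      disjoint : ∀ i j x → U x ≡ true → match i x ≡ match j x → i ≡ j

  module Peel {n} (U : Fin n → Bool) (G : Fin n → Fin n → Bool) {σ : Fin n → Fin n} (σbij : BijOn U σ)
              (σalong : ∀ x → U x ≡ true → G x (σ x) ≡ true) where

    G′ : Fin n → Fin n → Bool
    G′ x y = G x y ∧ not (σ x == y)

    -- Rows and columns are treated alike: q marks the pairs of the removed matching on one line,
    -- and there is at most one.
    drop : ∀ ℓ (p q : Fin n → Bool) → cnt (λ y → U y ∧ q y) ≤ 1 → cnt U + 2 * suc ℓ ≤ 2 * cnt (λ y → U y ∧ p y) →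
           cnt U + 2 * ℓ ≤ 2 * cnt (λ y → U y ∧ (p y ∧ not (q y)))
    drop ℓ p q one h = +-cancelʳ-≤ 2 _ _ (begin
      cnt U + 2 * ℓ + 2
        ≡⟨ arith (cnt U) ℓ ⟩
      cnt U + 2 * suc ℓ
        ≤⟨ h ⟩
      2 * cnt (λ y → U y ∧ p y)
        ≤⟨ *-monoʳ-≤ 2 (≤-trans (∑-mono λ y → go (U y) (p y) (q y)) (≤-reflexive (∑-+ _ _))) ⟩
      2 * (cnt (λ y → U y ∧ (p y ∧ not (q y))) + cnt (λ y → U y ∧ q y))
        ≤⟨ *-monoʳ-≤ 2 (+-monoʳ-≤ (cnt (λ y → U y ∧ (p y ∧ not (q y)))) one) ⟩
      2 * (cnt (λ y → U y ∧ (p y ∧ not (q y))) + 1)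
        ≡⟨ *-distribˡ-+ 2 (cnt (λ y → U y ∧ (p y ∧ not (q y)))) 1 ⟩
      2 * cnt (λ y → U y ∧ (p y ∧ not (q y))) + 2 ∎)
      where
      open ≤-Reasoning
      arith : ∀ a l → a + 2 * l + 2 ≡ a + 2 * (1 + l)
      arith = solve-∀
      go : ∀ u p q → χ (u ∧ p) ≤ χ (u ∧ (p ∧ not q)) + χ (u ∧ q)
      go false p     q     = z≤n
      go true  false q     = z≤n
      go true  true  true  = ≤-refl
      go true  true  false = ≤-refl

    dropˡ : ∀ ℓ x → cnt U + 2 * suc ℓ ≤ 2 * cnt (λ y → U y ∧ G x y) → cnt U + 2 * ℓ ≤ 2 * cnt (λ y → U y ∧ G′ x y)
    dropˡ ℓ x = drop ℓ (G x) (λ y → σ x == y) (cnt-unique _ λ y y′ h h′ →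
         trans (sym (==-≡ (proj₂ (∧-true {U y} h)))) (==-≡ (proj₂ (∧-true {U y′} h′))))

    dropʳ : ∀ ℓ y → cnt U + 2 * suc ℓ ≤ 2 * cnt (λ x → U x ∧ G x y) → cnt U + 2 * ℓ ≤ 2 * cnt (λ x → U x ∧ G′ x y)
    dropʳ ℓ y = drop ℓ (λ x → G x y) (λ x → σ x == y) (cnt-unique _ λ x x′ h h′ →
         BijOn.inj σbij x x′ (proj₁ (∧-true h)) (proj₁ (∧-true h′))
           (trans (==-≡ (proj₂ (∧-true {U x} h))) (sym (==-≡ (proj₂ (∧-true {U x′} h′))))))

    unpeel : ∀ {ℓ} → Factor U G′ ℓ → Factor U G (suc ℓ)
    unpeel {ℓ} rest = record { match = match′ ; bij = bij′ ; along = along′ ; disjoint = disjoint′ }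
      where
      module R = Factor rest
      match′ : Fin (suc ℓ) → Fin n → Fin n
      match′ zero    = σ
      match′ (suc i) = R.match i
      bij′ : ∀ i → BijOn U (match′ i)
      bij′ zero    = σbij
      bij′ (suc i) = R.bij i
      along′ : ∀ i x → U x ≡ true → G x (match′ i x) ≡ true
      along′ zero    x Ux = σalong x Ux
      along′ (suc i) x Ux = proj₁ (∧-true (R.along i x Ux))
      off : ∀ x y → G′ x y ≡ true → σ x ≢ y
      off x y h refl with ∧-true {G x y} h
      ... | _ , h′ rewrite ==-refl y = true≢false h′ refl
      disjoint′ : ∀ i j x → U x ≡ true → match′ i x ≡ match′ j x → i ≡ j
      disjoint′ zero    zero    x Ux eq = refl
      disjoint′ zero    (suc j) x Ux eq = contradiction eq (off x _ (R.along j x Ux))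
      disjoint′ (suc i) zero    x Ux eq = contradiction (sym eq) (off x _ (R.along i x Ux))
      disjoint′ (suc i) (suc j) x Ux eq = cong suc (R.disjoint i j x Ux eq)

  -- Removing a perfect matching lowers every degree by at most one, so a degree excess of ℓ over
  -- half of U leaves room for ℓ rounds.
  factor : ∀ {n} (U : Fin n → Bool) ℓ (G : Fin n → Fin n → Bool) →
           (∀ x → U x ≡ true → cnt U + 2 * ℓ ≤ 2 * cnt (λ y → U y ∧ G x y)) →
           (∀ y → U y ≡ true → cnt U + 2 * ℓ ≤ 2 * cnt (λ x → U x ∧ G x y)) → Factor U G ℓ
  factor U zero G rows cols = record { match = λ () ; bij = λ () ; along = λ () ; disjoint = λ () }
  factor U (suc ℓ) G rows cols = go (Matching.perfect-matching U G (λ x Ux → m+n≤o⇒m≤o _ (rows x Ux)) (λ x Ux → m+n≤o⇒m≤o _ (cols x Ux)))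
    where
    go : (∃ λ σ → BijOn U σ × ∀ x → U x ≡ true → G x (σ x) ≡ true) → Factor U G (suc ℓ)
    go (σ , bij , along) = unpeel (factor U ℓ G′ (λ x Ux → dropˡ ℓ x (rows x Ux)) (λ y Uy → dropʳ ℓ y (cols y Uy)))
      where open Peel U G bij along

  -- First-child, next-sibling encoding of a forest that hangs below a vertex not stored in it. The
  -- sign `s` is `true` when the edge is directed from that parent to `x`. Labels may repeat in this
  -- type; simplicity is imposed later by counting occurrences.
  data Forest (n : ℕ) : Set where
    ∅  : Forest n
    br : (s : Bool) (x : Fin n) (kids siblings : Forest n) → Forest n

  size : ∀ {n} → Forest n → ℕ
  size ∅ = 0
  size (br s x k r) = suc (size k + size r)

  -- Averaging tools and the inequalities of the almost-spanning phase

  -- Bernoulli's inequality (1 - m/ℓ)^L ≥ 1 - L m/ℓ for ℓ = ℓ′ + m, cleared of denominators.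
  power-loss : ∀ ℓ′ m L → (ℓ′ + m) ^ L * (ℓ′ + m) ≤ ℓ′ ^ L * (ℓ′ + m) + L * m * (ℓ′ + m) ^ L
  power-loss ℓ′ m zero = ≤-reflexive (arith ℓ′ m)
    where
    arith : ∀ a m → 1 * (a + m) ≡ 1 * (a + m) + 0
    arith = solve-∀
  power-loss ℓ′ m (suc L) = lin (L * m * m * (ℓ′ + m) ^ L) (*-monoʳ-≤ ℓ′ (power-loss ℓ′ m L)) (arith ℓ′ m L ((ℓ′ + m) ^ L) (ℓ′ ^ L))
    where
    arith : ∀ a m L p q → (a + m) * p * (a + m) + a * (q * (a + m) + L * m * p) + L * m * m * p
                        ≡ a * q * (a + m) + (1 + L) * m * ((a + m) * p) + a * (p * (a + m))
    arith = solve-∀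

  -- Of at least e + m candidates at most m lead to a vertex that is already used, so e remain, and
  -- the cheapest of these costs at most the e-th part of the total over all candidates.
  pick : ∀ {k n} (p : Fin k → Bool) (σ : Fin k → Fin n) (c : Fin k → ℕ) (U W : Fin n → Bool) m e →
         (∀ i → p i ≡ true → U (σ i) ≡ true) →
         (∀ i j → p i ≡ true → p j ≡ true → σ i ≡ σ j → i ≡ j) →
         (∀ x → W x ≡ true → U x ≡ true) → cnt U ≤ cnt W + m → e + m ≤ cnt p → 0 < e →
         ∃ λ i → p i ≡ true × W (σ i) ≡ true × c i * e ≤ ∑ (λ i → χ (p i) * c i)
  pick p σ c U W m e into inj W⊆U few many pos = go (min≤avg-on q c (<-≤-trans pos e≤q))
    where
    q : _ → Bool
    q i = p i ∧ W (σ i)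
    open ≤-Reasoning
    missing : cnt (λ x → U x ∧ not (W x)) ≤ m
    missing = +-cancelˡ-≤ (cnt W) _ _ (begin
      cnt W + cnt (λ x → U x ∧ not (W x))                    ≤⟨ +-monoˡ-≤ _ (cnt-mono λ x Wx → true-∧ (W⊆U x Wx) Wx) ⟩
      cnt (λ x → U x ∧ W x) + cnt (λ x → U x ∧ not (W x))    ≡⟨ cnt-split U W ⟨
      cnt U                                                  ≤⟨ few ⟩
      cnt W + m                                              ∎)
    e≤q : e ≤ cnt q
    e≤q = +-cancelʳ-≤ m _ _ (begin
      e + m                                       ≤⟨ many ⟩
      cnt p                                       ≡⟨ cnt-split p (W ∘ σ) ⟩
      cnt q + cnt (λ i → p i ∧ not (W (σ i)))     ≤⟨ +-monoʳ-≤ (cnt q) (≤-trans (cnt-inj _ (λ x → U x ∧ not (W x)) σ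
                                                       (λ i h → true-∧ (into i (proj₁ (∧-true h))) (proj₂ (∧-true {p i} h)))
                                                       (λ i j h h′ → inj i j (proj₁ (∧-true h)) (proj₁ (∧-true h′)))) missing) ⟩
      cnt q + m                                   ∎)
    go : (∃ λ i → q i ≡ true × c i * cnt q ≤ ∑ (λ i → χ (q i) * c i)) → _
    go (i , qi , le) = i , proj₁ (∧-true qi) , proj₂ (∧-true {p i} qi) , (begin
      c i * e                    ≤⟨ *-monoʳ-≤ (c i) e≤q ⟩
      c i * cnt q                ≤⟨ le ⟩
      ∑ (λ i → χ (q i) * c i)    ≤⟨ ∑-mono (λ i → *-monoˡ-≤ (c i) (drop (p i) (W (σ i)))) ⟩
      ∑ (λ i → χ (p i) * c i)    ∎)
      where
      drop : ∀ a b → χ (a ∧ b) ≤ χ a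
      drop false b = z≤n
      drop true  b = χ≤1 b

  -- A pair (u , c) is drawn by taking u uniform in U and then c uniform in Z u; some popular c has conditional
  -- expectation of G not much above the average of G.
  popular : ∀ {n} (U : Fin n → Bool) (Z : Fin n → Fin n → Bool) (G : Fin n → ℕ) z K →
    (∀ u → U u ≡ true → cnt (Z u) ≡ z) → (∀ u c → U u ≡ true → Z u c ≡ true → U c ≡ true) → 0 < cnt U * z → 1 ≤ K →
    ∃ λ c → U c ≡ true × z ≤ suc K * cnt (λ u → U u ∧ Z u c) ×
      cnt U * (K * ∑ (λ u → χ (U u ∧ Z u c) * G u)) ≤ suc K * (cnt (λ u → U u ∧ Z u c) * ∑ (λ u → χ (U u) * G u))
  popular {n} U Z G z K Zz Z⊆U pos K≥1 with any? (λ c → (U c Data.Bool.≟ true) ×-dec ((z ≤? suc K * cnt (λ u → U u ∧ Z u c)) ×-dec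
      (cnt U * (K * ∑ (λ u → χ (U u ∧ Z u c) * G u)) ≤? suc K * (cnt (λ u → U u ∧ Z u c) * ∑ (λ u → χ (U u) * G u)))))
  ... | yes r = r
  ... | no none = ⊥-elim (<-irrefl refl (<-≤-trans unpopular-small small))
    where
    open ≤-Reasoning
    N = cnt U
    e g : Fin n → ℕ
    e c = cnt (λ u → U u ∧ Z u c)
    g c = ∑ (λ u → χ (U u ∧ Z u c) * G u)
    S = ∑ (λ u → χ (U u) * G u)
    swap-sum : ∀ (H : Fin n → ℕ) → ∑ (λ c → ∑ (λ u → χ (U u ∧ Z u c) * H u)) ≡ z * ∑ (λ u → χ (U u) * H u)
    swap-sum H = begin-equality
      ∑ (λ c → ∑ (λ u → χ (U u ∧ Z u c) * H u))    ≡⟨ ∑-swap _ ⟩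
      ∑ (λ u → ∑ (λ c → χ (U u ∧ Z u c) * H u))    ≡⟨ ∑-cong (λ u → ∑-*ʳ (H u) (λ c → χ (U u ∧ Z u c))) ⟩
      ∑ (λ u → cnt (λ c → U u ∧ Z u c) * H u)      ≡⟨ ∑-cong (λ u → row u) ⟩
      ∑ (λ u → z * (χ (U u) * H u))                ≡⟨ ∑-*ˡ z _ ⟩
      z * ∑ (λ u → χ (U u) * H u)                  ∎
      where
      row : ∀ u → cnt (λ c → U u ∧ Z u c) * H u ≡ z * (χ (U u) * H u)
      row u with U u in eq
      ... | false = trans (cong (_* H u) (∑-zero {f = λ c → χ (false ∧ Z u c)} λ _ → refl)) (sym (*-zeroʳ z))
      ... | true rewrite Zz u eq = cong (z *_) (sym (+-identityʳ (H u)))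
    ∑g : ∑ g ≡ z * S
    ∑g = swap-sum G
    ∑e : ∑ e ≡ z * N
    ∑e = begin-equality
      ∑ e                                          ≡⟨ ∑-cong (λ c → cnt-χ1 (λ u → U u ∧ Z u c)) ⟩
      ∑ (λ c → ∑ (λ u → χ (U u ∧ Z u c) * 1))      ≡⟨ swap-sum (λ _ → 1) ⟩
      z * ∑ (λ u → χ (U u) * 1)                    ≡⟨ cong (z *_) (cnt-χ1 U) ⟨
      z * N                                        ∎
    good : Fin n → Bool
    good c = U c ∧ (z ≤ᵇ suc K * e c)
    outside : ∀ c → U c ≡ false → e c ≡ 0
    outside c Uc = ∑-zero λ u → off u
      where
      off : ∀ u → χ (U u ∧ Z u c) ≡ 0
      off u with U u in Uu | Z u c in Zuc
      ... | false | _ = refl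
      ... | true | false = refl
      ... | true | true = true≢false (Z⊆U u c Uu Zuc) Uc
    ≤ᵇ-true : ∀ a b → (a ≤ᵇ b) ≡ true → a ≤ b
    ≤ᵇ-true a b h = ≤ᵇ⇒≤ a b (subst Data.Bool.T (sym h) tt)
    ≤ᵇ-false : ∀ a b → (a ≤ᵇ b) ≡ false → b < a
    ≤ᵇ-false a b h = ≰⇒> λ le → subst Data.Bool.T h (≤⇒≤ᵇ le)
    -- One bound for all c: a popular c fails the wanted inequality by at least one, which is the
    -- summand `χ (good c)`, and an unpopular c is paid by z. Summed over c the bound leaves no
    -- popular c at all, yet the counts `e c` are too large in total for all of them to be
    -- unpopular.
    each : ∀ c → χ (good c) + suc K * (e c * S) ≤ N * (K * g c) + S * (z * χ (U c))
    each c with U c in Uc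
    ... | false rewrite outside c Uc | *-zeroʳ K = z≤n
    ... | true with z ≤ᵇ suc K * e c in h
    ...   | true = ≤-trans (≰⇒> λ le → none (c , Uc , ≤ᵇ-true z _ h , le)) (m≤m+n _ _)
    ...   | false = begin
      suc K * (e c * S)                  ≡⟨ *-assoc (suc K) (e c) S ⟨
      suc K * e c * S                    ≤⟨ *-monoˡ-≤ S (<⇒≤ (≤ᵇ-false z _ h)) ⟩
      z * S                              ≡⟨ cong (_* S) (*-identityʳ z) ⟨
      z * 1 * S                          ≡⟨ *-comm (z * 1) S ⟩
      S * (z * 1)                        ≤⟨ m≤n+m _ _ ⟩
      N * (K * g c) + S * (z * 1)        ∎
    summed : cnt good + suc K * (z * N * S) ≤ suc K * (z * N * S)
    summed = begin
      cnt good + suc K * (z * N * S)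
        ≡⟨ cong (λ h → cnt good + suc K * (h * S)) ∑e ⟨
      cnt good + suc K * (∑ e * S)
        ≡⟨ cong (cnt good +_) (trans (∑-*ˡ (suc K) _) (cong (suc K *_) (∑-*ʳ S e))) ⟨
      cnt good + ∑ (λ c → suc K * (e c * S))
        ≡⟨ ∑-+ _ _ ⟨
      ∑ (λ c → χ (good c) + suc K * (e c * S))
        ≤⟨ ∑-mono each ⟩
      ∑ (λ c → N * (K * g c) + S * (z * χ (U c)))
        ≡⟨ ∑-+ _ _ ⟩
      ∑ (λ c → N * (K * g c)) + ∑ (λ c → S * (z * χ (U c)))
        ≡⟨ cong₂ _+_ (trans (∑-*ˡ N _) (cong (N *_) (∑-*ˡ K g))) (trans (∑-*ˡ S _) (cong (S *_) (∑-*ˡ z _))) ⟩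
      N * (K * ∑ g) + S * (z * N)
        ≡⟨ cong (λ h → N * (K * h) + S * (z * N)) ∑g ⟩
      N * (K * (z * S)) + S * (z * N)
        ≡⟨ arith N K z S ⟩
      suc K * (z * N * S) ∎
      where
      arith : ∀ N K z S → N * (K * (z * S)) + S * (z * N) ≡ (1 + K) * (z * N * S)
      arith = solve-∀
    none-good : cnt good ≡ 0
    none-good = n≤0⇒n≡0 (+-cancelʳ-≤ (suc K * (z * N * S)) _ _ summed)
    bad : ∀ c → suc K * e c ≤ z * χ (U c)
    bad c with U c in Uc | z ≤ᵇ suc K * e c in h | ∑-≥ (χ ∘ good) c
    ... | false | _ | _ rewrite outside c Uc | *-zeroʳ K = z≤n
    ... | true | false | _ = subst (suc K * e c ≤_) (sym (*-identityʳ z)) (<⇒≤ (≤ᵇ-false z _ h))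
    ... | true | true | le = contradiction (subst (1 ≤_) none-good le) λ ()
    small : suc K * (z * N) ≤ z * N
    small = subst₂ _≤_ (trans (∑-*ˡ (suc K) e) (cong (suc K *_) ∑e)) (∑-*ˡ z _) (∑-mono bad)
    unpopular-small : z * N < suc K * (z * N)
    unpopular-small = <-≤-trans (m<n+m (z * N) (subst (0 <_) (*-comm N z) pos))
                        (+-monoʳ-≤ (z * N) (subst (_≤ K * (z * N)) (*-identityˡ (z * N)) (*-monoˡ-≤ (z * N) K≥1)))

  trim : ∀ {n} z (p : Fin n → Bool) → z ≤ cnt p → ∃ λ q → (∀ x → q x ≡ true → p x ≡ true) × cnt q ≡ z
  trim {n} z p le = go (cnt p ∸ z) p (m∸n+n≡m le)
    where
    go : ∀ k (p : Fin n → Bool) → k + z ≡ cnt p → ∃ λ (q : Fin n → Bool) → (∀ x → q x ≡ true → p x ≡ true) × cnt q ≡ z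
    go zero    p eq = p , (λ _ h → h) , sym eq
    go (suc k) p eq = shrink (cnt-pos p (subst (0 <_) eq (s≤s z≤n)))
      where
      shrink : (∃ λ x → p x ≡ true) → ∃ λ q → (∀ x → q x ≡ true → p x ≡ true) × cnt q ≡ z
      shrink (x , px) = rest (go k (p ∖ x) (Data.Nat.Properties.suc-injective (trans eq (cnt-∖ p x px))))
        where
        rest : (∃ λ q → (∀ y → q y ≡ true → (p ∖ x) y ≡ true) × cnt q ≡ z) → ∃ λ q → (∀ y → q y ≡ true → p y ≡ true) × cnt q ≡ z
        rest (q , sub , c) = q , (λ y h → ∖-⊆ p x y (sub y h)) , c

  Short : ∀ {n} → ℕ → Forest n → Set
  Short L ∅ = ⊤
  Short L (br s x k r) = size k ≤ L × Short L r

  -- Three losses of a factor 1 + 1/(4 D) each combine to at most 1 + 1/D: one from the popularity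
  -- of the centre, one from used vertices among the candidates (e against e′), one from used
  -- vertices along the matchings (q against p).
  block-arithmetic : ∀ {cst e e′ p q g N D S s SF} → cst * (e′ * p) ≤ g → N * (4 * D * g) ≤ suc (4 * D) * (e * S) → S ≤ s * q * SF →
    4 * D * e ≤ suc (4 * D) * e′ → 4 * D * q ≤ suc (4 * D) * p → 0 < e′ * p → 1 ≤ D → cst * (N * D) ≤ suc D * (s * SF)
  block-arithmetic {cst} {e} {e′} {p} {q} {g} {N} {suc d} {S} {s} {SF} h₁ h₂ h₃ h₄ h₅ pos _ =
    *-cancelˡ-≤ (64 * (D * D)) (begin
      64 * (D * D) * (cst * (N * D))                ≡⟨ a₁ D cst N ⟩
      64 * (D * D * D) * (N * cst)                  ≤⟨ *-cancelʳ-≤ _ _ (e′ * p) {{>-nonZero pos}} main ⟩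
      suc (4 * D) * suc (4 * D) * suc (4 * D) * (s * SF)   ≤⟨ *-monoˡ-≤ (s * SF) (m+n≤o⇒m≤o (suc (4 * D) * suc (4 * D) * suc (4 * D)) (≤-reflexive (a₂ d))) ⟩
      64 * (D * D) * suc D * (s * SF)               ≡⟨ *-assoc (64 * (D * D)) (suc D) (s * SF) ⟩
      64 * (D * D) * (suc D * (s * SF))             ∎)
    where
    open ≤-Reasoning
    D = suc d
    a₁ : ∀ D c N → 64 * (D * D) * (c * (N * D)) ≡ 64 * (D * D * D) * (N * c)
    a₁ = solve-∀
    a₂ : ∀ d → (1 + 4 * (1 + d)) * (1 + 4 * (1 + d)) * (1 + 4 * (1 + d)) + (3 + 20 * d + 16 * (d * d)) ≡ 64 * ((1 + d) * (1 + d)) * (1 + (1 + d))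
    a₂ = solve-∀
    main : 64 * (D * D * D) * (N * cst) * (e′ * p) ≤ suc (4 * D) * suc (4 * D) * suc (4 * D) * (s * SF) * (e′ * p)
    main = begin
      64 * (D * D * D) * (N * cst) * (e′ * p)
        ≡⟨ b₁ D N cst (e′ * p) ⟩
      16 * (D * D) * (N * (4 * D * (cst * (e′ * p))))
        ≤⟨ *-monoʳ-≤ (16 * (D * D)) (*-monoʳ-≤ N (*-monoʳ-≤ (4 * D) h₁)) ⟩
      16 * (D * D) * (N * (4 * D * g))
        ≤⟨ *-monoʳ-≤ (16 * (D * D)) (≤-trans h₂ (*-monoʳ-≤ (suc (4 * D)) (*-monoʳ-≤ e h₃))) ⟩
      16 * (D * D) * (suc (4 * D) * (e * (s * q * SF)))
        ≡⟨ b₂ D e q s SF ⟩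
      suc (4 * D) * (s * SF) * (4 * D * e * (4 * D * q))
        ≤⟨ *-monoʳ-≤ (suc (4 * D) * (s * SF)) (*-mono-≤ h₄ h₅) ⟩
      suc (4 * D) * (s * SF) * (suc (4 * D) * e′ * (suc (4 * D) * p))
        ≡⟨ b₃ D e′ p s SF ⟩
      suc (4 * D) * suc (4 * D) * suc (4 * D) * (s * SF) * (e′ * p) ∎
      where
      b₁ : ∀ D N c x → 64 * (D * D * D) * (N * c) * x ≡ 16 * (D * D) * (N * (4 * D * (c * x)))
      b₁ = solve-∀
      b₂ : ∀ D e q s S → 16 * (D * D) * ((1 + 4 * D) * (e * (s * q * S))) ≡ (1 + 4 * D) * (s * S) * (4 * D * e * (4 * D * q))
      b₂ = solve-∀
      b₃ : ∀ D e p s S → (1 + 4 * D) * (s * S) * ((1 + 4 * D) * e * ((1 + 4 * D) * p)) ≡ (1 + 4 * D) * (1 + 4 * D) * (1 + 4 * D) * (s * S) * (e * p)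
      b₃ = solve-∀

  -- Second-order bound (1 - e/b)^q ≤ 1 - q e/b + q² e²/b² for b = x + e, multiplied by b^(q + 2).
  taylor : ∀ q x e → x ^ q * ((x + e) * (x + e)) + q * e * ((x + e) * (x + e) ^ q) ≤ (x + e) * (x + e) * (x + e) ^ q + q * q * (e * e) * (x + e) ^ q
  taylor zero x e = ≤-reflexive (arith ((x + e) * (x + e)))
    where
    arith : ∀ b → 1 * b + 0 ≡ b * 1 + 0
    arith = solve-∀
  taylor (suc q) x e = lin (e * e * (x + e) ^ q * ((q + 1) * x + (q * q + q + 1) * e)) (*-monoʳ-≤ x (taylor q x e)) (arith q x e ((x + e) ^ q) (x ^ q))
    where
    arith : ∀ q x e b y → x * y * ((x + e) * (x + e)) + (1 + q) * e * ((x + e) * ((x + e) * b))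
                            + x * ((x + e) * (x + e) * b + q * q * (e * e) * b) + e * e * b * ((q + 1) * x + (q * q + q + 1) * e)
                        ≡ (x + e) * (x + e) * ((x + e) * b) + (1 + q) * (1 + q) * (e * e) * ((x + e) * b)
                            + x * (y * ((x + e) * (x + e)) + q * e * ((x + e) * b))
    arith = solve-∀

  -- `taylor` for the decrement e = 2 M - h, which is at most 2 M. The hypothesis `N ≤ b` is what
  -- turns the quadratic error, of order b^j, into a multiple of b^(1 + j) / N.
  potential-term : ∀ j b b′ h M N → b′ + 2 * M ≡ b + h → h ≤ M → N ≤ b → 0 < N →
    N * b′ ^ (2 + j) + 2 * (2 + j) * M * (N * b ^ (1 + j)) ≤ N * b ^ (2 + j) + (2 + j) * (N * (h * b ^ (1 + j))) + 4 * ((2 + j) * (2 + j) * (M * M)) * b ^ (1 + j)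
  potential-term j b b′ h M N eq h≤M N≤b N>0 = *-cancelˡ-≤ b {{>-nonZero b>0}} (begin
    b * (N * b′ ^ q + 2 * q * M * (N * b ^ (1 + j)))
      ≡⟨ arith₁ b N (b′ ^ q) q (b ^ (1 + j)) M ⟩
    N * (b * b′ ^ q) + q * (2 * M) * (N * (b * b ^ (1 + j)))
      ≡⟨ cong (λ z → N * (b * b′ ^ q) + q * z * (N * (b * b ^ (1 + j)))) (sym e+h) ⟩
    N * (b * b′ ^ q) + q * (e + h) * (N * (b * b ^ (1 + j)))
      ≡⟨ arith₂ N (b * b′ ^ q) q e h (b * b ^ (1 + j)) ⟩
    N * (b * b′ ^ q + q * e * (b * b ^ (1 + j))) + q * (N * h) * (b * b ^ (1 + j))
      ≤⟨ +-monoˡ-≤ (q * (N * h) * (b * b ^ (1 + j))) (*-monoʳ-≤ N core) ⟩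
    N * (b * (b * b ^ (1 + j)) + q * q * (e * e) * b ^ (1 + j)) + q * (N * h) * (b * b ^ (1 + j))
      ≡⟨ arith₄ N (b * (b * b ^ (1 + j))) (q * q * (e * e)) (b ^ (1 + j)) (q * (N * h) * (b * b ^ (1 + j))) ⟩
    N * (b * (b * b ^ (1 + j))) + q * (N * h) * (b * b ^ (1 + j)) + N * (q * q * (e * e)) * b ^ (1 + j)
      ≤⟨ +-monoʳ-≤ (N * (b * (b * b ^ (1 + j))) + q * (N * h) * (b * b ^ (1 + j))) (*-monoˡ-≤ (b ^ (1 + j)) (*-mono-≤ N≤b (*-monoʳ-≤ (q * q) (*-mono-≤ e≤2M e≤2M)))) ⟩
    N * (b * (b * b ^ (1 + j))) + q * (N * h) * (b * b ^ (1 + j)) + b * (q * q * (2 * M * (2 * M))) * b ^ (1 + j)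
      ≡⟨ arith₃ N b (b ^ (1 + j)) q h M ⟩
    b * (N * (b * b ^ (1 + j)) + q * (N * (h * b ^ (1 + j))) + 4 * (q * q * (M * M)) * b ^ (1 + j)) ∎)
    where
    open ≤-Reasoning
    q = 2 + j
    e = 2 * M ∸ h
    h≤2M : h ≤ 2 * M
    h≤2M = ≤-trans h≤M (m≤m+n M _)
    e+h : e + h ≡ 2 * M
    e+h = m∸n+n≡m h≤2M
    e≤2M : e ≤ 2 * M
    e≤2M = m∸n≤m (2 * M) h
    b≡ : b ≡ b′ + e
    b≡ = +-cancelʳ-≡ h b (b′ + e) (trans (sym eq) (trans (cong (b′ +_) (sym e+h)) (sym (+-assoc b′ e h))))
    b>0 : 0 < b
    b>0 = <-≤-trans N>0 N≤b
    core : b * b′ ^ q + q * e * (b * b ^ (1 + j)) ≤ b * (b * b ^ (1 + j)) + q * q * (e * e) * b ^ (1 + j)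
    core = *-cancelʳ-≤ _ _ b {{>-nonZero b>0}} (subst (λ z → (z * b′ ^ q + q * e * (z * z ^ (1 + j))) * z ≤ (z * (z * z ^ (1 + j)) + q * q * (e * e) * z ^ (1 + j)) * z) (sym b≡)
      (subst₂ _≤_ (a₁ (b′ ^ q) (b′ + e) (q * e) ((b′ + e) ^ j)) (a₂ (b′ + e) (q * q * (e * e)) ((b′ + e) ^ j)) (taylor q b′ e)))
      where
      a₁ : ∀ y b k p → y * (b * b) + k * (b * (b * (b * p))) ≡ (b * y + k * (b * (b * p))) * b
      a₁ = solve-∀
      a₂ : ∀ b k p → b * b * (b * (b * p)) + k * (b * (b * p)) ≡ (b * (b * (b * p)) + k * (b * p)) * b
      a₂ = solve-∀
    arith₁ : ∀ b N y q p M → b * (N * y + 2 * q * M * (N * p)) ≡ N * (b * y) + q * (2 * M) * (N * (b * p))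
    arith₁ = solve-∀
    arith₂ : ∀ N y q e h w → N * y + q * (e + h) * (N * w) ≡ N * (y + q * e * w) + q * (N * h) * w
    arith₂ = solve-∀
    arith₄ : ∀ N x c p y → N * (x + c * p) + y ≡ N * x + y + N * c * p
    arith₄ = solve-∀
    arith₃ : ∀ N b p q h M → N * (b * (b * p)) + q * (N * h) * (b * p) + b * (q * q * (2 * M * (2 * M))) * p ≡
             b * (N * (b * p) + q * (N * (h * p)) + 4 * (q * q * (M * M)) * p)
    arith₃ = solve-∀

  -- The potential of a block is weighed against the ideal one: with Θ = N P, one step changes Ψ / Θ ^ q by at most a factor 1.
  potential-step : ∀ q D N N′ M P Ψ Ψ′ R H Sa → N ≡ N′ + M → N′ ≤ P →
    N * Ψ′ + 2 * q * M * (N * R) ≤ N * Ψ + q * (N * H) + 4 * (q * q * (M * M)) * R →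
    D * (N * H) ≤ (D + 1) * (M * Sa) → Sa + Ψ ≡ 2 * (N * R) → N * R ≤ Ψ → 4 * (q * (M * D)) ≤ N → 3 * P ≤ D * N′ → 0 < N′ → 0 < D →
    Ψ′ * (N * P) ^ q ≤ Ψ * (N′ * (P + M)) ^ q
  potential-step q D N N′ M P Ψ Ψ′ R H Sa N≡ N′≤P h₁ h₂ h₃ h₄ h₅ h₆ N′>0 D>0 =
    *-cancelʳ-≤ (Ψ′ * Θ ^ q) (Ψ * Θ′ ^ q) (Θ * D) {{>-nonZero (*-mono-≤ Θ>0 D>0)}} (lin 0
      (+-mono-≤ (+-mono-≤ (*-monoʳ-≤ (P * Θ ^ q) main) (*-monoʳ-≤ (D * Ψ) bern)) (*-monoʳ-≤ (q * M * Ψ * Θ ^ q) DG))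
      (arith D N P Ψ Ψ′ q M G (Θ ^ q) (Θ′ ^ q)))
    where
    open ≤-Reasoning
    Θ = N * P
    Θ′ = N′ * (P + M)
    G = P ∸ N′
    P≡ : P ≡ N′ + G
    P≡ = sym (m+[n∸m]≡n N′≤P)
    N>0 : 0 < N
    N>0 = subst (0 <_) (sym N≡) (<-≤-trans N′>0 (m≤m+n N′ M))
    P>0 : 0 < P
    P>0 = <-≤-trans N′>0 N′≤P
    Θ>0 : 0 < Θ
    Θ>0 = *-mono-≤ N>0 P>0
    DG : D * G + 3 * P ≤ D * P
    DG = begin
      D * G + 3 * P     ≤⟨ +-monoʳ-≤ (D * G) h₆ ⟩
      D * G + D * N′    ≡⟨ ar D G N′ ⟩
      D * (N′ + G)      ≡⟨ cong (D *_) P≡ ⟨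
      D * P             ∎
      where
      ar : ∀ D G N → D * G + D * N ≡ D * (N + G)
      ar = solve-∀
    Θ≡ : Θ ≡ Θ′ + M * G
    Θ≡ = subst₂ (λ x y → x * y ≡ N′ * (y + M) + M * G) (sym N≡) (sym P≡) (ar N′ M G)
      where
      ar : ∀ N M G → (N + M) * (N + G) ≡ N * (N + G + M) + M * G
      ar = solve-∀
    bern : Θ ^ q * Θ ≤ Θ′ ^ q * Θ + q * (M * G) * Θ ^ q
    bern = subst (λ z → z ^ q * z ≤ Θ′ ^ q * z + q * (M * G) * z ^ q) (sym Θ≡) (power-loss Θ′ (M * G) q)
    -- Up to a relative error of 3/D, Ψ loses the ideal fraction q M/N. The error comes from the
    -- factor (D + 1)/D in `h₂` and from the second-order term, controlled by `h₅`. The growth of P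
    -- to P + M pays for it, since 3 P ≤ D N′.
    main : D * (N * Ψ′) + q * (M * D) * Ψ ≤ D * (N * Ψ) + 3 * (q * M * Ψ)
    main = lin (q * M * Ψ) (+-mono-≤ (+-mono-≤ (+-mono-≤ (*-monoʳ-≤ D h₁) (*-monoʳ-≤ q h₂)) (*-monoʳ-≤ (q * M * R) h₅))
             (+-mono-≤ (*-monoʳ-≤ (3 * (q * M)) h₄) (≤-reflexive (cong (q * (D + 1) * M *_) h₃))))
           (ar D N Ψ Ψ′ q M R H Sa)
      where
      ar : ∀ D N Ψ Ψ′ q M R H S →
        D * (N * Ψ′) + q * (M * D) * Ψ +
          ((D * (N * Ψ + q * (N * H) + 4 * (q * q * (M * M)) * R) + q * ((D + 1) * (M * S)) + q * M * R * N) + (3 * (q * M) * Ψ + q * (D + 1) * M * (2 * (N * R)))) + q * M * Ψ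
        ≡ D * (N * Ψ) + 3 * (q * M * Ψ) +
          ((D * (N * Ψ′ + 2 * q * M * (N * R)) + q * (D * (N * H)) + q * M * R * (4 * (q * (M * D)))) + (3 * (q * M) * (N * R) + q * (D + 1) * M * (S + Ψ)))
      ar = solve-∀
    arith : ∀ D N P Ψ Ψ′ q M G t t′ →
      Ψ′ * t * (N * P * D) + (P * t * (D * (N * Ψ) + 3 * (q * M * Ψ)) + D * Ψ * (t′ * (N * P) + q * (M * G) * t) + q * M * Ψ * t * (D * P)) + 0
      ≡ Ψ * t′ * (N * P * D) + (P * t * (D * (N * Ψ′) + q * (M * D) * Ψ) + D * Ψ * (t * (N * P)) + q * M * Ψ * t * (D * G + 3 * P))
    arith = solve-∀

  ^-cancelˡ-≤ : ∀ q {x y} → x ^ suc q ≤ y ^ suc q → x ≤ y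
  ^-cancelˡ-≤ q {x} {y} le = ≮⇒≥ λ lt → <⇒≱ (^-monoˡ-< (suc q) lt) le

  n<2^[1+log] : ∀ n → n < 2 ^ suc ⌊log₂ n ⌋
  n<2^[1+log] n = ≰⇒> λ le → 1+n≰n (subst (_≤ ⌊log₂ n ⌋) (⌊log₂[2^n]⌋≡n (suc ⌊log₂ n ⌋)) (⌊log₂⌋-mono-≤ le))

  -- (1 + 1 / k) ^ k ≥ 2.
  doubling : ∀ k → 1 ≤ k → 2 * k ^ k ≤ suc k ^ k
  doubling k k≥1 = go k refl
    where
    bernoulli : ∀ j → k ^ j * k + j * k ^ j ≤ suc k ^ j * k
    bernoulli zero = ≤-reflexive (+-identityʳ _)
    bernoulli (suc j) = lin (j * k ^ j) (*-monoʳ-≤ (suc k) (bernoulli j)) (arith k j (k ^ j) (suc k ^ j))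
      where
      arith : ∀ k j p r → k * p * k + (1 + j) * (k * p) + (1 + k) * (r * k) + j * p ≡ (1 + k) * r * k + (1 + k) * (p * k + j * p)
      arith = solve-∀
    go : ∀ j → j ≡ k → 2 * k ^ k ≤ suc k ^ k
    go j refl = *-cancelʳ-≤ _ _ k {{>-nonZero k≥1}} (subst (_≤ suc k ^ k * k) (arith k (k ^ k)) (bernoulli k))
      where
      arith : ∀ k p → p * k + k * p ≡ 2 * p * k
      arith = solve-∀

  ^-distrib-* : ∀ a b l → (a * b) ^ l ≡ a ^ l * b ^ l
  ^-distrib-* a b zero    = refl
  ^-distrib-* a b (suc l) = trans (cong (a * b *_) (^-distrib-* a b l)) (arith a b (a ^ l) (b ^ l))
    where
    arith : ∀ a b x y → a * b * (x * y) ≡ a * x * (b * y)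
    arith = solve-∀

  -- With an exponent of k l, a factor 2^l is absorbed by raising the base from k to k + 1. This is
  -- how a union bound over at most 2^l tests becomes affordable.
  log-growth : ∀ k l → 1 ≤ k → 2 ^ l * k ^ (k * l) ≤ suc k ^ (k * l)
  log-growth k l k≥1 = begin
    2 ^ l * k ^ (k * l)      ≡⟨ cong (2 ^ l *_) (^-*-assoc k k l) ⟨
    2 ^ l * (k ^ k) ^ l      ≡⟨ ^-distrib-* 2 (k ^ k) l ⟨
    (2 * k ^ k) ^ l          ≤⟨ ^-monoˡ-≤ l (doubling k k≥1) ⟩
    (suc k ^ k) ^ l          ≡⟨ ^-*-assoc (suc k) k l ⟩
    suc k ^ (k * l)          ∎
    where open ≤-Reasoning

  density-arithmetic : ∀ A b b₀ N N₀ → 0 < A → 0 < N₀ → b * N₀ * (18 * A * (18 * A)) ≤ suc (18 * A) * suc (18 * A) * b₀ * N →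
                       4 * A * b₀ + 3 * N₀ ≤ 6 * A * N₀ → 4 * A * b + 2 * N ≤ 6 * A * N
  density-arithmetic A b b₀ N N₀ A>0 N₀>0 h h₀ = *-cancelʳ-≤ _ _ (N₀ * (18 * A * (18 * A))) {{>-nonZero (*-mono-≤ N₀>0 (*-mono-≤ (*-mono-≤ (s≤s (z≤n {17})) A>0) (*-mono-≤ (s≤s (z≤n {17})) A>0)))}}
    (lin (N * N₀ * (108 * A * A + 102 * A + 3)) (+-mono-≤ (*-monoʳ-≤ (4 * A) h) (*-monoʳ-≤ (suc (18 * A) * suc (18 * A) * N) h₀)) (arith A b b₀ N N₀))
    where
    arith : ∀ A b b₀ N N₀ → (4 * A * b + 2 * N) * (N₀ * (18 * A * (18 * A))) + (4 * A * ((1 + 18 * A) * (1 + 18 * A) * b₀ * N) + (1 + 18 * A) * (1 + 18 * A) * N * (6 * A * N₀))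
                                     + N * N₀ * (108 * A * A + 102 * A + 3)
                                 ≡ 6 * A * N * (N₀ * (18 * A * (18 * A))) + (4 * A * (b * N₀ * (18 * A * (18 * A))) + (1 + 18 * A) * (1 + 18 * A) * N * (4 * A * b₀ + 3 * N₀))
    arith = solve-∀

  -- Cutting a rooted forest into blocks of bounded size

  Item : ℕ → Set
  Item n = Fin n × Forest n

  module _ {n : ℕ} where

    -- The first index is the vertex below which the forest hangs; p is always the parent and y the
    -- child, whatever the sign.
    data EdgeOf (s : Bool) (p y : Fin n) : Fin n → Forest n → Set where
      top : ∀ {k r} → EdgeOf s p y p (br s y k r)
      kid : ∀ {s′ x q k r} → EdgeOf s p y x k → EdgeOf s p y q (br s′ x k r)
      sib : ∀ {s′ x q k r} → EdgeOf s p y q r → EdgeOf s p y q (br s′ x k r)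

    occ : Forest n → Fin n → ℕ
    occ ∅ y = 0
    occ (br s x k r) y = χ (x == y) + (occ k y + occ r y)

    roots : Forest n → ℕ
    roots ∅ = 0
    roots (br s x k r) = suc (roots r)

    -- Bounds the children of the vertices of the forest. The top vertices are children of an outer
    -- vertex, so their number is bounded separately.
    Bounded : ℕ → Forest n → Set
    Bounded Δ ∅ = ⊤
    Bounded Δ (br s x k r) = roots k ≤ Δ × Bounded Δ k × Bounded Δ r

    occ-top : ∀ s x k r → 1 ≤ occ (br s x k r) x
    occ-top s x k r rewrite ==-refl x = s≤s z≤n

    occ-kid : ∀ s x k r y → occ k y ≤ occ (br s x k r) y
    occ-kid s x k r y = ≤-trans (m≤m+n (occ k y) (occ r y)) (m≤n+m _ (χ (x == y)))

    occ-sib : ∀ s x k r y → occ r y ≤ occ (br s x k r) y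
    occ-sib s x k r y = ≤-trans (m≤n+m (occ r y) (occ k y)) (m≤n+m _ (χ (x == y)))

    EdgeOf-occ : ∀ {s p y q t} → EdgeOf s p y q t → 1 ≤ occ t y × (p ≡ q ⊎ 1 ≤ occ t p)
    EdgeOf-occ {t = br s y k r} top = occ-top s y k r , inj₁ refl
    EdgeOf-occ {p = p} {y} {t = br s x k r} (kid e) with EdgeOf-occ e
    ... | y∈ , inj₁ refl = ≤-trans y∈ (occ-kid s x k r y) , inj₂ (occ-top s x k r)
    ... | y∈ , inj₂ p∈ = ≤-trans y∈ (occ-kid s x k r y) , inj₂ (≤-trans p∈ (occ-kid s x k r p))
    EdgeOf-occ {p = p} {y} {t = br s x k r} (sib e) with EdgeOf-occ e
    ... | y∈ , inj₁ eq = ≤-trans y∈ (occ-sib s x k r y) , inj₁ eq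
    ... | y∈ , inj₂ p∈ = ≤-trans y∈ (occ-sib s x k r y) , inj₂ (≤-trans p∈ (occ-sib s x k r p))

    occW : List (Item n) → Fin n → ℕ
    occW [] y = 0
    occW ((q , t) ∷ ws) y = occ t y + occW ws y

    sizeW : List (Item n) → ℕ
    sizeW [] = 0
    sizeW ((q , t) ∷ ws) = size t + sizeW ws

    occW-++ : ∀ xs ys y → occW (xs ++ ys) y ≡ occW xs y + occW ys y
    occW-++ [] ys y = refl
    occW-++ ((q , t) ∷ xs) ys y = trans (cong (occ t y +_) (occW-++ xs ys y)) (sym (+-assoc (occ t y) _ _))

    sizeW-++ : ∀ xs ys → sizeW (xs ++ ys) ≡ sizeW xs + sizeW ys
    sizeW-++ [] ys = refl
    sizeW-++ ((q , t) ∷ xs) ys = trans (cong (size t +_) (sizeW-++ xs ys)) (sym (+-assoc (size t) _ _))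

    EdgeIn : Bool → Fin n → Fin n → List (Item n) → Set
    EdgeIn s p y = Any (λ it → EdgeOf s p y (proj₁ it) (proj₂ it))

    -- A splitting of the forest t below q into a part that is embedded now and a list of items that stay pending.
    record Split (q : Fin n) (t t′ : Forest n) (R : List (Item n)) : Set where
      field
        occ≡    : ∀ y → occ t y ≡ occ t′ y + occW R y
        size≡   : size t ≡ size t′ + sizeW R
        edge    : ∀ s p y → EdgeOf s p y q t → EdgeOf s p y q t′ ⊎ EdgeIn s p y R
        parents : All (λ it → proj₁ it ≡ q ⊎ 1 ≤ occ t′ (proj₁ it)) R

    whole : ∀ q t → Split q t t []
    whole q t = record { occ≡ = λ y → sym (+-identityʳ _) ; size≡ = sym (+-identityʳ _) ; edge = λ s p y e → inj₁ e ; parents = [] }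

    module Cut (L : ℕ) where

      -- Bottom-up cutting: a vertex is cut off as soon as it and what is left of the trees below it
      -- reach L vertices. `load` counts what is left, `prune` is what is left, and `rest` lists the
      -- trees cut off, each with its parent.
      load : Forest n → ℕ
      load ∅ = 0
      load (br s x k r) = (if L ≤ᵇ suc (load k) then 0 else suc (load k)) + load r

      prune : Forest n → Forest n
      prune ∅ = ∅
      prune (br s x k r) = if L ≤ᵇ suc (load k) then prune r else br s x (prune k) (prune r)

      rest : Fin n → Forest n → List (Item n)
      rest q ∅ = []
      rest q (br s x k r) = if L ≤ᵇ suc (load k) then (q , br s x k ∅) ∷ rest q r else rest x k ++ rest q r

      -- The first block taken from a heavy item has at least L vertices. Only the image of its root
      -- escapes cost control, and the lower bound on the block makes that root negligible.
      data Heavy : Item n → Set where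
        heavy : ∀ {q s x k} → L ≤ suc (load k) → Heavy (q , br s x k ∅)

      size-prune : ∀ t → size (prune t) ≡ load t
      size-prune ∅ = refl
      size-prune (br s x k r) with L ≤ᵇ suc (load k)
      ... | true = size-prune r
      ... | false = cong suc (cong₂ _+_ (size-prune k) (size-prune r))

      Short-prune : ∀ t → Short L (prune t)
      Short-prune ∅ = tt
      Short-prune (br s x k r) with L ≤ᵇ suc (load k) in h
      ... | true = Short-prune r
      ... | false = subst (_≤ L) (sym (size-prune k)) (<⇒≤ (<⇒≤ (≰⇒> λ le → subst Data.Bool.T h (≤⇒≤ᵇ le)))) , Short-prune r

      -- Trees that are not cut off have fewer than L vertices left, so under a degree bound Δ a
      -- block has at most Δ L + 1 vertices.
      load≤ : ∀ t → load t ≤ roots t * L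
      load≤ ∅ = z≤n
      load≤ (br s x k r) with L ≤ᵇ suc (load k) in h
      ... | true = ≤-trans (load≤ r) (m≤n+m _ _)
      ... | false = +-mono-≤ (<⇒≤ (≰⇒> λ le → subst Data.Bool.T h (≤⇒≤ᵇ le))) (load≤ r)

      rest-heavy : ∀ q t → All Heavy (rest q t)
      rest-heavy q ∅ = []
      rest-heavy q (br s x k r) with L ≤ᵇ suc (load k) in h
      ... | true = heavy (≤ᵇ⇒≤ L _ (subst Data.Bool.T (sym h) tt)) ∷ rest-heavy q r
      ... | false = All.++⁺ (rest-heavy x k) (rest-heavy q r)

      rest-Bounded : ∀ {Δ} q t → Bounded Δ t → All (Bounded Δ ∘ proj₂) (rest q t)
      rest-Bounded q ∅ b = []
      rest-Bounded q (br s x k r) (k≤ , bk , b) with L ≤ᵇ suc (load k)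
      ... | true = (k≤ , bk , tt) ∷ rest-Bounded q r b
      ... | false = All.++⁺ (rest-Bounded x k bk) (rest-Bounded q r b)

      cut : ∀ q t → Split q t (prune t) (rest q t)
      cut q ∅ = record { occ≡ = λ y → refl ; size≡ = refl ; edge = λ s p y () ; parents = [] }
      cut q (br s x k r) with L ≤ᵇ suc (load k) | cut x k | cut q r
      ... | true | _ | S = record
        { occ≡ = λ y → trans (cong (χ (x == y) +_) (cong (occ k y +_) (S.occ≡ y))) (ar (χ (x == y)) (occ k y) (occ (prune r) y) (occW (rest q r) y))
        ; size≡ = trans (cong (λ z → suc (size k + z)) S.size≡) (ar₂ (size k) (size (prune r)) (sizeW (rest q r)))
        ; edge = e
        ; parents = inj₁ refl ∷ S.parents }
        where
        module S = Split S
        ar : ∀ a b c d → a + (b + (c + d)) ≡ c + (a + (b + 0) + d)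
        ar = solve-∀
        ar₂ : ∀ b c d → 1 + (b + (c + d)) ≡ c + ((1 + (b + 0)) + d)
        ar₂ = solve-∀
        e : ∀ s′ p y → EdgeOf s′ p y q (br s x k r) → EdgeOf s′ p y q (prune r) ⊎ EdgeIn s′ p y ((q , br s x k ∅) ∷ rest q r)
        e s′ p y top = inj₂ (here top)
        e s′ p y (kid z) = inj₂ (here (kid z))
        e s′ p y (sib z) with S.edge s′ p y z
        ... | inj₁ a = inj₁ a
        ... | inj₂ b = inj₂ (there b)
      ... | false | K | S = record
        { occ≡ = λ y → trans (cong (χ (x == y) +_) (cong₂ _+_ (K.occ≡ y) (S.occ≡ y)))
                   (trans (ar (χ (x == y)) (occ (prune k) y) (occW (rest x k) y) (occ (prune r) y) (occW (rest q r) y)) (cong (χ (x == y) + (occ (prune k) y + occ (prune r) y) +_) (sym (occW-++ (rest x k) (rest q r) y))))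
        ; size≡ = trans (cong suc (cong₂ _+_ K.size≡ S.size≡)) (trans (ar 1 (size (prune k)) (sizeW (rest x k)) (size (prune r)) (sizeW (rest q r))) (cong (suc (size (prune k) + size (prune r)) +_) (sym (sizeW-++ (rest x k) (rest q r)))))
        ; edge = e
        ; parents = All.++⁺ (All.map (λ {it} → fromk {it}) K.parents) (All.map (λ {it} → fromr {it}) S.parents) }
        where
        module K = Split K
        module S = Split S
        ar : ∀ a b c d e → a + ((b + c) + (d + e)) ≡ a + (b + d) + (c + e)
        ar = solve-∀
        fromk : ∀ {it : Item n} → proj₁ it ≡ x ⊎ 1 ≤ occ (prune k) (proj₁ it) → proj₁ it ≡ q ⊎ 1 ≤ occ (br s x (prune k) (prune r)) (proj₁ it)
        fromk (inj₁ refl) = inj₂ (occ-top s x (prune k) (prune r))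
        fromk {it} (inj₂ h) = inj₂ (≤-trans h (occ-kid s x (prune k) (prune r) (proj₁ it)))
        fromr : ∀ {it : Item n} → proj₁ it ≡ q ⊎ 1 ≤ occ (prune r) (proj₁ it) → proj₁ it ≡ q ⊎ 1 ≤ occ (br s x (prune k) (prune r)) (proj₁ it)
        fromr (inj₁ eq) = inj₁ eq
        fromr {it} (inj₂ h) = inj₂ (≤-trans h (occ-sib s x (prune k) (prune r) (proj₁ it)))
        e : ∀ s′ p y → EdgeOf s′ p y q (br s x k r) → EdgeOf s′ p y q (br s x (prune k) (prune r)) ⊎ EdgeIn s′ p y (rest x k ++ rest q r)
        e s′ p y top = inj₁ top
        e s′ p y (kid z) with K.edge s′ p y z
        ... | inj₁ a = inj₁ (kid a)
        ... | inj₂ b = inj₂ (Any.++⁺ˡ b)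
        e s′ p y (sib z) with S.edge s′ p y z
        ... | inj₁ a = inj₁ (sib a)
        ... | inj₂ b = inj₂ (Any.++⁺ʳ (rest x k) b)

      cut-item : ∀ q s x k → Split q (br s x k ∅) (br s x (prune k) ∅) (rest x k)
      cut-item q s x k = record
        { occ≡ = λ y → trans (cong (λ z → χ (x == y) + (z + 0)) (K.occ≡ y)) (ar (χ (x == y)) (occ (prune k) y) _)
        ; size≡ = trans (cong (λ z → suc (z + 0)) K.size≡) (ar 1 (size (prune k)) _)
        ; edge = e
        ; parents = All.map (λ {it} → fromk {it}) K.parents }
        where
        module K = Split (cut x k)
        ar : ∀ a b c → a + (b + c + 0) ≡ a + (b + 0) + c
        ar = solve-∀
        fromk : ∀ {it : Item n} → proj₁ it ≡ x ⊎ 1 ≤ occ (prune k) (proj₁ it) → proj₁ it ≡ q ⊎ 1 ≤ occ (br s x (prune k) ∅) (proj₁ it)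
        fromk (inj₁ refl) = inj₂ (occ-top s x (prune k) ∅)
        fromk {it} (inj₂ h) = inj₂ (≤-trans h (occ-kid s x (prune k) ∅ (proj₁ it)))
        e : ∀ s′ p y → EdgeOf s′ p y q (br s x k ∅) → EdgeOf s′ p y q (br s x (prune k) ∅) ⊎ EdgeIn s′ p y (rest x k)
        e s′ p y top = inj₁ top
        e s′ p y (kid z) with K.edge s′ p y z
        ... | inj₁ a = inj₁ (kid a)
        ... | inj₂ b = inj₂ b

    -- The splitting used when vertices are embedded one at a time.
    single : ∀ q s x k r → Split q (br s x k r) (br s x ∅ ∅) ((x , k) ∷ (q , r) ∷ [])
    single q s x k r = record
      { occ≡ = λ y → ar (χ (x == y)) (occ k y) (occ r y)
      ; size≡ = ar 1 (size k) (size r)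
      ; edge = e
      ; parents = inj₂ (occ-top s x ∅ ∅) ∷ inj₁ refl ∷ [] }
      where
      ar : ∀ a b c → a + (b + c) ≡ a + 0 + (b + (c + 0))
      ar = solve-∀
      e : ∀ s′ p y → EdgeOf s′ p y q (br s x k r) → EdgeOf s′ p y q (br s x ∅ ∅) ⊎ EdgeIn s′ p y ((x , k) ∷ (q , r) ∷ [])
      e s′ p y top = inj₁ top
      e s′ p y (kid z) = inj₂ (here z)
      e s′ p y (sib z) = inj₂ (there (here z))

  _[_↦_] : ∀ {n} {A : Set} → (Fin n → A) → Fin n → A → Fin n → A
  (f [ x ↦ u ]) y = if y == x then u else f y

  ↦-at : ∀ {n} {A : Set} (f : Fin n → A) x u → (f [ x ↦ u ]) x ≡ u
  ↦-at f x u rewrite ==-refl x = refl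

  ↦-off : ∀ {n} {A : Set} (f : Fin n → A) {x y} u → y ≢ x → (f [ x ↦ u ]) y ≡ f y
  ↦-off f u ne rewrite ==-≢ ne = refl

  -- Movable vertices: low degree and depth modulo three

  data Class : Set where
    Y X Z : Class

  -- Classes follow the depth. Only vertices of class `X` are moved, so their parents have class `Y`
  -- and their children class `Z`, and the two ends of an edge at one movable vertex are never both
  -- movable. The class of the roots stays free and is chosen to make movable vertices plentiful.
  next : Class → Class
  next Y = X
  next X = Z
  next Z = Y

  low : ∀ {n} → Forest n → Bool
  low ∅ = true
  low (br _ _ _ ∅) = true
  low (br _ _ _ (br _ _ _ _)) = false

  own : ∀ {n} → Class → Forest n → Bool
  own X k = low k
  own Y k = false
  own Z k = false

  movable : ∀ {n} → Class → Forest n → ℕ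
  movable c ∅ = 0
  movable c (br s x k r) = χ (own c k) + (movable (next c) k + movable c r)

  lows : ∀ {n} → Forest n → ℕ
  lows ∅ = 0
  lows (br s x k r) = χ (low k) + (lows k + lows r)

  -- Shifting the class of the roots takes every vertex through all three classes, so each low
  -- vertex is counted for exactly one shift.
  lows-classes : ∀ {n} (t : Forest n) → movable Y t + movable X t + movable Z t ≡ lows t
  lows-classes ∅ = refl
  lows-classes (br s x k r) = trans (arith (χ (low k)) (movable Y k) (movable X k) (movable Z k) (movable Y r) (movable X r) (movable Z r))
                                (cong (χ (low k) +_) (cong₂ _+_ (lows-classes k) (lows-classes r)))
    where
    arith : ∀ l a b c d e f → b + d + (l + (c + e)) + (a + f) ≡ l + (a + b + c + (d + e + f))
    arith = solve-∀

  -- The numbers of children sum to size minus roots, and each vertex that is not low contributes at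
  -- least two.
  size≤2lows : ∀ {n} (t : Forest n) → size t + roots t ≤ 2 * lows t
  size≤2lows ∅ = z≤n
  size≤2lows (br s x ∅ r) = lin 0 (size≤2lows r) (arith (size r) (roots r) (lows r))
    where
    arith : ∀ a b l → 1 + (0 + a) + (1 + b) + 2 * l + 0 ≡ 2 * (1 + (0 + l)) + (a + b)
    arith = solve-∀
  size≤2lows (br s x k@(br _ _ _ ∅) r) = lin 1 (+-mono-≤ (size≤2lows k) (size≤2lows r)) (arith (size k) (size r) (roots r) (lows k) (lows r))
    where
    arith : ∀ k a b m l → 1 + (k + a) + (1 + b) + (2 * m + 2 * l) + 1 ≡ 2 * (1 + (m + l)) + (k + 1 + (a + b))
    arith = solve-∀
  size≤2lows (br s x k@(br _ _ _ r′@(br _ _ _ r″)) r) = lin (roots r″) (+-mono-≤ (size≤2lows k) (size≤2lows r)) (arith (size k) (roots r″) (size r) (roots r) (lows k) (lows r))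
    where
    arith : ∀ k ρ a b m l → 1 + (k + a) + (1 + b) + (2 * m + 2 * l) + ρ ≡ 2 * (0 + (m + l)) + (k + (2 + ρ) + (a + b))
    arith = solve-∀

  -- Everything a move of the vertex `at` has to respect: the signed edge from its parent `above`
  -- and, if there is one, the signed edge to its only child.
  record XItem (n : ℕ) : Set where
    constructor xitem
    field
      sign  : Bool
      above : Fin n
      at    : Fin n
      below : Maybe (Bool × Fin n)

  same : Class → Class → Bool
  same Y Y = true
  same X X = true
  same Z Z = true
  same _ _ = false

  module _ {n : ℕ} where

    open XItem

    hook : Forest n → Maybe (Bool × Fin n)
    hook ∅ = nothing
    hook (br b z _ _) = just (b , z)

    ownItem : Bool → XItem n → List (XItem n)
    ownItem b it = if b then it ∷ [] else []

    items : Class → Fin n → Forest n → List (XItem n)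
    items c p ∅ = []
    items c p (br s x k r) = ownItem (own c k) (xitem s p x (hook k)) ++ (items (next c) x k ++ items c p r)

    length-items : ∀ c p t → length (items c p t) ≡ movable c t
    length-items c p ∅ = refl
    length-items c p (br s x k r) = trans (length-++ (ownItem (own c k) _)) (cong₂ _+_ (len (own c k)) (trans (length-++ (items (next c) x k)) (cong₂ _+_ (length-items (next c) x k) (length-items c p r))))
      where
      len : ∀ b {it} → length (ownItem b it) ≡ χ b
      len true = refl
      len false = refl

    data Case (c : Class) (p : Fin n) (s : Bool) (x : Fin n) (k r : Forest n) (it : XItem n) : Set where
      mine  : own c k ≡ true → it ≡ xitem s p x (hook k) → Case c p s x k r it
      inner : it ∈ items (next c) x k → Case c p s x k r it
      later : it ∈ items c p r → Case c p s x k r it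

    cases : ∀ c p s x k r {it} → it ∈ items c p (br s x k r) → Case c p s x k r it
    cases c p s x k r m with own c k in eq | ∈-++⁻ (ownItem (own c k) (xitem s p x (hook k))) m
    ... | true  | inj₁ (here refl) = mine eq refl
    ... | _ | inj₂ m′ with ∈-++⁻ (items (next c) x k) m′
    ...   | inj₁ a = inner a
    ...   | inj₂ b = later b

    occC : Class → Class → Forest n → Fin n → ℕ
    occC d c ∅ y = 0
    occC d c (br s x k r) y = χ (same d c) * χ (x == y) + (occC d (next c) k y + occC d c r y)

    occC-total : ∀ c t y → occC Y c t y + occC X c t y + occC Z c t y ≡ occ t y
    occC-total c ∅ y = refl
    occC-total c (br s x k r) y = trans (arith (χ (same Y c)) (χ (same X c)) (χ (same Z c)) (χ (x == y)) (occC Y (next c) k y) (occC X (next c) k y) (occC Z (next c) k y) (occC Y c r y) (occC X c r y) (occC Z c r y))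
       (cong₂ _+_ (trans (cong (_* χ (x == y)) (one c)) (*-identityˡ _)) (cong₂ _+_ (occC-total (next c) k y) (occC-total c r y)))
      where
      one : ∀ c → χ (same Y c) + χ (same X c) + χ (same Z c) ≡ 1
      one Y = refl
      one X = refl
      one Z = refl
      arith : ∀ i j l e a b c d f g → i * e + (a + d) + (j * e + (b + f)) + (l * e + (c + g)) ≡ (i + j + l) * e + ((a + b + c) + (d + f + g))
      arith = solve-∀

    module _ {d c : Class} {s : Bool} {x : Fin n} {k r : Forest n} where

      occC-top : same d c ≡ true → 1 ≤ occC d c (br s x k r) x
      occC-top eq rewrite eq | ==-refl x = s≤s z≤n

      occC-kid : ∀ y → occC d (next c) k y ≤ occC d c (br s x k r) y
      occC-kid y = ≤-trans (m≤m+n (occC d (next c) k y) (occC d c r y)) (m≤n+m _ (χ (same d c) * χ (x == y)))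

      occC-sib : ∀ y → occC d c r y ≤ occC d c (br s x k r) y
      occC-sib y = ≤-trans (m≤n+m (occC d c r y) (occC d (next c) k y)) (m≤n+m _ (χ (same d c) * χ (x == y)))

    is-X : ∀ {c} {k : Forest n} → own c k ≡ true → c ≡ X
    is-X {X} _ = refl

    item-at : ∀ c p t {it} → it ∈ items c p t → 1 ≤ occC X c t (at it)
    item-at c p (br s x k r) m with cases c p s x k r m
    ... | mine h refl with is-X {c} {k} h
    ...   | refl = occC-top {X} {X} {s} {x} {k} {r} refl
    item-at c p (br s x k r) {it} m | inner m′ = ≤-trans (item-at (next c) x k m′) (occC-kid {X} {c} {s} {x} {k} {r} (at it))
    item-at c p (br s x k r) {it} m | later m′ = ≤-trans (item-at c p r m′) (occC-sib {X} {c} {s} {x} {k} {r} (at it))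

    item-above : ∀ c p t {it} → it ∈ items c p t → above it ≡ p × c ≡ X ⊎ 1 ≤ occC Y c t (above it)
    item-above c p (br s x k r) m with cases c p s x k r m
    ... | mine h refl = inj₁ (refl , is-X {c} {k} h)
    ... | later m′ with item-above c p r m′
    ...   | inj₁ eq = inj₁ eq
    ...   | inj₂ le = inj₂ (≤-trans le (occC-sib {Y} {c} {s} {x} {k} {r} _))
    item-above c p (br s x k r) m | inner m′ with item-above (next c) x k m′
    ...   | inj₂ le = inj₂ (≤-trans le (occC-kid {Y} {c} {s} {x} {k} {r} _))
    item-above Y p (br s x k r) m | inner m′ | inj₁ (refl , _) = inj₂ (occC-top {Y} {Y} {s} {x} {k} {r} refl)
    item-above X p (br s x k r) m | inner m′ | inj₁ (_ , ())
    item-above Z p (br s x k r) m | inner m′ | inj₁ (_ , ())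

    item-below : ∀ c p t {it} → it ∈ items c p t → ∀ b z → below it ≡ just (b , z) → 1 ≤ occC Z c t z
    item-below c p (br s x k r) m b z eq with cases c p s x k r m
    ... | later m′ = ≤-trans (item-below c p r m′ b z eq) (occC-sib {Z} {c} {s} {x} {k} {r} z)
    ... | inner m′ = ≤-trans (item-below (next c) x k m′ b z eq) (occC-kid {Z} {c} {s} {x} {k} {r} z)
    item-below c p (br s x (br b′ z′ k′ r′) r) m b z refl | mine h refl with is-X {c} {br b′ z′ k′ r′} h
    ... | refl = ≤-trans (occC-top {Z} {Z} {b′} {z′} {k′} {r′} refl) (occC-kid {Z} {X} {s} {x} {br b′ z′ k′ r′} {r} z′)

    private
      none : ∀ {m} → 1 ≤ m → m ≡ 0 → ⊥
      none () refl

    -- A movable vertex is low and every label occurs at most once, so the only edges at it are the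
    -- one from its parent and the one to its single child. Each other position of an edge would
    -- make some label occur twice.
    incident : ∀ c p t → (∀ y → occ t y ≤ 1) → occ t p ≡ 0 → ∀ {it} → it ∈ items c p t → ∀ s′ a b → EdgeOf s′ a b p t →
               (b ≡ at it → a ≡ above it × s′ ≡ sign it) × (a ≡ at it → below it ≡ just (s′ , b))
    incident c p t@(br s x k r) simple p∉ {it} m s′ a b e = go (cases c p s x k r m) e
      where
      p≢x : p ≢ x
      p≢x refl = none (occ-top s x k r) p∉
      p∉k : occ k p ≡ 0
      p∉k = n≤0⇒n≡0 (≤-trans (occ-kid s x k r p) (≤-reflexive p∉))
      p∉r : occ r p ≡ 0
      p∉r = n≤0⇒n≡0 (≤-trans (occ-sib s x k r p) (≤-reflexive p∉))
      x∉ : occ k x + occ r x ≡ 0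
      x∉ = n≤0⇒n≡0 (≤-pred (subst (λ z → χ z + (occ k x + occ r x) ≤ 1) (==-refl x) (simple x)))
      x∉k : occ k x ≡ 0
      x∉k = m+n≡0⇒m≡0 (occ k x) x∉
      x∉r : occ r x ≡ 0
      x∉r = m+n≡0⇒n≡0 (occ k x) x∉
      apart : ∀ y → 1 ≤ occ k y → 1 ≤ occ r y → ⊥
      apart y y∈k y∈r = <⇒≱ (+-mono-≤ y∈k y∈r) (≤-trans (m≤n+m _ (χ (x == y))) (simple y))
      at∈ : ∀ c p t {it} → it ∈ items c p t → 1 ≤ occ t (at it)
      at∈ c p t {it} m = ≤-trans (item-at c p t m) (≤-trans (m≤n+m _ (occC Y c t (at it))) (≤-trans (m≤m+n _ _) (≤-reflexive (occC-total c t (at it)))))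
      Goal = (b ≡ at it → a ≡ above it × s′ ≡ sign it) × (a ≡ at it → below it ≡ just (s′ , b))
      only : ∀ k → own c k ≡ true → occ k x ≡ 0 → EdgeOf s′ a b x k → a ≡ x → hook k ≡ just (s′ , b)
      only (br b′ z k′ r′) h x∉ top _ = refl
      only (br b′ z k′ r′) h x∉ (kid e) refl with EdgeOf-occ e
      ... | _ , inj₁ refl = ⊥-elim (none (occ-top b′ z k′ r′) x∉)
      ... | _ , inj₂ x∈ = ⊥-elim (none (≤-trans x∈ (occ-kid b′ z k′ r′ x)) x∉)
      only (br b′ z k′ ∅) h x∉ (sib ()) _
      only (br b′ z k′ r′@(br _ _ _ _)) h x∉ (sib e) _ with is-X {c} {br b′ z k′ r′} h
      only (br b′ z k′ r′@(br _ _ _ _)) () x∉ (sib e) _ | refl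
      go : Case c p s x k r it → EdgeOf s′ a b p t → Goal
      go (mine h refl) top = (λ _ → refl , refl) , λ eq → contradiction eq p≢x
      go (mine h refl) (kid e) = (λ { refl → ⊥-elim (none (proj₁ (EdgeOf-occ e)) x∉k) }) , only k h x∉k e
      go (mine h refl) (sib e) with EdgeOf-occ e
      ... | b∈ , a∈ = (λ { refl → ⊥-elim (none b∈ x∉r) }) , λ { refl → ⊥-elim (bad a∈) }
        where
        bad : x ≡ p ⊎ 1 ≤ occ r x → ⊥
        bad (inj₁ eq) = p≢x (sym eq)
        bad (inj₂ x∈) = none x∈ x∉r
      go (inner m′) top = (λ eq → ⊥-elim (none (subst (λ z → 1 ≤ occ k z) (sym eq) (at∈ (next c) x k m′)) x∉k)) , λ eq → ⊥-elim (none (subst (λ z → 1 ≤ occ k z) (sym eq) (at∈ (next c) x k m′)) p∉k)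
      go (inner m′) (kid e) = incident (next c) x k (λ y → ≤-trans (occ-kid s x k r y) (simple y)) x∉k m′ s′ a b e
      go (inner m′) (sib e) with EdgeOf-occ e
      ... | b∈ , a∈ = (λ eq → ⊥-elim (apart (at it) (at∈ (next c) x k m′) (subst (λ z → 1 ≤ occ r z) eq b∈))) , λ eq → ⊥-elim (bad a∈ eq)
        where
        bad : a ≡ p ⊎ 1 ≤ occ r a → a ≡ at it → ⊥
        bad (inj₁ eq) eq′ = none (subst (λ z → 1 ≤ occ k z) (trans (sym eq′) eq) (at∈ (next c) x k m′)) p∉k
        bad (inj₂ a∈r) eq′ = apart (at it) (at∈ (next c) x k m′) (subst (λ z → 1 ≤ occ r z) eq′ a∈r)
      go (later m′) top = (λ eq → ⊥-elim (none (subst (λ z → 1 ≤ occ r z) (sym eq) (at∈ c p r m′)) x∉r)) , λ eq → ⊥-elim (none (subst (λ z → 1 ≤ occ r z) (sym eq) (at∈ c p r m′)) p∉r)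
      go (later m′) (kid e) with EdgeOf-occ e
      ... | b∈ , a∈ = (λ eq → ⊥-elim (apart (at it) (subst (λ z → 1 ≤ occ k z) eq b∈) (at∈ c p r m′))) , λ eq → ⊥-elim (bad a∈ eq)
        where
        bad : a ≡ x ⊎ 1 ≤ occ k a → a ≡ at it → ⊥
        bad (inj₁ eq) eq′ = none (subst (λ z → 1 ≤ occ r z) (trans (sym eq′) eq) (at∈ c p r m′)) x∉r
        bad (inj₂ a∈k) eq′ = apart (at it) (subst (λ z → 1 ≤ occ k z) eq′ a∈k) (at∈ c p r m′)
      go (later m′) (sib e) = incident c p r (λ y → ≤-trans (occ-sib s x k r y) (simple y)) p∉r m′ s′ a b e

    atCount : Fin n → List (XItem n) → ℕ
    atCount y [] = 0
    atCount y (it ∷ its) = χ (at it == y) + atCount y its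

    atCount-++ : ∀ y xs ys → atCount y (xs ++ ys) ≡ atCount y xs + atCount y ys
    atCount-++ y [] ys = refl
    atCount-++ y (it ∷ xs) ys = trans (cong (χ (at it == y) +_) (atCount-++ y xs ys)) (sym (+-assoc (χ (at it == y)) _ _))

    atCount≤ : ∀ y c p t → atCount y (items c p t) ≤ occC X c t y
    atCount≤ y c p ∅ = z≤n
    atCount≤ y c p (br s x k r) = begin
      atCount y (items c p (br s x k r))
        ≡⟨ trans (atCount-++ y (ownItem (own c k) _) _) (cong (atCount y (ownItem (own c k) (xitem s p x (hook k))) +_) (atCount-++ y (items (next c) x k) _)) ⟩
      atCount y (ownItem (own c k) (xitem s p x (hook k))) + (atCount y (items (next c) x k) + atCount y (items c p r))
        ≤⟨ +-mono-≤ (mineOnly c) (+-mono-≤ (atCount≤ y (next c) x k) (atCount≤ y c p r)) ⟩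
      occC X c (br s x k r) y ∎
      where
      open ≤-Reasoning
      mineOnly : ∀ c → atCount y (ownItem (own c k) (xitem s p x (hook k))) ≤ χ (same X c) * χ (x == y)
      mineOnly Y = z≤n
      mineOnly Z = z≤n
      mineOnly X with low k
      ... | true = ≤-refl
      ... | false = z≤n

  -- The lower-tail estimate, derandomised: `prod` has a factor 1 - d₃/M per hit, relative to M, and
  -- is at most I (1 - 1/M)^len. One hit accounts for at most 2 d₃ of the factors 1 - 1/M. With too
  -- few hits, at least v₀ l of these factors are left over, and together they are at most 2^(-l),
  -- too small to be compensated by I < 2^l tests.
  few-hits : ∀ I l v₀ M v₃ d₃ len g h prod → M ≡ suc v₀ → 1 ≤ v₀ → M ≡ v₃ + d₃ → 2 * d₃ ≤ M → I < 2 ^ l → 2 * d₃ * g + v₀ * l ≤ len →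
             prod * M ^ h ≡ v₃ ^ h * M ^ len → prod ≤ I * v₀ ^ len → g ≤ h
  few-hits I l v₀ M v₃ d₃ len g h prod refl v₀>0 M≡ 2d≤M I< long prod≡ small = ≮⇒≥ λ h<g → contra (≤-trans (+-monoˡ-≤ (v₀ * l) (*-monoʳ-≤ H (<⇒≤ h<g))) long)
    where
    open ≤-Reasoning
    H = 2 * d₃
    -- This is (1 - 1/M)^(2 d₃) ≤ 1 - d₃/M: by Bernoulli the left side is at most M/(M + 2 d₃), and
    -- `2 * d₃ ≤ M` does the rest.
    step : v₀ ^ H * M ≤ M ^ H * v₃
    step = *-cancelʳ-≤ _ _ M (begin
      v₀ ^ H * M * M              ≡⟨ *-assoc (v₀ ^ H) M M ⟩
      v₀ ^ H * (M * M)            ≤⟨ *-monoʳ-≤ (v₀ ^ H) square ⟩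
      v₀ ^ H * ((M + H) * v₃)     ≡⟨ *-assoc (v₀ ^ H) (M + H) v₃ ⟨
      v₀ ^ H * (M + H) * v₃       ≤⟨ *-monoˡ-≤ v₃ (bernoulli H) ⟩
      M ^ H * M * v₃              ≡⟨ ar (M ^ H) M v₃ ⟩
      M ^ H * v₃ * M              ∎)
      where
      ar : ∀ a b c → a * b * c ≡ a * c * b
      ar = solve-∀
      square : M * M ≤ (M + H) * v₃
      square = lin 0 (*-monoʳ-≤ d₃ 2d≤M) (subst (λ m → m * m + d₃ * m + 0 ≡ (m + 2 * d₃) * v₃ + d₃ * (2 * d₃)) (sym M≡) (ar₂ v₃ d₃))
        where
        ar₂ : ∀ v d → (v + d) * (v + d) + d * (v + d) + 0 ≡ (v + d + 2 * d) * v + d * (2 * d)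
        ar₂ = solve-∀
      bernoulli : ∀ j → v₀ ^ j * (M + j) ≤ M ^ j * M
      bernoulli zero = ≤-reflexive (cong (1 *_) (+-identityʳ M))
      bernoulli (suc j) = lin (v₀ ^ j * (1 + j)) (*-monoʳ-≤ M (bernoulli j)) (ar₃ v₀ (v₀ ^ j) j (M ^ j))
        where
        ar₃ : ∀ v p j r → v * p * (1 + v + (1 + j)) + (1 + v) * (r * (1 + v)) + p * (1 + j) ≡ (1 + v) * r * (1 + v) + (1 + v) * (p * (1 + v + j))
        ar₃ = solve-∀
    contra : H * h + v₀ * l ≤ len → ⊥
    contra le = <⇒≱ big small′
      where
      extra rem : ℕ
      extra = len ∸ (H * h + v₀ * l)
      rem = v₀ * l + extra
      len≡ : len ≡ H * h + rem
      len≡ = trans (sym (m+[n∸m]≡n le)) (+-assoc (H * h) (v₀ * l) extra)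
      big : I * v₀ ^ rem < M ^ rem
      big = begin-strict
        I * v₀ ^ rem                              <⟨ *-monoˡ-< (v₀ ^ rem) {{>-nonZero (m^n>0 v₀ {{>-nonZero v₀>0}} rem)}} I< ⟩
        2 ^ l * v₀ ^ rem                          ≡⟨ trans (cong (2 ^ l *_) (^-distribˡ-+-* v₀ (v₀ * l) extra)) (sym (*-assoc (2 ^ l) _ _)) ⟩
        2 ^ l * v₀ ^ (v₀ * l) * v₀ ^ extra        ≤⟨ *-mono-≤ (log-growth v₀ l v₀>0) (^-monoˡ-≤ extra (n≤1+n v₀)) ⟩
        M ^ (v₀ * l) * M ^ extra                  ≡⟨ ^-distribˡ-+-* M (v₀ * l) extra ⟨
        M ^ rem                                   ∎
      small′ : M ^ rem ≤ I * v₀ ^ rem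
      small′ = *-cancelʳ-≤ _ _ (v₀ ^ (H * h) * M ^ (H * h) * M ^ h) {{>-nonZero (*-mono-≤ (*-mono-≤ (m^n>0 v₀ {{>-nonZero v₀>0}} (H * h)) (m^n>0 M (H * h))) (m^n>0 M h))}} (begin
        M ^ rem * (v₀ ^ (H * h) * M ^ (H * h) * M ^ h)
          ≡⟨ ar₁ (M ^ rem) (v₀ ^ (H * h)) (M ^ (H * h)) (M ^ h) ⟩
        v₀ ^ (H * h) * M ^ h * (M ^ (H * h) * M ^ rem)
          ≡⟨ cong₂ (λ a b → a * M ^ h * b) (^-*-assoc v₀ H h) (^-distribˡ-+-* M (H * h) rem) ⟨
        (v₀ ^ H) ^ h * M ^ h * M ^ (H * h + rem)
          ≡⟨ cong₂ (λ a b → a * M ^ b) (^-distrib-* (v₀ ^ H) M h) len≡ ⟨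
        (v₀ ^ H * M) ^ h * M ^ len
          ≤⟨ *-monoˡ-≤ (M ^ len) (^-monoˡ-≤ h step) ⟩
        (M ^ H * v₃) ^ h * M ^ len
          ≡⟨ cong (_* M ^ len) (trans (^-distrib-* (M ^ H) v₃ h) (cong (_* v₃ ^ h) (^-*-assoc M H h))) ⟩
        M ^ (H * h) * v₃ ^ h * M ^ len
          ≡⟨ *-assoc (M ^ (H * h)) (v₃ ^ h) (M ^ len) ⟩
        M ^ (H * h) * (v₃ ^ h * M ^ len)
          ≡⟨ cong (M ^ (H * h) *_) prod≡ ⟨
        M ^ (H * h) * (prod * M ^ h)
          ≤⟨ *-monoʳ-≤ (M ^ (H * h)) (*-monoˡ-≤ (M ^ h) small) ⟩
        M ^ (H * h) * (I * v₀ ^ len * M ^ h)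
          ≡⟨ cong (λ a → M ^ (H * h) * (I * a * M ^ h)) (trans (cong (v₀ ^_) len≡) (^-distribˡ-+-* v₀ (H * h) rem)) ⟩
        M ^ (H * h) * (I * (v₀ ^ (H * h) * v₀ ^ rem) * M ^ h)
          ≡⟨ ar₂ (M ^ (H * h)) I (v₀ ^ (H * h)) (v₀ ^ rem) (M ^ h) ⟩
        I * v₀ ^ rem * (v₀ ^ (H * h) * M ^ (H * h) * M ^ h) ∎)
        where
        ar₁ : ∀ a b c d → a * (b * c * d) ≡ b * d * (c * a)
        ar₁ = solve-∀
        ar₂ : ∀ a i b c d → a * (i * (b * c) * d) ≡ i * c * (b * a * d)
        ar₂ = solve-∀

  -- Rooting the given tree and splitting it at a vertex

  ∑-squeeze : ∀ {n} (f g : Fin n → ℕ) → (∀ x → f x ≤ g x) → ∑ g ≤ ∑ f → ∀ x → f x ≡ g x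
  ∑-squeeze f g le ge x = ≤-antisym (le x) (+-cancelʳ-≤ (∑ f) _ _ (begin
    g x + ∑ f                                          ≤⟨ +-monoʳ-≤ (g x) (∑-mono pointwise) ⟩
    g x + ∑ (λ y → χ (y == x) * f x + χ (not (y == x)) * g y)   ≡⟨ cong (g x +_) (trans (∑-+ _ _) (cong (_+ ∑ (λ y → χ (not (y == x)) * g y)) (at f))) ⟩
    g x + (f x + ∑ (λ y → χ (not (y == x)) * g y))     ≡⟨ arith (g x) (f x) _ ⟩
    f x + (g x + ∑ (λ y → χ (not (y == x)) * g y))     ≡⟨ cong (f x +_) (trans (cong (_+ ∑ (λ y → χ (not (y == x)) * g y)) (sym (at g))) (sym (∑-+ _ _))) ⟩
    f x + ∑ (λ y → χ (y == x) * g x + χ (not (y == x)) * g y)   ≡⟨ cong (f x +_) (∑-cong merge) ⟩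
    f x + ∑ g                                          ≤⟨ +-monoʳ-≤ (f x) ge ⟩
    f x + ∑ f                                          ∎))
    where
    open ≤-Reasoning
    arith : ∀ a b c → a + (b + c) ≡ b + (a + c)
    arith = solve-∀
    pointwise : ∀ y → f y ≤ χ (y == x) * f x + χ (not (y == x)) * g y
    pointwise y with y ≟ x
    ... | yes refl = ≤-trans (m≤m+n (f y) 0) (m≤m+n _ _)
    ... | no _ = ≤-trans (le y) (m≤m+n (g y) 0)
    merge : ∀ y → χ (y == x) * g x + χ (not (y == x)) * g y ≡ g y
    merge y with y ≟ x
    ... | yes refl = trans (+-identityʳ _) (+-identityʳ _)
    ... | no _ = +-identityʳ _
    at : ∀ h → ∑ (λ y → χ (y == x) * h x) ≡ h x
    at h = trans (∑-delta _ x λ y ne → cong (λ b → χ b * h x) (==-≢ ne)) (trans (cong (λ b → χ b * h x) (==-refl x)) (+-identityʳ _))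

  ∑-point : ∀ {n} (x : Fin n) → ∑ (λ y → χ (x == y)) ≡ 1
  ∑-point x = trans (∑-delta _ x λ y ne → cong χ (==-≢ (ne ∘ sym))) (cong χ (==-refl x))

  module _ {n : ℕ} where

    -- The arc carried by an edge of sign s from parent p to child y, as an indicator of the ordered pair (a , b).
    arc : Bool → Fin n → Fin n → Fin n → Fin n → ℕ
    arc true  p y a b = χ (p == a) * χ (y == b)
    arc false p y a b = χ (y == a) * χ (p == b)

    arcs : Fin n → Forest n → Fin n → Fin n → ℕ
    arcs q ∅ a b = 0
    arcs q (br s x k r) a b = arc s q x a b + (arcs x k a b + arcs q r a b)

    arc-not : ∀ s p y a b → arc (not s) y p a b ≡ arc s p y a b
    arc-not true  p y a b = refl
    arc-not false p y a b = refl

    arc-total : ∀ s p y → ∑ (λ a → ∑ (arc s p y a)) ≡ 1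
    arc-total true p y = trans (∑-cong λ a → trans (∑-*ˡ (χ (p == a)) _) (trans (cong (χ (p == a) *_) (∑-point y)) (*-identityʳ _))) (∑-point p)
    arc-total false p y = trans (∑-cong λ a → trans (∑-*ˡ (χ (y == a)) _) (trans (cong (χ (y == a) *_) (∑-point p)) (*-identityʳ _))) (∑-point y)

    arcs-total : ∀ q t → ∑ (λ a → ∑ (arcs q t a)) ≡ size t
    arcs-total q ∅ = ∑-zero λ a → ∑-zero λ b → refl
    arcs-total q (br s x k r) = begin
      ∑ (λ a → ∑ (arcs q (br s x k r) a))
        ≡⟨ ∑-cong (λ a → trans (∑-+ _ _) (cong (∑ (arc s q x a) +_) (∑-+ _ _))) ⟩
      ∑ (λ a → ∑ (arc s q x a) + (∑ (arcs x k a) + ∑ (arcs q r a)))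
        ≡⟨ trans (∑-+ _ _) (cong (∑ (λ a → ∑ (arc s q x a)) +_) (∑-+ _ _)) ⟩
      ∑ (λ a → ∑ (arc s q x a)) + (∑ (λ a → ∑ (arcs x k a)) + ∑ (λ a → ∑ (arcs q r a)))
        ≡⟨ cong₂ _+_ (arc-total s q x) (cong₂ _+_ (arcs-total x k) (arcs-total q r)) ⟩
      suc (size k + size r) ∎
      where open ≡-Reasoning

    occ-total : ∀ (t : Forest n) → ∑ (occ t) ≡ size t
    occ-total ∅ = ∑-zero λ y → refl
    occ-total (br s x k r) = trans (∑-+ _ _) (cong₂ _+_ (∑-point x) (trans (∑-+ _ _) (cong₂ _+_ (occ-total k) (occ-total r))))

    χχ : ∀ {p y a b : Fin n} → 1 ≤ χ (p == a) * χ (y == b) → p ≡ a × y ≡ b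
    χχ {p} {y} {a} {b} h with p ≟ a | y ≟ b
    ... | yes e | yes e′ = e , e′

    arcs-edge : ∀ q t a b → 1 ≤ arcs q t a b → EdgeOf true a b q t ⊎ EdgeOf false b a q t
    arcs-edge q (br s x k r) a b h with arc s q x a b in eq₁ | arcs x k a b in eq₂
    arcs-edge q (br true x k r) a b h | suc m | _ with χχ {q} {x} {a} {b} (subst (1 ≤_) (sym eq₁) (s≤s z≤n))
    ... | refl , refl = inj₁ top
    arcs-edge q (br false x k r) a b h | suc m | _ with χχ {x} {q} {a} {b} (subst (1 ≤_) (sym eq₁) (s≤s z≤n))
    ... | refl , refl = inj₂ top
    arcs-edge q (br s x k r) a b h | zero | suc m with arcs-edge x k a b (subst (1 ≤_) (sym eq₂) (s≤s z≤n))
    ... | inj₁ e = inj₁ (kid e)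
    ... | inj₂ e = inj₂ (kid e)
    arcs-edge q (br s x k r) a b h | zero | zero with arcs-edge q r a b h
    ... | inj₁ e = inj₁ (sib e)
    ... | inj₂ e = inj₂ (sib e)

    tip heel : Bool → Fin n → Fin n → Fin n
    tip true p y = y
    tip false p y = p
    heel true p y = p
    heel false p y = y

    arc-self : ∀ s p y → arc s p y (heel s p y) (tip s p y) ≡ 1
    arc-self true p y rewrite ==-refl p | ==-refl y = refl
    arc-self false p y rewrite ==-refl p | ==-refl y = refl

    edge-arcs : ∀ {s p y q t} → EdgeOf s p y q t → 1 ≤ arcs q t (heel s p y) (tip s p y)
    edge-arcs {s} {p} {y} top = ≤-trans (≤-reflexive (sym (arc-self s p y))) (m≤m+n _ _)
    edge-arcs {t = br s′ x k r} (kid e) = ≤-trans (edge-arcs e) (≤-trans (m≤m+n _ _) (m≤n+m _ (arc s′ _ x _ _)))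
    edge-arcs {t = br s′ x k r} (sib e) = ≤-trans (edge-arcs e) (≤-trans (m≤n+m _ (arcs x k _ _)) (m≤n+m _ (arc s′ _ x _ _)))

    -- The new child is added below every occurrence of p, hence the factor `occ t p` in the two
    -- lemmas that follow.
    insert : Fin n → Bool → Fin n → Forest n → Forest n
    insert p s y ∅ = ∅
    insert p s y (br s′ x k r) = br s′ x (if x == p then br s y ∅ (insert p s y k) else insert p s y k) (insert p s y r)

    occ-insert : ∀ p s y t z → occ (insert p s y t) z ≡ occ t z + occ t p * χ (y == z)
    occ-insert p s y ∅ z = refl
    occ-insert p s y (br s′ x k r) z with x ≟ p
    ... | yes refl = trans (cong₂ (λ i j → χ (x == z) + (χ (y == z) + (0 + i) + j)) (occ-insert p s y k z) (occ-insert p s y r z)) (arith (χ (x == z)) (χ (y == z)) (occ k z) (occ r z) (occ k x) (occ r x))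
      where
      arith : ∀ a b c d e f → a + (b + (0 + (c + e * b)) + (d + f * b)) ≡ a + (c + d) + (1 + (e + f)) * b
      arith = solve-∀
    ... | no _ = trans (cong₂ (λ i j → χ (x == z) + (i + j)) (occ-insert p s y k z) (occ-insert p s y r z)) (arith (χ (x == z)) (χ (y == z)) (occ k z) (occ r z) (occ k p) (occ r p))
      where
      arith : ∀ a b c d e f → a + (c + e * b + (d + f * b)) ≡ a + (c + d) + (0 + (e + f)) * b
      arith = solve-∀

    arcs-insert : ∀ p s y q t a b → arcs q (insert p s y t) a b ≡ arcs q t a b + occ t p * arc s p y a b
    arcs-insert p s y q ∅ a b = refl
    arcs-insert p s y q (br s′ x k r) a b with x ≟ p
    ... | yes refl = trans (cong₂ (λ i j → arc s′ q x a b + (arc s x y a b + (0 + i) + j)) (arcs-insert p s y x k a b) (arcs-insert p s y q r a b)) (arith (arc s′ q x a b) (arc s x y a b) (arcs x k a b) (arcs q r a b) (occ k x) (occ r x))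
      where
      arith : ∀ a b c d e f → a + (b + (0 + (c + e * b)) + (d + f * b)) ≡ a + (c + d) + (1 + (e + f)) * b
      arith = solve-∀
    ... | no _ = trans (cong₂ (λ i j → arc s′ q x a b + (i + j)) (arcs-insert p s y x k a b) (arcs-insert p s y q r a b)) (arith (arc s′ q x a b) (arc s p y a b) (arcs x k a b) (arcs q r a b) (occ k p) (occ r p))
      where
      arith : ∀ a b c d e f → a + (c + e * b + (d + f * b)) ≡ a + (c + d) + (0 + (e + f)) * b
      arith = solve-∀

    infixr 5 _⊕_
    _⊕_ : Forest n → Forest n → Forest n
    ∅ ⊕ t = t
    br s x k r ⊕ t = br s x k (r ⊕ t)

    occ-⊕ : ∀ t t′ y → occ (t ⊕ t′) y ≡ occ t y + occ t′ y
    occ-⊕ ∅ t′ y = refl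
    occ-⊕ (br s x k r) t′ y = trans (cong (λ z → χ (x == y) + (occ k y + z)) (occ-⊕ r t′ y)) (arith (χ (x == y)) (occ k y) (occ r y) (occ t′ y))
      where
      arith : ∀ a b c d → a + (b + (c + d)) ≡ a + (b + c) + d
      arith = solve-∀

    arcs-⊕ : ∀ q t t′ a b → arcs q (t ⊕ t′) a b ≡ arcs q t a b + arcs q t′ a b
    arcs-⊕ q ∅ t′ a b = refl
    arcs-⊕ q (br s x k r) t′ a b = trans (cong (λ z → arc s q x a b + (arcs x k a b + z)) (arcs-⊕ q r t′ a b)) (arith (arc s q x a b) (arcs x k a b) (arcs q r a b) (arcs q t′ a b))
      where
      arith : ∀ a b c d → a + (b + (c + d)) ≡ a + (b + c) + d
      arith = solve-∀

  module TreeForest {n : ℕ} (T : Digraph n) (tree : IsOrientedTree T) where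

    open IsOrientedTree tree

    -- The forest below the root v is the whole of T: labels and arcs are compared as
    -- multiplicities, so being spanning, repetition-free and faithful is expressed by two
    -- equations.
    record Rep (v : Fin n) (t : Forest n) : Set where
      field
        occ≡  : ∀ y → χ (v == y) + occ t y ≡ 1
        arcs≡ : ∀ a b → arcs v t a b ≡ χ (adj T a b)

    record Grown (v : Fin n) (t : Forest n) : Set where
      field
        occ≤  : ∀ y → χ (v == y) + occ t y ≤ 1
        arcs≤ : ∀ a b → arcs v t a b ≤ χ (adj T a b)

    has : Fin n → Forest n → Fin n → Bool
    has v t y = 1 ≤ᵇ (χ (v == y) + occ t y)

    1≤ᵇ-true : ∀ {m} → (1 ≤ᵇ m) ≡ true → 1 ≤ m
    1≤ᵇ-true {suc m} _ = s≤s z≤n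

    1≤ᵇ-false : ∀ {m} → (1 ≤ᵇ m) ≡ false → m ≡ 0
    1≤ᵇ-false {zero} _ = refl

    crossing : ∀ (S : Fin n → Bool) {a c} → Star (λ a b → undAdj T a b ≡ true) a c → S a ≡ true → S c ≡ false →
               ∃ λ a → ∃ λ b → S a ≡ true × S b ≡ false × undAdj T a b ≡ true
    crossing S nil Sa Sc = true≢false Sa Sc
    crossing S {a} (_◅_ {j = b} ab path) Sa Sc with S b in eq
    ... | true = crossing S path eq Sc
    ... | false = a , b , Sa , eq , ab

    arcs-end : ∀ q (t : Forest n) a b → 1 ≤ arcs q t a b → (1 ≤ χ (q == a) + occ t a) × (1 ≤ χ (q == b) + occ t b)
    arcs-end q t a b h with arcs-edge q t a b h
    ... | inj₁ e = parent (proj₂ (EdgeOf-occ e)) , ≤-trans (proj₁ (EdgeOf-occ e)) (m≤n+m _ _)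
      where
      parent : ∀ {p} → p ≡ q ⊎ 1 ≤ occ t p → 1 ≤ χ (q == p) + occ t p
      parent (inj₁ refl) = ≤-trans (≤-reflexive (cong χ (sym (==-refl q)))) (m≤m+n _ _)
      parent (inj₂ h) = ≤-trans h (m≤n+m _ _)
    ... | inj₂ e = ≤-trans (proj₁ (EdgeOf-occ e)) (m≤n+m _ _) , parent (proj₂ (EdgeOf-occ e))
      where
      parent : ∀ {p} → p ≡ q ⊎ 1 ≤ occ t p → 1 ≤ χ (q == p) + occ t p
      parent (inj₁ refl) = ≤-trans (≤-reflexive (cong χ (sym (==-refl q)))) (m≤m+n _ _)
      parent (inj₂ h) = ≤-trans h (m≤n+m _ _)

    graft : ∀ {v t} → Grown v t → ∀ p y s → has v t p ≡ true → has v t y ≡ false → adj T (heel s p y) (tip s p y) ≡ true →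
            ∃ λ t′ → Grown v t′ × (∀ z → χ (v == z) + occ t′ z ≡ χ (v == z) + occ t z + χ (y == z))
    graft {v} {t} grown p y s hp hy edge = go (v ≟ p)
      where
      open Grown grown
      y∉ : χ (v == y) + occ t y ≡ 0
      y∉ = 1≤ᵇ-false hy
      p∈ : 1 ≤ χ (v == p) + occ t p
      p∈ = 1≤ᵇ-true hp
      occ-ok : ∀ z → χ (v == z) + occ t z + χ (y == z) ≤ 1
      occ-ok z with y ≟ z
      ... | yes refl rewrite y∉ = ≤-refl
      ... | no _ = subst (_≤ 1) (sym (+-identityʳ _)) (occ≤ z)
      fresh-arc : ∀ s a b → 1 ≤ arc s p y a b → arcs v t a b ≡ 0
      fresh-arc true a b h with χχ {p = p} {y} {a} {b} h
      ... | refl , refl = n≤0⇒n≡0 (≮⇒≥ λ h′ → <⇒≱ (proj₂ (arcs-end v t p y h′)) (≤-reflexive y∉))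
      fresh-arc false a b h with χχ {p = y} {p} {a} {b} h
      ... | refl , refl = n≤0⇒n≡0 (≮⇒≥ λ h′ → <⇒≱ (proj₁ (arcs-end v t y p h′)) (≤-reflexive y∉))
      arc≤ : ∀ s → adj T (heel s p y) (tip s p y) ≡ true → ∀ a b → arc s p y a b ≤ χ (adj T a b)
      arc≤ true e a b with p ≟ a | y ≟ b
      ... | yes refl | yes refl rewrite e = ≤-refl
      ... | yes refl | no _ = z≤n
      ... | no _ | _ = z≤n
      arc≤ false e a b with y ≟ a | p ≟ b
      ... | yes refl | yes refl rewrite e = ≤-refl
      ... | yes refl | no _ = z≤n
      ... | no _ | _ = z≤n
      arcs-ok : ∀ a b → arcs v t a b + arc s p y a b ≤ χ (adj T a b)
      arcs-ok a b with arc s p y a b in eq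
      ... | zero = subst (_≤ χ (adj T a b)) (sym (+-identityʳ _)) (arcs≤ a b)
      ... | suc m rewrite fresh-arc s a b (subst (1 ≤_) (sym eq) (s≤s z≤n)) = subst (_≤ χ (adj T a b)) eq (arc≤ s edge a b)
      go : Dec (v ≡ p) → ∃ λ t′ → Grown v t′ × (∀ z → χ (v == z) + occ t′ z ≡ χ (v == z) + occ t z + χ (y == z))
      go (yes refl) = br s y ∅ t , record { occ≤ = λ z → subst (_≤ 1) (sym (occ′ z)) (occ-ok z)
                                         ; arcs≤ = λ a b → subst (_≤ χ (adj T a b)) (+-comm (arcs v t a b) (arc s v y a b)) (arcs-ok a b) } , occ′
        where
        ar : ∀ a b c → a + (b + (0 + c)) ≡ a + c + b
        ar = solve-∀
        occ′ : ∀ z → χ (v == z) + (χ (y == z) + (0 + occ t z)) ≡ χ (v == z) + occ t z + χ (y == z)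
        occ′ z = ar (χ (v == z)) (χ (y == z)) (occ t z)
      go (no v≢p) = insert p s y t , record { occ≤ = λ z → subst (_≤ 1) (sym (occ′ z)) (occ-ok z)
                                            ; arcs≤ = λ a b → subst (_≤ χ (adj T a b)) (sym (arcs′ a b)) (arcs-ok a b) } , occ′
        where
        one : occ t p ≡ 1
        one = ≤-antisym (≤-trans (m≤n+m _ _) (occ≤ p)) (subst (λ b → 1 ≤ χ b + occ t p) (==-≢ v≢p) p∈)
        occ′ : ∀ z → χ (v == z) + occ (insert p s y t) z ≡ χ (v == z) + occ t z + χ (y == z)
        occ′ z = trans (cong (χ (v == z) +_) (trans (occ-insert p s y t z) (cong (occ t z +_) (trans (cong (_* χ (y == z)) one) (*-identityˡ _))))) (sym (+-assoc (χ (v == z)) _ _))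
        arcs′ : ∀ a b → arcs v (insert p s y t) a b ≡ arcs v t a b + arc s p y a b
        arcs′ a b = trans (arcs-insert p s y v t a b) (cong (arcs v t a b +_) (trans (cong (_* arc s p y a b) one) (*-identityˡ _)))

    und-sign : ∀ p y → undAdj T p y ≡ true → ∃ λ s → adj T (heel s p y) (tip s p y) ≡ true
    und-sign p y h with adj T p y in eq
    ... | true = true , eq
    ... | false = false , h

    -- A grown tree on all n vertices has n - 1 arcs, all of them edges of T, and T has n - 1 edges.
    -- Squeezing first the row sums and then the entries makes the two arc sets equal.
    all-has : ∀ {v t} → Grown v t → (∀ y → has v t y ≡ true) → Rep v t
    all-has {v} {t} grown all = record { occ≡ = occ≡ ; arcs≡ = λ a b → ∑-squeeze (arcs v t a) (λ b → χ (adj T a b)) (arcs≤ a) (≤-reflexive (sym (∑-squeeze (λ a → ∑ (arcs v t a)) (λ a → ∑ (λ b → χ (adj T a b))) (λ a → ∑-mono (arcs≤ a)) enough a))) b }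
      where
      open Grown grown
      occ≡ : ∀ y → χ (v == y) + occ t y ≡ 1
      occ≡ y = ≤-antisym (occ≤ y) (1≤ᵇ-true (all y))
      n≡ : suc (size t) ≡ n
      n≡ = begin
        suc (size t)                           ≡⟨ cong₂ _+_ (∑-point v) (occ-total t) ⟨
        ∑ (λ y → χ (v == y)) + ∑ (occ t)       ≡⟨ ∑-+ _ _ ⟨
        ∑ (λ y → χ (v == y) + occ t y)         ≡⟨ ∑-cong occ≡ ⟩
        ∑ {n} (λ y → 1)                        ≡⟨ trans (∑-const n 1) (*-identityʳ n) ⟩
        n                                      ∎
        where open ≡-Reasoning
      edgeCount≡ : edgeCount T ≡ ∑ (λ a → ∑ (λ b → χ (adj T a b)))
      edgeCount≡ = trans (cong sum (map-tabulate id (outdeg T))) (trans (∑-tabulate n (outdeg T)) (∑-cong λ a → countFin≡cnt n (adj T a)))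
      enough : ∑ (λ a → ∑ (λ b → χ (adj T a b))) ≤ ∑ (λ a → ∑ (arcs v t a))
      enough = ≤-reflexive (trans (sym edgeCount≡) (trans edges (trans (cong (_∸ 1) (sym n≡)) (sym (arcs-total v t)))))

    -- While a vertex is missing, a path from v to it leaves the vertex set reached so far, and the
    -- crossing edge is grafted on. Each graft adds one vertex, which bounds the number of rounds.
    represent : ∀ v → ∃ λ t → Rep v t
    represent v = search (suc n) ∅ (record { occ≤ = λ y → subst (_≤ 1) (sym (+-identityʳ _)) (χ≤1 (v == y)) ; arcs≤ = λ a b → z≤n }) (s≤s (m∸n≤m n (∑ (λ y → χ (v == y) + 0))))
      where
      search : ∀ fuel t → Grown v t → n ∸ ∑ (λ y → χ (v == y) + occ t y) < fuel → ∃ λ t → Rep v t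
      search (suc fuel) t grown lt with any? (λ y → has v t y Data.Bool.≟ false)
      ... | no none = t , all-has grown λ y → ¬false y (λ h → none (y , h))
        where
        ¬false : ∀ y → (has v t y ≡ false → ⊥) → has v t y ≡ true
        ¬false y h with has v t y
        ... | true = refl
        ... | false = ⊥-elim (h refl)
      ... | yes (y₀ , miss) = grow (crossing (has v t) (connected v y₀) root miss)
        where
        root : has v t v ≡ true
        root rewrite ==-refl v = refl
        Total : Forest n → ℕ
        Total t = ∑ (λ y → χ (v == y) + occ t y)
        grow : (∃ λ a → ∃ λ b → has v t a ≡ true × has v t b ≡ false × undAdj T a b ≡ true) → ∃ λ t → Rep v t
        grow (p , y , hp , hy , e) = grow₂ (und-sign p y e)
          where
          grow₂ : (∃ λ s → adj T (heel s p y) (tip s p y) ≡ true) → ∃ λ t → Rep v t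
          grow₂ (s , e′) = grow₃ (graft grown p y s hp hy e′)
            where
            grow₃ : (∃ λ t′ → Grown v t′ × (∀ z → χ (v == z) + occ t′ z ≡ χ (v == z) + occ t z + χ (y == z))) → ∃ λ t → Rep v t
            grow₃ (t′ , grown′ , occ′) = search fuel t′ grown′ (<-≤-trans shrink (≤-pred lt))
              where
              total′ : Total t′ ≡ suc (Total t)
              total′ = trans (∑-cong occ′) (trans (∑-+ _ _) (trans (cong (Total t +_) (∑-point y)) (+-comm (Total t) 1)))
              total≤ : Total t′ ≤ n
              total≤ = ≤-trans (∑-mono (Grown.occ≤ grown′)) (≤-reflexive (trans (∑-const n 1) (*-identityʳ n)))
              shrink : n ∸ Total t′ < n ∸ Total t
              shrink = ∸-monoʳ-< (subst (Total t <_) (sym total′) (n<1+n _)) total≤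

    record Halves (μ : ℕ) : Set where
      field
        {v}    : Fin n
        {t₁ t₂} : Forest n
        rep    : Rep v (t₁ ⊕ t₂)
        lower  : μ ≤ size t₁
        upper  : size t₁ < 2 * μ

    -- Descend into a child with at least μ descendants, rerooting there; at the deepest such vertex collect child trees until they have μ vertices.
    descend : ∀ μ x k acc up → Rep x (acc ⊕ (k ⊕ up)) → size acc < μ → μ ≤ size acc + size k → Halves μ
    descend μ x ∅ acc up rep small big = ⊥-elim (<⇒≱ small (subst (μ ≤_) (+-identityʳ _) big))
    descend μ x (br s c kc r) acc up rep small big with μ ≤? size kc
    -- Rerooting at c turns the old root x into a child of c along the reversed edge and keeps the
    -- represented tree.
    ... | yes deep = descend μ c kc ∅ (br (not s) x (acc ⊕ (r ⊕ up)) ∅) rep′ (≤-<-trans z≤n small) deep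
      where
      open Rep rep
      rep′ : Rep c (kc ⊕ br (not s) x (acc ⊕ (r ⊕ up)) ∅)
      rep′ = record
        { occ≡ = λ y → trans (cong (χ (c == y) +_) (trans (occ-⊕ kc _ y) (cong (λ z → occ kc y + (χ (x == y) + (z + 0))) (trans (occ-⊕ acc _ y) (cong (occ acc y +_) (occ-⊕ r up y))))))
                   (trans (ar (χ (c == y)) (occ kc y) (χ (x == y)) (occ acc y) (occ r y) (occ up y))
                     (trans (cong (χ (x == y) +_) (sym (trans (occ-⊕ acc _ y) (cong (λ z → occ acc y + (χ (c == y) + (occ kc y + z))) (occ-⊕ r up y))))) (occ≡ y)))
        ; arcs≡ = λ a b → trans (trans (arcs-⊕ c kc _ a b) (cong (λ z → arcs c kc a b + (arc (not s) c x a b + (z + 0))) (trans (arcs-⊕ x acc _ a b) (cong (arcs x acc a b +_) (arcs-⊕ x r up a b)))))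
                   (trans (cong (λ z → arcs c kc a b + (z + (arcs x acc a b + (arcs x r a b + arcs x up a b) + 0))) (arc-not s x c a b))
                     (trans (ar₂ (arcs c kc a b) (arc s x c a b) (arcs x acc a b) (arcs x r a b) (arcs x up a b))
                       (trans (sym (trans (arcs-⊕ x acc _ a b) (cong (λ z → arcs x acc a b + (arc s x c a b + (arcs c kc a b + z))) (arcs-⊕ x r up a b)))) (arcs≡ a b)))) }
        where
        ar : ∀ c k x a r u → c + (k + (x + (a + (r + u) + 0))) ≡ x + (a + (c + (k + (r + u))))
        ar = solve-∀
        ar₂ : ∀ k e a r u → k + (e + (a + (r + u) + 0)) ≡ a + (e + (k + (r + u)))
        ar₂ = solve-∀
    ... | no shallow with μ ≤? suc (size kc + size acc)
    -- The tree at c has at most μ vertices including c, and `acc` has fewer than μ, so together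
    -- they stay below 2 μ.
    ...   | yes enough = record { v = x ; t₁ = br s c kc acc ; t₂ = r ⊕ up ; rep = rep′ ; lower = enough
                                ; upper = subst (suc (suc (size kc + size acc)) ≤_) (cong (μ +_) (sym (+-identityʳ μ))) (subst (_≤ μ + μ) (cong suc (+-suc (size kc) (size acc))) (+-mono-≤ (≰⇒> shallow) small)) }
      where
      open Rep rep
      rep′ : Rep x (br s c kc (acc ⊕ (r ⊕ up)))
      rep′ = record
        { occ≡ = λ y → trans (cong (λ z → χ (x == y) + (χ (c == y) + (occ kc y + z))) (occ-⊕ acc (r ⊕ up) y))
                   (trans (ar (χ (x == y)) (χ (c == y)) (occ kc y) (occ acc y) _) (trans (cong (χ (x == y) +_) (sym (occ-⊕ acc _ y))) (occ≡ y)))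
        ; arcs≡ = λ a b → trans (cong (λ z → arc s x c a b + (arcs c kc a b + z)) (arcs-⊕ x acc (r ⊕ up) a b))
                   (trans (ar₂ (arc s x c a b) (arcs c kc a b) (arcs x acc a b) _) (trans (sym (arcs-⊕ x acc _ a b)) (arcs≡ a b))) }
        where
        ar : ∀ x c k a z → x + (c + (k + (a + z))) ≡ x + (a + (c + (k + z)))
        ar = solve-∀
        ar₂ : ∀ c k a z → c + (k + (a + z)) ≡ a + (c + (k + z))
        ar₂ = solve-∀
    ...   | no few = descend μ x r (br s c kc acc) up rep′ (≰⇒> few) (subst (μ ≤_) (ar₃ (size acc) (size kc) (size r)) big)
      where
      open Rep rep
      ar₃ : ∀ a k r → a + (1 + (k + r)) ≡ 1 + (k + a) + r
      ar₃ = solve-∀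
      rep′ : Rep x (br s c kc (acc ⊕ (r ⊕ up)))
      rep′ = record
        { occ≡ = λ y → trans (cong (λ z → χ (x == y) + (χ (c == y) + (occ kc y + z))) (occ-⊕ acc (r ⊕ up) y))
                   (trans (ar (χ (x == y)) (χ (c == y)) (occ kc y) (occ acc y) _) (trans (cong (χ (x == y) +_) (sym (occ-⊕ acc _ y))) (occ≡ y)))
        ; arcs≡ = λ a b → trans (cong (λ z → arc s x c a b + (arcs c kc a b + z)) (arcs-⊕ x acc (r ⊕ up) a b))
                   (trans (ar₂ (arc s x c a b) (arcs c kc a b) (arcs x acc a b) _) (trans (sym (arcs-⊕ x acc _ a b)) (arcs≡ a b))) }
        where
        ar : ∀ x c k a z → x + (c + (k + (a + z))) ≡ x + (a + (c + (k + z)))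
        ar = solve-∀
        ar₂ : ∀ c k a z → c + (k + (a + z)) ≡ a + (c + (k + z))
        ar₂ = solve-∀

    rep-size : ∀ {v t} → Rep v t → suc (size t) ≡ n
    rep-size {v} {t} rep = begin
      suc (size t)                           ≡⟨ cong₂ _+_ (∑-point v) (occ-total t) ⟨
      ∑ (λ y → χ (v == y)) + ∑ (occ t)       ≡⟨ ∑-+ _ _ ⟨
      ∑ (λ y → χ (v == y) + occ t y)         ≡⟨ ∑-cong (Rep.occ≡ rep) ⟩
      ∑ {n} (λ y → 1)                        ≡⟨ trans (∑-const n 1) (*-identityʳ n) ⟩
      n                                      ∎
      where open ≡-Reasoning

    halves : ∀ μ → 0 < μ → Fin n → suc μ ≤ n → Halves μ
    halves μ μ>0 v₀ le = go (represent v₀)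
      where
      ⊕-∅ : ∀ (t : Forest n) → t ⊕ ∅ ≡ t
      ⊕-∅ ∅ = refl
      ⊕-∅ (br s x k r) = cong (br s x k) (⊕-∅ r)
      go : (∃ λ t → Rep v₀ t) → Halves μ
      go (t , rep) = descend μ v₀ t ∅ ∅ (subst (Rep v₀) (sym (⊕-∅ t)) rep) μ>0 (≤-pred (subst (suc μ ≤_) (sym (rep-size rep)) le))

    edge-adj : ∀ {v t} → Rep v t → ∀ {s p y} → EdgeOf s p y v t → adj T (heel s p y) (tip s p y) ≡ true
    edge-adj rep e = χ≢0 (≤-trans (edge-arcs e) (≤-reflexive (Rep.arcs≡ rep _ _)))

    adj-edge : ∀ {v t} → Rep v t → ∀ x y → adj T x y ≡ true → EdgeOf true x y v t ⊎ EdgeOf false y x v t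
    adj-edge {v} {t} rep x y e = arcs-edge v t x y (≤-reflexive (trans (cong χ (sym e)) (sym (Rep.arcs≡ rep x y))))

    heads : Forest n → Fin n → ℕ
    heads ∅ y = 0
    heads (br s x k r) y = χ (x == y) + heads r y

    heads-total : ∀ t → ∑ (heads t) ≡ roots t
    heads-total ∅ = ∑-zero λ y → refl
    heads-total (br s x k r) = trans (∑-+ _ _) (cong₂ _+_ (∑-point x) (heads-total r))

    heads≤occ : ∀ t y → heads t y ≤ occ t y
    heads≤occ ∅ y = z≤n
    heads≤occ (br s x k r) y = +-monoʳ-≤ (χ (x == y)) (≤-trans (heads≤occ r y) (m≤n+m _ _))

    heads-edge : ∀ q t y → 1 ≤ heads t y → ∃ λ s → EdgeOf s q y q t
    heads-edge q (br s x k r) y h with x ≟ y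
    ... | yes refl = s , top
    ... | no _ with heads-edge q r y h
    ...   | s′ , e = s′ , sib e

    roots≤deg : ∀ q t → (∀ y → occ t y ≤ 1) → (∀ s p y → EdgeOf s p y q t → undAdj T p y ≡ true) → roots t ≤ undDeg T q
    roots≤deg q t simple und = subst₂ _≤_ (heads-total t) (sym (countFin≡cnt n (undAdj T q))) (∑-mono each)
      where
      each : ∀ y → heads t y ≤ χ (undAdj T q y)
      each y with heads t y in eq
      ... | zero = z≤n
      ... | suc m with heads-edge q t y (subst (1 ≤_) (sym eq) (s≤s z≤n))
      ...   | s , e rewrite und s q y e = subst (_≤ 1) eq (≤-trans (heads≤occ t y) (simple y))

    bounded : ∀ Δ q t → (∀ x → undDeg T x ≤ Δ) → (∀ y → occ t y ≤ 1) → (∀ s p y → EdgeOf s p y q t → undAdj T p y ≡ true) → Bounded Δ t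
    bounded Δ q ∅ deg simple und = tt
    bounded Δ q (br s x k r) deg simple und =
      ≤-trans (roots≤deg x k simplek undk) (deg x) , bounded Δ x k deg simplek undk ,
      bounded Δ q r deg (λ y → ≤-trans (occ-sib s x k r y) (simple y)) (λ s′ p y e → und s′ p y (sib e))
      where
      simplek : ∀ y → occ k y ≤ 1
      simplek y = ≤-trans (occ-kid s x k r y) (simple y)
      undk : ∀ s′ p y → EdgeOf s′ p y x k → undAdj T p y ≡ true
      undk s′ p y e = und s′ p y (kid e)

    edge-und : ∀ {v t} → Rep v t → ∀ s p y → EdgeOf s p y v t → undAdj T p y ≡ true
    edge-und rep true p y e rewrite edge-adj rep e = refl
    edge-und rep false p y e with adj T p y
    ... | true = refl
    ... | false = edge-adj rep e

  -- Signed adjacency of the host and the numerical conditions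

  host : ∀ {n} → Digraph n → Bool → Fin n → Fin n → Bool
  host D true  u v = adj D u v
  host D false u v = adj D v u

  host-flip : ∀ {n} (D : Digraph n) s u v → host D (not s) u v ≡ host D s v u
  host-flip D true  u v = refl
  host-flip D false u v = refl

  -- The factor 6 is 2 for the low vertices, at least half of all, times 3 for the classes.
  best-class : ∀ {n} (t : Forest n) → ∃ λ c → size t ≤ 6 * movable c t
  best-class t = pick-max (≤-total (movable Y t) (movable X t))
    where
    open ≤-Reasoning
    y = movable Y t
    x = movable X t
    z = movable Z t
    base : size t ≤ 2 * (y + x + z)
    base = ≤-trans (m≤m+n (size t) (roots t)) (≤-trans (size≤2lows t) (≤-reflexive (cong (2 *_) (sym (lows-classes t)))))
    three : ∀ m → y ≤ m → x ≤ m → z ≤ m → size t ≤ 6 * m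
    three m a b c = ≤-trans base (≤-trans (*-monoʳ-≤ 2 (+-mono-≤ (+-mono-≤ a b) c)) (≤-reflexive (ar m)))
      where
      ar : ∀ m → 2 * (m + m + m) ≡ 6 * m
      ar = solve-∀
    pick-max : y ≤ x ⊎ x ≤ y → ∃ λ c → size t ≤ 6 * movable c t
    pick-max (inj₁ y≤x) = go (≤-total x z)
      where
      go : x ≤ z ⊎ z ≤ x → ∃ λ c → size t ≤ 6 * movable c t
      go (inj₁ x≤z) = Z , three z (≤-trans y≤x x≤z) x≤z ≤-refl
      go (inj₂ z≤x) = X , three x y≤x ≤-refl z≤x
    pick-max (inj₂ x≤y) = go (≤-total y z)
      where
      go : y ≤ z ⊎ z ≤ y → ∃ λ c → size t ≤ 6 * movable c t
      go (inj₁ y≤z) = Z , three z y≤z (≤-trans x≤y y≤z) ≤-refl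
      go (inj₂ z≤y) = Y , three y ≤-refl x≤y z≤y

  EdgeOf-⊕ : ∀ {n} {s : Bool} {p y q : Fin n} (t t′ : Forest n) → EdgeOf s p y q (t ⊕ t′) → EdgeOf s p y q t ⊎ EdgeOf s p y q t′
  EdgeOf-⊕ ∅ t′ e = inj₂ e
  EdgeOf-⊕ (br s x k r) t′ top = inj₁ top
  EdgeOf-⊕ (br s x k r) t′ (kid e) = inj₁ (kid e)
  EdgeOf-⊕ (br s x k r) t′ (sib e) with EdgeOf-⊕ r t′ e
  ... | inj₁ a = inj₁ (sib a)
  ... | inj₂ b = inj₂ b

  ⊕-EdgeOfˡ : ∀ {n} {s : Bool} {p y q : Fin n} {t : Forest n} (t′ : Forest n) → EdgeOf s p y q t → EdgeOf s p y q (t ⊕ t′)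
  ⊕-EdgeOfˡ t′ top = top
  ⊕-EdgeOfˡ t′ (kid e) = kid e
  ⊕-EdgeOfˡ t′ (sib e) = sib (⊕-EdgeOfˡ t′ e)

  ⊕-EdgeOfʳ : ∀ {n} {s : Bool} {p y q : Fin n} (t : Forest n) {t′ : Forest n} → EdgeOf s p y q t′ → EdgeOf s p y q (t ⊕ t′)
  ⊕-EdgeOfʳ ∅ e = e
  ⊕-EdgeOfʳ (br s x k r) e = sib (⊕-EdgeOfʳ r e)

  size-⊕ : ∀ {n} (t t′ : Forest n) → size (t ⊕ t′) ≡ size t + size t′
  size-⊕ ∅ t′ = refl
  size-⊕ (br s x k r) t′ = cong suc (trans (cong (size k +_) (size-⊕ r t′)) (sym (+-assoc (size k) _ _)))

  -- The numbers: l ≈ log n, h bounds the number of vertices left to the final switching phase, μ ≈ |t₁|,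
  -- and 2 D is the size at which subtrees are cut off in the almost-spanning phase.
  module Derived (a Δ D : ℕ) where
    A L Mmax d₃ : ℕ
    A = suc a
    L = 2 * D
    Mmax = suc (Δ * L)
    d₃ = A * (A * (2 * A))

  record Scales (a Δ n l h μ D : ℕ) : Set where
    open Derived a Δ D public
    field
      D>0   : 1 ≤ D
      μ>0   : 1 ≤ μ
      n≤2^l : n + n ≤ 2 ^ l
      tests : 2 * (n * n) < 2 ^ (2 * l)
      l>0   : 1 ≤ l
      rich  : 6 * (2 * d₃ * h + (d₃ + d₃ + Δ * (2 * A)) * (2 * l)) ≤ μ
      roomy : (2 * A + 1) * (2 * μ + h) ≤ n
      small : Δ * L ≤ h
      cut₁  : 2 * A * (suc (4 * L) * (L * Mmax)) ≤ h
      cut₂  : 2 * A * (2 * A * (suc (4 * L) * (suc (4 * L) * Mmax))) ≤ 2 * h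
      cut₃  : 4 * (18 * A * l * (Mmax * D)) ≤ h
      cut₄  : Mmax + 3 * (suc (18 * A) * n) ≤ D * (h ∸ Mmax)

  -- eT u v: the directed tree has the edge u → v.  E true is the adjacency of the host.

  module Host {n : ℕ} (T : Digraph n) (E : Bool → Fin n → Fin n → Bool) (E-flip : ∀ s u v → E (not s) u v ≡ E s v u) where

    -- Embeddings of forests and walks along random matchings

    eT : Fin n → Fin n → Bool
    eT = adj T

    Pool : Set
    Pool = Fin n → Bool

    -- Emb U p t U′: the forest t is embedded below the image p of its root, its vertices taking the elements of U that are missing in U′.
    data Emb : Pool → Fin n → Forest n → Pool → Set where
      ∅  : ∀ {U p} → Emb U p ∅ U
      br : ∀ {U U₁ U₂ p s x k r} u → U u ≡ true → E s p u ≡ true → Emb (U ∖ u) u k U₁ → Emb U₁ p r U₂ → Emb U p (br s x k r) U₂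

    cost : (Fin n → ℕ) → ∀ {U p t U′} → Emb U p t U′ → ℕ
    cost F ∅ = 0
    cost F (br u _ _ ε δ) = F u + (cost F ε + cost F δ)

    ∑-Emb : ∀ (g : Fin n → ℕ) {U p t U′} (ε : Emb U p t U′) → ∑ (λ x → χ (U x) * g x) ≡ cost g ε + ∑ (λ x → χ (U′ x) * g x)
    ∑-Emb g ∅ = refl
    ∑-Emb g {U = U} (br u Uu _ ε δ) = trans (∑-∖ U g u Uu) (trans (cong (g u +_) (trans (∑-Emb g ε) (cong (cost g ε +_) (∑-Emb g δ))))
      (arith (g u) (cost g ε) (cost g δ) _))
      where
      arith : ∀ a b c d → a + (b + (c + d)) ≡ a + (b + c) + d
      arith = solve-∀

    cost-1 : ∀ {U p t U′} (ε : Emb U p t U′) → cost (λ _ → 1) ε ≡ size t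
    cost-1 ∅ = refl
    cost-1 (br u _ _ ε δ) = cong suc (cong₂ _+_ (cost-1 ε) (cost-1 δ))

    cnt-Emb : ∀ {U p t U′} (ε : Emb U p t U′) → cnt U ≡ size t + cnt U′
    cnt-Emb {U} {U′ = U′} ε = trans (cnt-χ1 U) (trans (∑-Emb (λ _ → 1) ε) (cong₂ _+_ (cost-1 ε) (sym (cnt-χ1 U′))))

    Emb-⊆ : ∀ {U p t U′} → Emb U p t U′ → ∀ x → U′ x ≡ true → U x ≡ true
    Emb-⊆ ∅ x h = h
    Emb-⊆ {U} (br u _ _ ε δ) x h = ∖-⊆ U u x (Emb-⊆ ε x (Emb-⊆ δ x h))

    record CheapEmb (F : Fin n → ℕ) (W : Pool) (p : Fin n) (t : Forest n) (scale bound : ℕ) : Set where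
      constructor cheap
      field
        {W′}  : Pool
        ε     : Emb W p t W′
        bound≤ : cost F ε * scale ≤ bound

    module Guided (U : Pool) (F : Fin n → ℕ) {ℓ : ℕ} (factors : ∀ s → Factor U (E s) ℓ) (ℓ′ m : ℕ) (ℓ≡ : ℓ ≡ ℓ′ + m) (ℓ′>0 : 0 < ℓ′) where

      open Factor

      σ : Bool → Fin ℓ → Fin n → Fin n
      σ s = match (factors s)

      SF : ℕ
      SF = ∑ (λ x → χ (U x) * F x)

      -- The expected cost of embedding t below p when every vertex is sent from the image of its parent along a random
      -- one of the ℓ matchings; the scaling ℓ′ ^ size t leaves room for avoiding the m vertices already used.
      guide : Forest n → Fin n → ℕ
      guide ∅ p = 0
      guide (br s x k r) p = ℓ′ ^ size r * ∑ (λ i → ℓ′ ^ size k * F (σ s i p) + guide k (σ s i p)) + ℓ′ ^ suc (size k) * guide r p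

      embed-guided : ∀ t p W → U p ≡ true → (∀ x → W x ≡ true → U x ≡ true) → cnt U + size t ≤ cnt W + m →
                     CheapEmb F W p t (ℓ′ ^ size t) (guide t p)
      embed-guided ∅ p W Up W⊆U room = cheap ∅ z≤n
      embed-guided (br s x k r) p W Up W⊆U room =
        first (pick (λ _ → true) (λ i → σ s i p) c U W m ℓ′ (λ i _ → BijOn.into (bij (factors s) i) p Up)
                (λ i j _ _ eq → disjoint (factors s) i j p Up eq) W⊆U (m+n≤o⇒m≤o _ room)
                (≤-reflexive (trans (sym ℓ≡) (sym (cnt-true ℓ)))) ℓ′>0)
        where
        open ≤-Reasoning
        c : Fin ℓ → ℕ
        c i = ℓ′ ^ size k * F (σ s i p) + guide k (σ s i p)
        first : (∃ λ i → true ≡ true × W (σ s i p) ≡ true × c i * ℓ′ ≤ ∑ (λ i → 1 * c i)) →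
                CheapEmb F W p (br s x k r) (ℓ′ ^ size (br s x k r)) (guide (br s x k r) p)
        first (i , _ , Wu , le) = second (embed-guided k u (W ∖ u) (W⊆U u Wu) (λ y h → W⊆U y (∖-⊆ W u y h)) roomk)
          where
          u = σ s i p
          cntW : cnt W ≡ suc (cnt (W ∖ u))
          cntW = cnt-∖ W u Wu
          roomk : cnt U + size k ≤ cnt (W ∖ u) + m
          roomk = ≤-pred (begin
            suc (cnt U + size k)             ≡⟨ +-suc (cnt U) (size k) ⟨
            cnt U + suc (size k)             ≤⟨ +-monoʳ-≤ (cnt U) (s≤s (m≤m+n _ _)) ⟩
            cnt U + suc (size k + size r)    ≤⟨ room ⟩
            cnt W + m                        ≡⟨ cong (_+ m) cntW ⟩
            suc (cnt (W ∖ u) + m)            ∎)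
          second : CheapEmb F (W ∖ u) u k (ℓ′ ^ size k) (guide k u) → CheapEmb F W p (br s x k r) (ℓ′ ^ size (br s x k r)) (guide (br s x k r) p)
          second (cheap {W₁} ε εb) = third (embed-guided r p W₁ Up (λ y h → W⊆U y (∖-⊆ W u y (Emb-⊆ ε y h))) roomr)
            where
            roomr : cnt U + size r ≤ cnt W₁ + m
            roomr = +-cancelˡ-≤ (suc (size k)) _ _ (begin
              suc (size k) + (cnt U + size r)  ≡⟨ arith (size k) (cnt U) (size r) ⟩
              cnt U + suc (size k + size r)    ≤⟨ room ⟩
              cnt W + m                        ≡⟨ cong (_+ m) (trans cntW (cong suc (cnt-Emb ε))) ⟩
              suc (size k + cnt W₁) + m        ≡⟨ +-assoc (suc (size k)) (cnt W₁) m ⟩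
              suc (size k) + (cnt W₁ + m)      ∎)
              where
              arith : ∀ a b c → 1 + a + (b + c) ≡ b + (1 + (a + c))
              arith = solve-∀
            third : CheapEmb F W₁ p r (ℓ′ ^ size r) (guide r p) → CheapEmb F W p (br s x k r) (ℓ′ ^ size (br s x k r)) (guide (br s x k r) p)
            third (cheap δ δb) = cheap (br u Wu (along (factors s) i p Up) ε δ) (begin
              (F u + (cost F ε + cost F δ)) * (ℓ′ * ℓ′ ^ (size k + size r))
                ≡⟨ cong (λ h → (F u + (cost F ε + cost F δ)) * (ℓ′ * h)) (^-distribˡ-+-* ℓ′ (size k) (size r)) ⟩
              (F u + (cost F ε + cost F δ)) * (ℓ′ * (ℓ′ ^ size k * ℓ′ ^ size r))
                ≡⟨ arith (F u) (cost F ε) (cost F δ) ℓ′ (ℓ′ ^ size k) (ℓ′ ^ size r) ⟩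
              ℓ′ ^ size r * ((ℓ′ ^ size k * F u + cost F ε * ℓ′ ^ size k) * ℓ′) + ℓ′ * ℓ′ ^ size k * (cost F δ * ℓ′ ^ size r)
                ≤⟨ +-mono-≤ (*-monoʳ-≤ (ℓ′ ^ size r) (≤-trans (*-monoˡ-≤ ℓ′ (+-monoʳ-≤ (ℓ′ ^ size k * F u) εb)) le)) (*-monoʳ-≤ (ℓ′ * ℓ′ ^ size k) δb) ⟩
              ℓ′ ^ size r * ∑ (λ i → 1 * c i) + ℓ′ * ℓ′ ^ size k * guide r p
                ≡⟨ cong (λ h → ℓ′ ^ size r * h + ℓ′ * ℓ′ ^ size k * guide r p) (∑-cong λ i → *-identityˡ (c i)) ⟩
              ℓ′ ^ size r * ∑ c + ℓ′ * ℓ′ ^ size k * guide r p ∎)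
              where
              arith : ∀ f a b l A B → (f + (a + b)) * (l * (A * B)) ≡ B * ((A * f + a * A) * l) + l * A * (b * B)
              arith = solve-∀

      ℓ′≤ℓ : ℓ′ ≤ ℓ
      ℓ′≤ℓ = subst (ℓ′ ≤_) (sym ℓ≡) (m≤m+n ℓ′ m)

      -- If the start is uniform in U, so is every later vertex of the walk, because each step
      -- follows a matching. Hence each of the `size t` vertices costs the average of F, here scaled
      -- by ℓ ^ size t and by the size of U.
      ∑-guide : ∀ t → ∑ (λ p → χ (U p) * guide t p) ≤ size t * ℓ ^ size t * SF
      ∑-guide ∅ = ≤-reflexive (∑-zero λ p → *-zeroʳ (χ (U p)))
      ∑-guide (br s x k r) = begin
        ∑ (λ p → χ (U p) * guide (br s x k r) p)
          ≡⟨ ∑-cong (λ p → expand p) ⟩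
        ∑ (λ p → B * ∑ (λ i → A * (χ (U p) * F (σ s i p)) + χ (U p) * guide k (σ s i p)) + ℓ′ * A * (χ (U p) * guide r p))
          ≡⟨ trans (∑-+ _ _) (cong₂ _+_ (∑-*ˡ B _) (∑-*ˡ (ℓ′ * A) _)) ⟩
        B * ∑ (λ p → ∑ (λ i → A * (χ (U p) * F (σ s i p)) + χ (U p) * guide k (σ s i p))) + ℓ′ * A * ∑ (λ p → χ (U p) * guide r p)
          ≡⟨ cong (λ h → B * h + ℓ′ * A * ∑ (λ p → χ (U p) * guide r p)) (∑-swap _) ⟩
        B * ∑ (λ i → ∑ (λ p → A * (χ (U p) * F (σ s i p)) + χ (U p) * guide k (σ s i p))) + ℓ′ * A * ∑ (λ p → χ (U p) * guide r p)
          ≤⟨ +-mono-≤ (*-monoʳ-≤ B (∑-mono per-matching)) (*-monoʳ-≤ (ℓ′ * A) (∑-guide r)) ⟩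
        B * ∑ {ℓ} (λ i → A * SF + size k * ℓ ^ size k * SF) + ℓ′ * A * (size r * ℓ ^ size r * SF)
          ≡⟨ cong (λ h → B * h + ℓ′ * A * (size r * ℓ ^ size r * SF)) (∑-const ℓ _) ⟩
        B * (ℓ * (A * SF + size k * ℓ ^ size k * SF)) + ℓ′ * A * (size r * ℓ ^ size r * SF)
          ≤⟨ +-mono-≤ (*-mono-≤ {B} Bm (*-monoʳ-≤ ℓ (+-monoˡ-≤ _ (*-monoˡ-≤ SF Am)))) (*-monoˡ-≤ _ (*-mono-≤ {ℓ′} ℓ′≤ℓ Am)) ⟩
        ℓ ^ size r * (ℓ * (ℓ ^ size k * SF + size k * ℓ ^ size k * SF)) + ℓ * ℓ ^ size k * (size r * ℓ ^ size r * SF)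
          ≡⟨ arith (ℓ ^ size r) (ℓ ^ size k) ℓ SF (size k) (size r) ⟩
        suc (size k + size r) * (ℓ * (ℓ ^ size k * ℓ ^ size r)) * SF
          ≡⟨ cong (λ h → suc (size k + size r) * (ℓ * h) * SF) (^-distribˡ-+-* ℓ (size k) (size r)) ⟨
        suc (size k + size r) * ℓ ^ suc (size k + size r) * SF ∎
        where
        open ≤-Reasoning
        A = ℓ′ ^ size k
        B = ℓ′ ^ size r
        Am : A ≤ ℓ ^ size k
        Am = ^-monoˡ-≤ (size k) ℓ′≤ℓ
        Bm : B ≤ ℓ ^ size r
        Bm = ^-monoˡ-≤ (size r) ℓ′≤ℓ
        arith : ∀ b a l S k r → b * (l * (a * S + k * a * S)) + l * a * (r * b * S) ≡ (1 + (k + r)) * (l * (a * b)) * S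
        arith = solve-∀
        expand : ∀ p → χ (U p) * guide (br s x k r) p ≡
                 B * ∑ (λ i → A * (χ (U p) * F (σ s i p)) + χ (U p) * guide k (σ s i p)) + ℓ′ * A * (χ (U p) * guide r p)
        expand p = trans (ar (χ (U p)) B _ (ℓ′ * A) (guide r p)) (cong (λ h → B * h + ℓ′ * A * (χ (U p) * guide r p))
          (trans (sym (∑-*ˡ (χ (U p)) _)) (∑-cong λ i → ar2 (χ (U p)) A (F (σ s i p)) (guide k (σ s i p)))))
          where
          ar : ∀ x b g a h → x * (b * g + a * h) ≡ b * (x * g) + a * (x * h)
          ar = solve-∀
          ar2 : ∀ x a f g → x * (a * f + g) ≡ a * (x * f) + x * g
          ar2 = solve-∀
        per-matching : ∀ i → ∑ (λ p → A * (χ (U p) * F (σ s i p)) + χ (U p) * guide k (σ s i p)) ≤ A * SF + size k * ℓ ^ size k * SF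
        per-matching i = begin
          ∑ (λ p → A * (χ (U p) * F (σ s i p)) + χ (U p) * guide k (σ s i p))
            ≡⟨ trans (∑-+ _ _) (cong (_+ ∑ (λ p → χ (U p) * guide k (σ s i p))) (∑-*ˡ A _)) ⟩
          A * ∑ (λ p → χ (U p) * F (σ s i p)) + ∑ (λ p → χ (U p) * guide k (σ s i p))
            ≤⟨ +-mono-≤ (*-monoʳ-≤ A (∑-BijOn (bij (factors s) i) F)) (≤-trans (∑-BijOn (bij (factors s) i) (guide k)) (∑-guide k)) ⟩
          A * SF + size k * ℓ ^ size k * SF ∎

      -- The children of a block's centre: a child of sign s starts its subtree at `τ s u`, with u
      -- drawn from the vertices served by the centre. The powers with exponent `L ∸ size k` bring
      -- subtrees of different sizes to the common scale ℓ ^ L.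
      module Kids (L : ℕ) (τ : Bool → Fin n → Fin n) (τ-bij : ∀ s → BijOn U (τ s)) where

        total : Forest n → Fin n → ℕ
        total ∅ u = 0
        total (br s x k r) u = ℓ′ ^ (L ∸ size k) * (ℓ′ ^ size k * F (τ s u) + guide k (τ s u)) + total r u

        ∑-total : ∀ kf → Short L kf → ∑ (λ u → χ (U u) * total kf u) ≤ size kf * ℓ ^ L * SF
        ∑-total ∅ _ = ≤-reflexive (∑-zero λ u → *-zeroʳ (χ (U u)))
        ∑-total (br s x k r) (k≤L , short) = begin
          ∑ (λ u → χ (U u) * total (br s x k r) u)
            ≡⟨ ∑-cong (λ u → ar (χ (U u)) B A (F (τ s u)) (guide k (τ s u)) (total r u)) ⟩
          ∑ (λ u → B * (A * (χ (U u) * F (τ s u))) + (B * (χ (U u) * guide k (τ s u)) + χ (U u) * total r u))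
            ≡⟨ trans (∑-+ _ _) (cong₂ _+_ (trans (∑-*ˡ B _) (cong (B *_) (∑-*ˡ A _))) (trans (∑-+ _ _) (cong (_+ ∑ (λ u → χ (U u) * total r u)) (∑-*ˡ B _)))) ⟩
          B * (A * ∑ (λ u → χ (U u) * F (τ s u))) + (B * ∑ (λ u → χ (U u) * guide k (τ s u)) + ∑ (λ u → χ (U u) * total r u))
            ≤⟨ +-mono-≤ (*-monoʳ-≤ B (*-monoʳ-≤ A (∑-BijOn (τ-bij s) F)))
                 (+-mono-≤ (*-monoʳ-≤ B (≤-trans (∑-BijOn (τ-bij s) (guide k)) (∑-guide k))) (∑-total r short)) ⟩
          B * (A * SF) + (B * (size k * ℓ ^ size k * SF) + size r * ℓ ^ L * SF)
            ≤⟨ +-mono-≤ (*-mono-≤ {B} Bm (*-monoˡ-≤ SF Am)) (+-monoˡ-≤ (size r * ℓ ^ L * SF) (*-monoˡ-≤ (size k * ℓ ^ size k * SF) Bm)) ⟩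
          ℓ ^ (L ∸ size k) * (ℓ ^ size k * SF) + (ℓ ^ (L ∸ size k) * (size k * ℓ ^ size k * SF) + size r * ℓ ^ L * SF)
            ≡⟨ ar2 (ℓ ^ (L ∸ size k)) (ℓ ^ size k) SF (size k) (size r) (ℓ ^ L) ⟩
          suc (size k) * (ℓ ^ (L ∸ size k) * ℓ ^ size k) * SF + size r * ℓ ^ L * SF
            ≡⟨ cong (λ h → suc (size k) * h * SF + size r * ℓ ^ L * SF)
                 (trans (sym (^-distribˡ-+-* ℓ (L ∸ size k) (size k))) (cong (ℓ ^_) (m∸n+n≡m k≤L))) ⟩
          suc (size k) * ℓ ^ L * SF + size r * ℓ ^ L * SF
            ≡⟨ ar3 (size k) (size r) (ℓ ^ L) SF ⟩
          suc (size k + size r) * ℓ ^ L * SF ∎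
          where
          open ≤-Reasoning
          A = ℓ′ ^ size k
          B = ℓ′ ^ (L ∸ size k)
          Am : A ≤ ℓ ^ size k
          Am = ^-monoˡ-≤ (size k) ℓ′≤ℓ
          Bm : B ≤ ℓ ^ (L ∸ size k)
          Bm = ^-monoˡ-≤ (L ∸ size k) ℓ′≤ℓ
          ar : ∀ x b a f g t → x * (b * (a * f + g) + t) ≡ b * (a * (x * f)) + (b * (x * g) + x * t)
          ar = solve-∀
          ar2 : ∀ b a S k r l → b * (a * S) + (b * (k * a * S) + r * l * S) ≡ (1 + k) * (b * a) * S + r * l * S
          ar2 = solve-∀
          ar3 : ∀ k r l S → (1 + k) * l * S + r * l * S ≡ (1 + (k + r)) * l * S
          ar3 = solve-∀

        embed-kids : ∀ kf c (Q : Pool) W e → Short L kf → (∀ u → Q u ≡ true → U u ≡ true) → (∀ s u → Q u ≡ true → E s c (τ s u) ≡ true) →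
                     (∀ x → W x ≡ true → U x ≡ true) → cnt U + size kf ≤ cnt W + m → e + m ≤ cnt Q → 0 < e →
                     CheapEmb F W c kf (e * ℓ′ ^ L) (∑ (λ u → χ (Q u) * total kf u))
        embed-kids ∅ c Q W e _ _ _ _ _ _ _ = cheap ∅ z≤n
        embed-kids (br s x k r) c Q W e (k≤L , short) Q⊆U Qadj W⊆U room many e>0 =
          first (pick Q (τ s) h U W m e (λ u Qu → BijOn.into (τ-bij s) u (Q⊆U u Qu))
                  (λ u v Qu Qv eq → BijOn.inj (τ-bij s) u v (Q⊆U u Qu) (Q⊆U v Qv) eq) W⊆U (m+n≤o⇒m≤o _ room) many e>0)
          where
          open ≤-Reasoning
          B = ℓ′ ^ (L ∸ size k)
          h : Fin n → ℕ
          h u = B * (ℓ′ ^ size k * F (τ s u) + guide k (τ s u))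
          Goal = CheapEmb F W c (br s x k r) (e * ℓ′ ^ L) (∑ (λ u → χ (Q u) * total (br s x k r) u))
          first : (∃ λ u → Q u ≡ true × W (τ s u) ≡ true × h u * e ≤ ∑ (λ u → χ (Q u) * h u)) → Goal
          first (u , Qu , Wv , le) = second (embed-guided k v (W ∖ v) (W⊆U v Wv) (λ y z → W⊆U y (∖-⊆ W v y z)) roomk)
            where
            v = τ s u
            cntW : cnt W ≡ suc (cnt (W ∖ v))
            cntW = cnt-∖ W v Wv
            roomk : cnt U + size k ≤ cnt (W ∖ v) + m
            roomk = ≤-pred (begin
              suc (cnt U + size k)             ≡⟨ +-suc (cnt U) (size k) ⟨
              cnt U + suc (size k)             ≤⟨ +-monoʳ-≤ (cnt U) (s≤s (m≤m+n _ _)) ⟩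
              cnt U + suc (size k + size r)    ≤⟨ room ⟩
              cnt W + m                        ≡⟨ cong (_+ m) cntW ⟩
              suc (cnt (W ∖ v) + m)            ∎)
            second : CheapEmb F (W ∖ v) v k (ℓ′ ^ size k) (guide k v) → Goal
            second (cheap {W₁} ε εb) = third (embed-kids r c Q W₁ e short Q⊆U Qadj (λ y z → W⊆U y (∖-⊆ W v y (Emb-⊆ ε y z))) roomr many e>0)
              where
              roomr : cnt U + size r ≤ cnt W₁ + m
              roomr = +-cancelˡ-≤ (suc (size k)) _ _ (begin
                suc (size k) + (cnt U + size r)  ≡⟨ arith (size k) (cnt U) (size r) ⟩
                cnt U + suc (size k + size r)    ≤⟨ room ⟩
                cnt W + m                        ≡⟨ cong (_+ m) (trans cntW (cong suc (cnt-Emb ε))) ⟩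
                suc (size k + cnt W₁) + m        ≡⟨ +-assoc (suc (size k)) (cnt W₁) m ⟩
                suc (size k) + (cnt W₁ + m)      ∎)
                where
                arith : ∀ a b c → 1 + a + (b + c) ≡ b + (1 + (a + c))
                arith = solve-∀
              third : CheapEmb F W₁ c r (e * ℓ′ ^ L) (∑ (λ u → χ (Q u) * total r u)) → Goal
              third (cheap δ δb) = cheap (br v Wv (Qadj s u Qu) ε δ) (begin
                (F v + (cost F ε + cost F δ)) * (e * ℓ′ ^ L)
                  ≡⟨ ar1 (F v) (cost F ε) (cost F δ) e (ℓ′ ^ L) ⟩
                (F v + cost F ε) * e * ℓ′ ^ L + cost F δ * (e * ℓ′ ^ L)
                  ≡⟨ cong (λ z → (F v + cost F ε) * e * z + cost F δ * (e * ℓ′ ^ L))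
                       (trans (cong (ℓ′ ^_) (sym (m∸n+n≡m k≤L))) (^-distribˡ-+-* ℓ′ (L ∸ size k) (size k))) ⟩
                (F v + cost F ε) * e * (B * ℓ′ ^ size k) + cost F δ * (e * ℓ′ ^ L)
                  ≡⟨ cong (_+ cost F δ * (e * ℓ′ ^ L)) (ar2 (F v) (cost F ε) e B (ℓ′ ^ size k)) ⟩
                B * (ℓ′ ^ size k * F v + cost F ε * ℓ′ ^ size k) * e + cost F δ * (e * ℓ′ ^ L)
                  ≤⟨ +-mono-≤ (≤-trans (*-monoˡ-≤ e (*-monoʳ-≤ B (+-monoʳ-≤ (ℓ′ ^ size k * F v) εb))) le) δb ⟩
                ∑ (λ u → χ (Q u) * h u) + ∑ (λ u → χ (Q u) * total r u)
                  ≡⟨ ∑-+ _ _ ⟨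
                ∑ (λ u → χ (Q u) * h u + χ (Q u) * total r u)
                  ≡⟨ ∑-cong (λ u → *-distribˡ-+ (χ (Q u)) (h u) (total r u)) ⟨
                ∑ (λ u → χ (Q u) * total (br s x k r) u) ∎)
                where
                ar1 : ∀ f a b e l → (f + (a + b)) * (e * l) ≡ (f + a) * e * l + b * (e * l)
                ar1 = solve-∀
                ar2 : ∀ f a e B A → (f + a) * e * (B * A) ≡ B * (A * f + a * A) * e
                ar2 = solve-∀

    -- Placing one block near its average cost

    Dense : ℕ → Pool → Set
    Dense B U = ∀ s v → (B + 2) * cnt U ≤ 2 * (B * cnt (λ x → U x ∧ E s v x))

    flip-cnt : ∀ (U : Pool) s v → cnt (λ x → U x ∧ E (not s) v x) ≡ cnt (λ x → U x ∧ E s x v)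
    flip-cnt U s v = ∑-cong λ x → cong (λ b → χ (U x ∧ b)) (E-flip s v x)

    -- Two subsets of U of density 1/2 + 1/B overlap in density at least 2/B.
    common-neighbours : ∀ {B U} → Dense B U → ∀ s v s′ w → 2 * cnt U ≤ B * cnt (λ x → U x ∧ (E s v x ∧ E s′ w x))
    common-neighbours {B} {U} dense s v s′ w = *-cancelˡ-≤ 2 (lin 0
      (+-mono-≤ (+-mono-≤ (dense s v) (dense s′ w)) (*-monoʳ-≤ (2 * B) (cnt-∧∧ U (E s v) (E s′ w))))
      (arith B (cnt U) (cnt (λ x → U x ∧ E s v x)) (cnt (λ x → U x ∧ E s′ w x)) (cnt (λ x → U x ∧ (E s v x ∧ E s′ w x)))))
      where
      arith : ∀ B N c c′ d → 2 * (2 * N) + (2 * (B * c) + 2 * (B * c′) + 2 * B * (N + d)) + 0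
                           ≡ 2 * (B * d) + ((B + 2) * N + (B + 2) * N + 2 * B * (c + c′))
      arith = solve-∀

    -- Double counting of H between `From` and U: each c has density at least 1/2 + 1/B into U,
    -- while a vertex u outside the counted set sees fewer than z elements of `From`. As B z is at
    -- most the size of `From`, such u use up only the surplus 1/B, so the others are at least half
    -- of U.
    spread : ∀ {B U} (From : Pool) (H : Fin n → Fin n → Bool) z → 1 ≤ B →
             (∀ c → From c ≡ true → (B + 2) * cnt U ≤ 2 * (B * cnt (λ u → U u ∧ H c u))) →
             2 * cnt U ≤ B * cnt From → B * (B * z) ≤ 2 * cnt U →
             cnt U ≤ 2 * cnt (λ u → U u ∧ (z ≤ᵇ cnt (λ c → From c ∧ H c u)))
    spread {B@(suc _)} {U} From H z B≥1 deg Ybig zsmall with cnt U in eqN | cnt From in eqy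
    ... | zero  | _ = z≤n
    ... | suc N′ | zero = contradiction (≤-trans Ybig (≤-reflexive (*-zeroʳ B))) λ ()
    ... | N@(suc _) | y@(suc _) = *-cancelʳ-≤ N (2 * g) (B * y) (lin 0
        (+-mono-≤ (≤-trans (*-monoʳ-≤ y (≤-refl {(B + 2) * N})) double) (*-monoʳ-≤ (2 * N) Bz≤y)) (arith B N y g z))
      where
      open ≤-Reasoning
      G : Pool
      G u = z ≤ᵇ cnt (λ c → From c ∧ H c u)
      g = cnt (λ u → U u ∧ G u)
      Bz≤y : B * z ≤ y
      Bz≤y = *-cancelˡ-≤ B (≤-trans zsmall Ybig)
      arith : ∀ B N y g z → N * (B * y) + (2 * B * (g * y + N * z) + 2 * N * y) + 0 ≡ 2 * g * (B * y) + (y * ((B + 2) * N) + 2 * N * (B * z))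
      arith = solve-∀
      each : ∀ u → χ (U u) * cnt (λ c → From c ∧ H c u) ≤ χ (U u ∧ G u) * y + χ (U u) * z
      each u with U u | z ≤ᵇ cnt (λ c → From c ∧ H c u) in h
      ... | false | _ = z≤n
      ... | true | true = begin
        1 * cnt (λ c → From c ∧ H c u)   ≡⟨ *-identityˡ _ ⟩
        cnt (λ c → From c ∧ H c u)       ≤⟨ cnt-mono (λ c h → proj₁ (∧-true h)) ⟩
        cnt From                         ≡⟨ trans eqy (sym (*-identityˡ y)) ⟩
        1 * y                         ≤⟨ m≤m+n _ _ ⟩
        1 * y + 1 * z                 ∎
      ... | true | false = *-monoʳ-≤ 1 (<⇒≤ (≰⇒> λ le → subst Data.Bool.T h (≤⇒≤ᵇ le)))
      swapped : ∑ (λ c → χ (From c) * cnt (λ u → U u ∧ H c u)) ≤ g * y + N * z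
      swapped = begin
        ∑ (λ c → χ (From c) * cnt (λ u → U u ∧ H c u))
          ≡⟨ ∑-cong (λ c → sym (∑-*ˡ (χ (From c)) _)) ⟩
        ∑ (λ c → ∑ (λ u → χ (From c) * χ (U u ∧ H c u)))
          ≡⟨ ∑-swap _ ⟩
        ∑ (λ u → ∑ (λ c → χ (From c) * χ (U u ∧ H c u)))
          ≡⟨ ∑-cong (λ u → trans (∑-cong λ c → reorder (From c) (U u) (H c u)) (∑-*ˡ (χ (U u)) _)) ⟩
        ∑ (λ u → χ (U u) * cnt (λ c → From c ∧ H c u))
          ≤⟨ ∑-mono each ⟩
        ∑ (λ u → χ (U u ∧ G u) * y + χ (U u) * z)
          ≡⟨ trans (∑-+ _ _) (cong₂ _+_ (∑-*ʳ y _) (∑-*ʳ z _)) ⟩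
        g * y + cnt U * z
          ≡⟨ cong (λ h → g * y + h * z) eqN ⟩
        g * y + N * z ∎
        where
        reorder : ∀ a b c → χ a * χ (b ∧ c) ≡ χ b * χ (a ∧ c)
        reorder false false c = refl
        reorder false true  c = refl
        reorder true  false c = refl
        reorder true  true  c = refl
      double : y * ((B + 2) * N) ≤ 2 * B * (g * y + N * z)
      double = begin
        y * ((B + 2) * N)
          ≡⟨ cong (_* ((B + 2) * N)) (sym eqy) ⟩
        cnt From * ((B + 2) * N)
          ≡⟨ ∑-*ʳ ((B + 2) * N) _ ⟨
        ∑ (λ c → χ (From c) * ((B + 2) * N))
          ≤⟨ ∑-mono (λ c → row c) ⟩
        ∑ (λ c → 2 * B * (χ (From c) * cnt (λ u → U u ∧ H c u)))
          ≡⟨ ∑-*ˡ (2 * B) _ ⟩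
        2 * B * ∑ (λ c → χ (From c) * cnt (λ u → U u ∧ H c u))
          ≤⟨ *-monoʳ-≤ (2 * B) swapped ⟩
        2 * B * (g * y + N * z) ∎
        where
        row : ∀ c → χ (From c) * ((B + 2) * N) ≤ 2 * B * (χ (From c) * cnt (λ u → U u ∧ H c u))
        row c with From c in Yc
        ... | false = z≤n
        ... | true = begin
          1 * ((B + 2) * N)                            ≡⟨ *-identityˡ _ ⟩
          (B + 2) * N                                  ≤⟨ deg c Yc ⟩
          2 * (B * cnt (λ u → U u ∧ H c u))            ≡⟨ ar B (cnt (λ u → U u ∧ H c u)) ⟩
          2 * B * (1 * cnt (λ u → U u ∧ H c u))        ∎
          where
          ar : ∀ B x → 2 * (B * x) ≡ 2 * B * (1 * x)
          ar = solve-∀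

    -- The pairing τ serves out- and in-children at once: a vertex c of Hub u can be followed by u along an edge c → u
    -- and by τ u along an edge τ u → c.
    record Pairing (U : Pool) (a : Bool) (r : Fin n) (z : ℕ) : Set where
      field
        τ      : Fin n → Fin n
        τ-bij  : BijOn U τ
        Hub      : Fin n → Pool
        Z-size : ∀ u → U u ≡ true → cnt (Hub u) ≡ z
        Z-adj  : ∀ u c → U u ≡ true → Hub u c ≡ true → U c ≡ true × E a r c ≡ true × E true c u ≡ true × E false c (τ u) ≡ true

    -- Join u to u′ when at least z vertices c are adjacent to r and satisfy c → u and u′ → c. Since
    -- r and u have many common neighbours, `spread` gives every u at least half of all u′, and
    -- symmetrically for every u′; a perfect matching of this relation is τ.
    pairing : ∀ {B U} → 1 ≤ B → Dense B U → ∀ a r z → B * (B * z) ≤ 2 * cnt U → Pairing U a r z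
    pairing {B} {U} B≥1 dense a r z zsmall = build (Matching.perfect-matching U G rows cols)
      where
      link : Fin n → Fin n → Pool
      link u u′ c = (U c ∧ (E a r c ∧ E false u c)) ∧ E true u′ c
      G : Fin n → Fin n → Bool
      G u u′ = z ≤ᵇ cnt (link u u′)
      rows : ∀ u → U u ≡ true → cnt U ≤ 2 * cnt (λ u′ → U u′ ∧ G u u′)
      rows u _ = spread {B} {U} (λ c → U c ∧ (E a r c ∧ E false u c)) (λ c u′ → E true u′ c) z B≥1
        (λ c _ → subst (λ h → (B + 2) * cnt U ≤ 2 * (B * h)) (flip-cnt U true c) (dense false c)) (common-neighbours {B} {U} dense a r false u) zsmall
      cols : ∀ u′ → U u′ ≡ true → cnt U ≤ 2 * cnt (λ u → U u ∧ G u u′)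
      cols u′ _ = subst (λ h → cnt U ≤ 2 * h) (∑-cong λ u → cong (λ k → χ (U u ∧ (z ≤ᵇ k))) (∑-cong λ c → cong χ (shuffle (U c) (E a r c) (E true u′ c) (E false u c))))
        (spread {B} {U} (λ c → U c ∧ (E a r c ∧ E true u′ c)) (λ c u → E false u c) z B≥1
          (λ c _ → subst (λ h → (B + 2) * cnt U ≤ 2 * (B * h)) (flip-cnt U false c) (dense true c)) (common-neighbours {B} {U} dense a r true u′) zsmall)
        where
        shuffle : ∀ a b c d → (a ∧ (b ∧ c)) ∧ d ≡ (a ∧ (b ∧ d)) ∧ c
        shuffle false b     c     d     = refl
        shuffle true  false c     d     = refl
        shuffle true  true  false false = refl
        shuffle true  true  false true  = refl
        shuffle true  true  true  false = refl
        shuffle true  true  true  true  = refl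
      build : (∃ λ τ → BijOn U τ × ∀ u → U u ≡ true → G u (τ u) ≡ true) → Pairing U a r z
      build (τ , bij , along) = record { τ = τ ; τ-bij = bij ; Hub = λ u → proj₁ (Zs u) ; Z-size = λ u Uu → proj₂ (proj₂ (Zs u) Uu)
                                       ; Z-adj = λ u c Uu Zc → adj′ u c (proj₁ (proj₂ (Zs u) Uu) c Zc) }
        where
        -- Hubs are cut down to exactly z elements, so that in the count of pairs (u, c) all u have
        -- equal weight.
        trimmed : ∀ (p : Pool) b → (b ≡ true → z ≤ cnt p) → ∃ λ q → b ≡ true → (∀ c → q c ≡ true → p c ≡ true) × cnt q ≡ z
        trimmed p false h = p , λ ()
        trimmed p true  h with trim z p (h refl)
        ... | q , rest = q , λ _ → rest
        Zs : ∀ u → ∃ λ q → U u ≡ true → (∀ c → q c ≡ true → link u (τ u) c ≡ true) × cnt q ≡ z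
        Zs u = trimmed (link u (τ u)) (U u) λ Uu → ≤ᵇ⇒≤ z _ (subst Data.Bool.T (sym (along u Uu)) tt)
        adj′ : ∀ u c → link u (τ u) c ≡ true → U c ≡ true × E a r c ≡ true × E true c u ≡ true × E false c (τ u) ≡ true
        adj′ u c h with ∧-true {U c ∧ (E a r c ∧ E false u c)} h
        ... | h₁ , h₂ with ∧-true {U c} h₁
        ... | Uc , h₃ with ∧-true {E a r c} h₃
        ... | Ec , h₄ = Uc , Ec , trans (sym (E-flip true u c)) h₄ , trans (E-flip true c (τ u)) h₂

    factors : ∀ {B U} ℓ → 1 ≤ B → Dense B U → B * ℓ ≤ cnt U → ∀ s → Factor U (E s) ℓ
    factors {suc b} {U} ℓ B≥1 dense small s = factor U ℓ (E s) (λ x _ → deg s x)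
        (λ y _ → subst (λ h → cnt U + 2 * ℓ ≤ 2 * h) (flip-cnt U s y) (deg (not s) y))
      where
      B = suc b
      deg : ∀ s x → cnt U + 2 * ℓ ≤ 2 * cnt (λ y → U y ∧ E s x y)
      deg s x = *-cancelˡ-≤ B (lin 0 (+-mono-≤ (dense s x) (*-monoʳ-≤ 2 small)) (arith B (cnt U) ℓ (cnt (λ y → U y ∧ E s x y))))
        where
        arith : ∀ B N l c → B * (N + 2 * l) + (2 * (B * c) + 2 * N) + 0 ≡ B * (2 * c) + ((B + 2) * N + 2 * (B * l))
        arith = solve-∀

    record CheapBlock (F : Fin n → ℕ) (U : Pool) (a : Bool) (r : Fin n) (kf : Forest n) (scale bound : ℕ) : Set where
      constructor block
      field
        c    : Fin n
        Uc   : U c ≡ true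
        Ec   : E a r c ≡ true
        kids : CheapEmb F (U ∖ c) c kf scale bound

    -- The centre is a popular vertex of the hubs, so it is adjacent to r and the vertices u it
    -- serves are almost as cheap on average as all of U. Its children go to such u or to τ u
    -- according to sign, and their subtrees continue along the disjoint matchings. The cost of the
    -- centre itself is left open.
    cheap-block : ∀ {B U} D L ℓ z F a r kf → 1 ≤ B → 1 ≤ D → 1 ≤ L → Dense B U → Short L kf → B * ℓ ≤ cnt U → B * (B * z) ≤ 2 * cnt U →
                  suc (4 * D) * (L * suc (size kf)) ≤ ℓ → suc (4 * D) * (suc (4 * D) * suc (size kf)) ≤ z →
                  CheapBlock F U a r kf (cnt U * D) (suc D * (size kf * ∑ (λ x → χ (U x) * F x)))
    cheap-block {B} {U} (suc d) (suc l) ℓ z F a r kf B≥1 D≥1 L≥1 dense short Bℓ≤N Bz≤N ℓbig zbig = go (pairing {B} {U} B≥1 dense a r z Bz≤N)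
      where
      D = suc d
      L = suc l
      K = suc (4 * D)
      M = suc (size kf)
      open ≤-Reasoning
      M≤KX : ∀ w → M ≤ w → suc M ≤ K * w
      M≤KX w h = begin
        suc M                ≤⟨ +-mono-≤ (s≤s (z≤n {size kf})) (≤-refl {M}) ⟩
        M + M                ≤⟨ +-mono-≤ h h ⟩
        w + w                ≤⟨ +-monoʳ-≤ w (m≤m*n w (4 * D)) ⟩
        w + w * (4 * D)      ≡⟨ cong (w +_) (*-comm w (4 * D)) ⟩
        K * w                ∎
      M<ℓ : suc M ≤ ℓ
      M<ℓ = ≤-trans (M≤KX (L * M) (m≤n*m M L)) ℓbig
      ℓ′ = ℓ ∸ M
      ℓ≡ : ℓ ≡ ℓ′ + M
      ℓ≡ = sym (m∸n+n≡m (<⇒≤ M<ℓ))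
      ℓ′>0 : 0 < ℓ′
      ℓ′>0 = m<n⇒0<n∸m M<ℓ
      N>0 : 0 < cnt U
      N>0 = ≤-trans (≤-trans (s≤s z≤n) M<ℓ) (≤-trans (≤-trans (≤-reflexive (sym (*-identityˡ ℓ))) (*-monoˡ-≤ ℓ B≥1)) Bℓ≤N)
      -- From K L M ≤ ℓ: giving up M of the ℓ matchings at each of at most L steps loses only a
      -- factor 1 + 1/(4 D).
      powers : 4 * D * ℓ ^ L ≤ K * ℓ′ ^ L
      powers = *-cancelʳ-≤ (4 * D * ℓ ^ L) (K * ℓ′ ^ L) ℓ {{>-nonZero (≤-trans (s≤s z≤n) M<ℓ)}} (lin 0
        (+-mono-≤ (*-monoʳ-≤ K (subst (λ h → h ^ L * h ≤ ℓ′ ^ L * h + L * M * h ^ L) (sym ℓ≡) (power-loss ℓ′ M L))) (*-monoˡ-≤ (ℓ ^ L) ℓbig))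
        (arith (4 * D) (ℓ ^ L) (ℓ′ ^ L) ℓ (L * M)))
        where
        arith : ∀ D q p l x → D * q * l + ((1 + D) * (p * l + x * q) + l * q) + 0 ≡ (1 + D) * p * l + ((1 + D) * (q * l) + (1 + D) * x * q)
        arith = solve-∀
      go : Pairing U a r z → CheapBlock F U a r kf (cnt U * D) (suc D * (size kf * ∑ (λ x → χ (U x) * F x)))
      go pr = centre (popular U Hub (total kf) z (4 * D) Z-size (λ u c Uu Zc → proj₁ (Z-adj u c Uu Zc)) (*-mono-≤ N>0 (≤-trans (s≤s z≤n) zbig)) (s≤s z≤n))
        where
        open Pairing pr
        pair : Bool → Fin n → Fin n
        pair true  = id
        pair false = τ
        pair-bij : ∀ s → BijOn U (pair s)
        pair-bij true  = record { into = λ _ h → h ; inj = λ _ _ _ _ h → h }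
        pair-bij false = τ-bij
        open Guided U F (factors {B} {U} ℓ B≥1 dense Bℓ≤N) ℓ′ M ℓ≡ ℓ′>0
        open Kids L pair pair-bij
        centre : (∃ λ c → U c ≡ true × z ≤ K * cnt (λ u → U u ∧ Hub u c) ×
                   cnt U * (4 * D * ∑ (λ u → χ (U u ∧ Hub u c) * total kf u)) ≤ K * (cnt (λ u → U u ∧ Hub u c) * ∑ (λ u → χ (U u) * total kf u))) →
                 CheapBlock F U a r kf (cnt U * D) (suc D * (size kf * SF))
        centre (c , Uc , popular-c , cheap-c) = block c Uc (proj₁ (proj₂ (Z-adj′ (cnt-pos Q (≤-trans (s≤s z≤n) M<e)))))
            (finish (embed-kids kf c Q (U ∖ c) e′ short (λ u h → proj₁ (∧-true h)) Q-adj (λ x → ∖-⊆ U c x)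
              (≤-reflexive (trans (cong (_+ size kf) (cnt-∖ U c Uc)) (sym (+-suc _ _)))) (≤-reflexive (m∸n+n≡m (<⇒≤ M<e))) e′>0))
          where
          Q : Pool
          Q u = U u ∧ Hub u c
          e = cnt Q
          KM≤e : K * M ≤ e
          KM≤e = *-cancelˡ-≤ K (≤-trans zbig popular-c)
          M<e : suc M ≤ e
          M<e = ≤-trans (M≤KX M ≤-refl) KM≤e
          e′ = e ∸ M
          e′>0 : 0 < e′
          e′>0 = m<n⇒0<n∸m M<e
          Z-adj′ : (∃ λ u → Q u ≡ true) → U c ≡ true × E a r c ≡ true × ⊤
          Z-adj′ (u , Qu) with Z-adj u c (proj₁ (∧-true Qu)) (proj₂ (∧-true {U u} Qu))
          ... | Uc , Ec , _ = Uc , Ec , tt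
          Q-adj : ∀ s u → Q u ≡ true → E s c (pair s u) ≡ true
          Q-adj true  u Qu = proj₁ (proj₂ (proj₂ (Z-adj u c (proj₁ (∧-true Qu)) (proj₂ (∧-true {U u} Qu)))))
          Q-adj false u Qu = proj₂ (proj₂ (proj₂ (Z-adj u c (proj₁ (∧-true Qu)) (proj₂ (∧-true {U u} Qu)))))
          finish : CheapEmb F (U ∖ c) c kf (e′ * ℓ′ ^ L) (∑ (λ u → χ (Q u) * total kf u)) →
                   CheapEmb F (U ∖ c) c kf (cnt U * D) (suc D * (size kf * SF))
          finish (cheap ε le) = cheap ε (block-arithmetic {cst = cost F ε} {e = e} {e′ = e′} {p = ℓ′ ^ L} {N = cnt U} {D = D} {s = size kf} le cheap-c (∑-total kf short) loss powers
                                          (*-mono-≤ e′>0 (m^n>0 ℓ′ {{>-nonZero ℓ′>0}} L)) D≥1)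
            where
            loss : 4 * D * e ≤ K * e′
            loss = +-cancelʳ-≤ (K * M) _ _ (begin
              4 * D * e + K * M      ≤⟨ +-monoʳ-≤ (4 * D * e) KM≤e ⟩
              4 * D * e + e          ≡⟨ +-comm (4 * D * e) e ⟩
              K * e                  ≡⟨ cong (K *_) (m∸n+n≡m (<⇒≤ M<e)) ⟨
              K * (e′ + M)           ≡⟨ *-distribˡ-+ K e′ M ⟩
              K * e′ + K * M         ∎)

    -- The potential that keeps all semidegrees high

    module Potential {I : ℕ} (A : Fin I → Fin n → Bool) (j : ℕ) where

      q : ℕ
      q = 2 + j

      -- This is 2 N - a, with a the number of hits. The extra N keeps b at least N, so that a block
      -- of M vertices changes it by a relative amount of order M/N only, as the second-order bound
      -- requires.
      b : Pool → Fin I → ℕ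
      b U i = cnt U + cnt (λ x → U x ∧ not (A i x))

      Ψ R : Pool → ℕ
      Ψ U = ∑ (λ i → b U i ^ q)
      R U = ∑ (λ i → b U i ^ suc j)

      -- Taking a vertex u lowers every b by 2 and gives back 1 to those tests that contain u. Up to
      -- the factor q, the weight is the first-order effect of what is given back.
      weight : Pool → Fin n → ℕ
      weight U u = ∑ (λ i → b U i ^ suc j * χ (A i u))

      hits : Pool → Fin I → ℕ
      hits U i = cnt (λ x → U x ∧ A i x)

      cost-∑ : ∀ {J} (w : Fin J → ℕ) (g : Fin J → Fin n → ℕ) {U p t U′} (ε : Emb U p t U′) →
               cost (λ u → ∑ (λ i → w i * g i u)) ε ≡ ∑ (λ i → w i * cost (g i) ε)
      cost-∑ w g ∅ = sym (∑-zero λ i → *-zeroʳ (w i))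
      cost-∑ w g (br u _ _ ε δ) = begin
        ∑ (λ i → w i * g i u) + (cost _ ε + cost _ δ)
          ≡⟨ cong (∑ (λ i → w i * g i u) +_) (cong₂ _+_ (cost-∑ w g ε) (cost-∑ w g δ)) ⟩
        ∑ (λ i → w i * g i u) + (∑ (λ i → w i * cost (g i) ε) + ∑ (λ i → w i * cost (g i) δ))
          ≡⟨ cong (∑ (λ i → w i * g i u) +_) (∑-+ _ _) ⟨
        ∑ (λ i → w i * g i u) + ∑ (λ i → w i * cost (g i) ε + w i * cost (g i) δ)
          ≡⟨ ∑-+ _ _ ⟨
        ∑ (λ i → w i * g i u + (w i * cost (g i) ε + w i * cost (g i) δ))
          ≡⟨ ∑-cong (λ i → arith (w i) (g i u) (cost (g i) ε) (cost (g i) δ)) ⟩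
        ∑ (λ i → w i * (g i u + (cost (g i) ε + cost (g i) δ))) ∎
        where
        open ≡-Reasoning
        arith : ∀ w a b c → w * a + (w * b + w * c) ≡ w * (a + (b + c))
        arith = solve-∀

      cost-≤size : ∀ (p : Pool) {U r t U′} (ε : Emb U r t U′) → cost (χ ∘ p) ε ≤ size t
      cost-≤size p ∅ = z≤n
      cost-≤size p (br u _ _ ε δ) = +-mono-≤ (χ≤1 (p u)) (+-mono-≤ (cost-≤size p ε) (cost-≤size p δ))

      ∑-weight : ∀ U → ∑ (λ u → χ (U u) * weight U u) ≡ ∑ (λ i → b U i ^ suc j * hits U i)
      ∑-weight U = begin
        ∑ (λ u → χ (U u) * weight U u)
          ≡⟨ ∑-cong (λ u → sym (∑-*ˡ (χ (U u)) _)) ⟩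
        ∑ (λ u → ∑ (λ i → χ (U u) * (b U i ^ suc j * χ (A i u))))
          ≡⟨ ∑-swap _ ⟩
        ∑ (λ i → ∑ (λ u → χ (U u) * (b U i ^ suc j * χ (A i u))))
          ≡⟨ ∑-cong (λ i → trans (∑-cong λ u → arith (U u) (b U i ^ suc j) (A i u)) (∑-*ˡ (b U i ^ suc j) _)) ⟩
        ∑ (λ i → b U i ^ suc j * hits U i) ∎
        where
        open ≡-Reasoning
        arith : ∀ u w a → χ u * (w * χ a) ≡ w * χ (u ∧ a)
        arith false w a = sym (*-zeroʳ w)
        arith true  w a = +-identityʳ _

      potential-Emb : ∀ {U U′ r t} (ε : Emb U r t U′) D P → 0 < cnt U′ → 0 < D → cnt U′ ≤ P → 3 * P ≤ D * cnt U′ →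
        4 * (q * (size t * D)) ≤ cnt U →
        D * (cnt U * cost (weight U) ε) ≤ (D + 1) * (size t * ∑ (λ u → χ (U u) * weight U u)) →
        Ψ U′ * (cnt U * P) ^ q ≤ Ψ U * (cnt U′ * (P + size t)) ^ q
      potential-Emb {U} {U′} {r} {t} ε D P N′>0 D>0 N′≤P 3P≤ 4qMD≤ cheap≤ =
        potential-step q D N N′ M P (Ψ U) (Ψ U′) (R U) H Sa (trans (cnt-Emb ε) (+-comm M N′)) N′≤P summed
          (subst (λ z → D * (N * z) ≤ (D + 1) * (M * Sa)) (cost-∑ (λ i → b U i ^ suc j) (λ i → χ ∘ A i) ε) cheap≤)
          Sa+Ψ NR≤Ψ 4qMD≤ 3P≤ N′>0 D>0
        where
        N = cnt U
        N′ = cnt U′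
        M = size t
        Sa = ∑ (λ u → χ (U u) * weight U u)
        h : Fin I → ℕ
        h i = cost (χ ∘ A i) ε
        H = ∑ (λ i → b U i ^ suc j * h i)
        N>0 : 0 < N
        N>0 = subst (0 <_) (sym (cnt-Emb ε)) (<-≤-trans N′>0 (m≤n+m N′ M))
        hits-Emb : ∀ i → hits U i ≡ h i + hits U′ i
        hits-Emb i = trans (∑-cong λ x → χ-∧ (U x) (A i x)) (trans (∑-Emb (χ ∘ A i) ε) (cong (h i +_) (∑-cong λ x → sym (χ-∧ (U′ x) (A i x)))))
        balance : ∀ i → b U′ i + 2 * M ≡ b U i + h i
        balance i = +-cancelʳ-≡ (hits U′ i) _ _ (begin
          N′ + c′ + 2 * M + a′        ≡⟨ ar₁ N′ c′ M a′ ⟩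
          M + N′ + M + (a′ + c′)      ≡⟨ cong₂ (λ x y → x + M + y) (cnt-Emb ε) (cnt-split U′ (A i)) ⟨
          N + M + N′                  ≡⟨ +-assoc N M N′ ⟩
          N + (M + N′)                ≡⟨ cong (N +_) (trans (sym (cnt-Emb ε)) (trans (cnt-split U (A i)) (cong (_+ c) (hits-Emb i)))) ⟩
          N + (h i + a′ + c)          ≡⟨ ar₂ N (h i) a′ c ⟩
          N + c + h i + a′            ∎)
          where
          open ≡-Reasoning
          c = cnt (λ x → U x ∧ not (A i x))
          c′ = cnt (λ x → U′ x ∧ not (A i x))
          a′ = hits U′ i
          ar₁ : ∀ N c M a → N + c + 2 * M + a ≡ M + N + M + (a + c)
          ar₁ = solve-∀
          ar₂ : ∀ N h a c → N + (h + a + c) ≡ N + c + h + a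
          ar₂ = solve-∀
        summed : N * Ψ U′ + 2 * q * M * (N * R U) ≤ N * Ψ U + q * (N * H) + 4 * (q * q * (M * M)) * R U
        summed = subst₂ _≤_ lhs rhs (∑-mono λ i → potential-term j (b U i) (b U′ i) (h i) M N (balance i) (cost-≤size (A i) ε) (m≤m+n N _) N>0)
          where
          lhs : ∑ (λ i → N * b U′ i ^ q + 2 * q * M * (N * b U i ^ suc j)) ≡ N * Ψ U′ + 2 * q * M * (N * R U)
          lhs = trans (∑-+ _ _) (cong₂ _+_ (∑-*ˡ N _) (trans (∑-*ˡ (2 * q * M) _) (cong (2 * q * M *_) (∑-*ˡ N _))))
          rhs : ∑ (λ i → N * b U i ^ q + q * (N * (h i * b U i ^ suc j)) + 4 * (q * q * (M * M)) * b U i ^ suc j) ≡ N * Ψ U + q * (N * H) + 4 * (q * q * (M * M)) * R U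
          rhs = trans (∑-+ _ _) (cong₂ _+_ (trans (∑-+ _ _) (cong₂ _+_ (∑-*ˡ N _) (trans (∑-*ˡ q _) (cong (q *_) (trans (∑-*ˡ N _) (cong (N *_) (∑-cong λ i → *-comm (h i) _))))))) (∑-*ˡ (4 * (q * q * (M * M))) _))
        -- Every b is 2 N minus the number of hits, so the weighted total of the hits is determined
        -- by Ψ and R.
        Sa+Ψ : Sa + Ψ U ≡ 2 * (N * R U)
        Sa+Ψ = begin
          Sa + Ψ U
            ≡⟨ cong (_+ Ψ U) (∑-weight U) ⟩
          ∑ (λ i → b U i ^ suc j * hits U i) + Ψ U
            ≡⟨ ∑-+ _ _ ⟨
          ∑ (λ i → b U i ^ suc j * hits U i + b U i ^ q)
            ≡⟨ ∑-cong (λ i → each i) ⟩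
          ∑ (λ i → 2 * N * b U i ^ suc j)
            ≡⟨ trans (∑-*ˡ (2 * N) _) (*-assoc 2 N (R U)) ⟩
          2 * (N * R U) ∎
          where
          open ≡-Reasoning
          each : ∀ i → b U i ^ suc j * hits U i + b U i ^ q ≡ 2 * N * b U i ^ suc j
          each i = trans (ar (b U i ^ suc j) (hits U i) N (cnt (λ x → U x ∧ not (A i x)))) (cong (λ z → (N + z) * b U i ^ suc j) (trans (sym (cnt-split U (A i))) (sym (+-identityʳ N))))
            where
            ar : ∀ p a N c → p * a + (N + c) * p ≡ (N + (a + c)) * p
            ar = solve-∀
        NR≤Ψ : N * R U ≤ Ψ U
        NR≤Ψ = subst (_≤ Ψ U) (∑-*ˡ N _) (∑-mono λ i → *-monoˡ-≤ (b U i ^ suc j) (m≤m+n N _))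

      record Advance (U : Pool) (r : Fin n) (t : Forest n) (P : ℕ) : Set where
        constructor advance
        field
          {U′}  : Pool
          ε     : Emb U r t U′
          decay : Ψ U′ * (cnt U * P) ^ q ≤ Ψ U * (cnt U′ * (P + size t)) ^ q

      -- The weight of the centre is at most R, and N R is at most twice the total weight of U,
      -- because every test contains at least half of U. A block of at least 2 D vertices can absorb
      -- this. Using `cheap-block` with accuracy 2 D leaves the other half of the allowed error 1/D
      -- to the centre.
      advance-block : ∀ {B U} D ℓ z P a r x kf → 1 ≤ B → 1 ≤ D → Dense B U → (∀ i → cnt U ≤ 2 * hits U i) → Short (2 * D) kf → 2 * D ≤ suc (size kf) →
        B * ℓ ≤ cnt U → B * (B * z) ≤ 2 * cnt U →
        suc (4 * (2 * D)) * (2 * D * suc (size kf)) ≤ ℓ → suc (4 * (2 * D)) * (suc (4 * (2 * D)) * suc (size kf)) ≤ z →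
        4 * (q * (suc (size kf) * D)) ≤ cnt U → cnt U ≤ P → suc (size kf) + 3 * P ≤ D * (cnt U ∸ suc (size kf)) →
        Advance U r (br a x kf ∅) P
      advance-block {B} {U} D@(suc d) ℓ z P a r x kf B≥1 D≥1 dense half short big Bℓ Bz ℓbig zbig qbig N≤P 3P =
        finish (cheap-block {B} {U} (2 * D) (2 * D) ℓ z (weight U) a r kf B≥1 (s≤s z≤n) (s≤s z≤n) dense short Bℓ Bz ℓbig zbig)
        where
        open ≤-Reasoning
        N = cnt U
        M = suc (size kf)
        S = ∑ (λ u → χ (U u) * weight U u)
        finish : CheapBlock (weight U) U a r kf (N * (2 * D)) (suc (2 * D) * (size kf * S)) → Advance U r (br a x kf ∅) P
        finish (block c Uc Ec (cheap {U′} ε le)) = advance δ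
            (potential-Emb δ D P N′>0 (s≤s z≤n) (≤-trans N′≤N N≤P) (≤-trans (m≤n+m (3 * P) M) (subst (λ m → M + 3 * P ≤ D * m) (sym N′≡) 3P))
              (subst (λ m → 4 * (q * (m * D)) ≤ N) (sym sizeM) qbig) (subst (λ m → D * (N * cost (weight U) δ) ≤ (D + 1) * (m * S)) (sym sizeM) cheap≤))
          where
          δ : Emb U r (br a x kf ∅) U′
          δ = br c Uc Ec ε ∅
          sizeM : size (br a x kf ∅) ≡ M
          sizeM = cong suc (+-identityʳ (size kf))
          N≡ : N ≡ M + cnt U′
          N≡ = trans (cnt-Emb δ) (cong (_+ cnt U′) sizeM)
          N′≡ : cnt U′ ≡ N ∸ M
          N′≡ = trans (sym (m+n∸m≡n M (cnt U′))) (cong (_∸ M) (sym N≡))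
          N′≤N : cnt U′ ≤ N
          N′≤N = ≤-trans (m≤n+m (cnt U′) M) (≤-reflexive (sym N≡))
          N′>0 : 0 < cnt U′
          N′>0 = n≢0⇒n>0 λ z → contradiction (≤-trans (m+n≤o⇒m≤o M 3P) (≤-reflexive (trans (cong (D *_) (trans (sym N′≡) z)) (*-zeroʳ D)))) λ ()
          Fc : weight U c ≤ R U
          Fc = ∑-mono λ i → ≤-trans (*-monoʳ-≤ (b U i ^ suc j) (χ≤1 (A i c))) (≤-reflexive (*-identityʳ _))
          NR : N * R U ≤ 2 * S
          NR = begin
            N * R U                                          ≡⟨ ∑-*ˡ N _ ⟨
            ∑ (λ i → N * b U i ^ suc j)                      ≤⟨ ∑-mono (λ i → ≤-trans (*-monoˡ-≤ (b U i ^ suc j) (half i)) (≤-reflexive (ar (b U i ^ suc j) (hits U i)))) ⟩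
            ∑ (λ i → 2 * (b U i ^ suc j * hits U i))         ≡⟨ ∑-*ˡ 2 _ ⟩
            2 * ∑ (λ i → b U i ^ suc j * hits U i)           ≡⟨ cong (2 *_) (∑-weight U) ⟨
            2 * S                                            ∎
            where
            ar : ∀ p a → 2 * a * p ≡ 2 * (p * a)
            ar = solve-∀
          cheap≤ : D * (N * (weight U c + (cost (weight U) ε + 0))) ≤ (D + 1) * (M * S)
          cheap≤ = *-cancelˡ-≤ 2 (lin S (+-mono-≤ (+-mono-≤ (*-monoʳ-≤ (2 * D) (≤-trans (*-monoʳ-≤ N Fc) NR)) le) (*-monoˡ-≤ S big))
                     (ar D N (weight U c) (cost (weight U) ε) (size kf) S))
            where
            ar : ∀ D N w k m S → 2 * (D * (N * (w + (k + 0)))) + (2 * D * (2 * S) + (1 + 2 * D) * (m * S) + (1 + m) * S) + S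
                               ≡ 2 * ((D + 1) * ((1 + m) * S)) + (2 * D * (N * w) + k * (N * (2 * D)) + 2 * D * S)
            ar = solve-∀

    -- Partial embeddings and their invariant

    Map : Set
    Map = Fin n → Fin n

    put : Map → ∀ {U p t U′} → Emb U p t U′ → Map
    put f ∅ = f
    put f (br {x = x} u _ _ ε δ) = put (put (f [ x ↦ u ]) ε) δ

    Simple : Forest n → Set
    Simple t = ∀ y → occ t y ≤ 1

    occ-zero : ∀ {x y : Fin n} {a b} → χ (x == y) + (a + b) ≡ 0 → y ≢ x × a ≡ 0 × b ≡ 0
    occ-zero {x} {y} {a} {b} h = ne , m+n≡0⇒m≡0 a h′ , m+n≡0⇒n≡0 a h′
      where
      h′ : a + b ≡ 0
      h′ = m+n≡0⇒n≡0 (χ (x == y)) h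
      ne : y ≢ x
      ne refl = 1+n≢0 (trans (cong (_+ (a + b)) (sym (cong χ (==-refl y)))) h)

    occ-cases : ∀ {x y : Fin n} {a b} → 1 ≤ χ (x == y) + (a + b) → y ≡ x ⊎ (1 ≤ a ⊎ 1 ≤ b)
    occ-cases {x} {y} {a} {b} h with x ≟ y
    ... | yes eq = inj₁ (sym eq)
    occ-cases {a = zero} h | no _ = inj₂ (inj₂ h)
    occ-cases {a = suc a} h | no _ = inj₂ (inj₁ (s≤s z≤n))

    simple-kid : ∀ {s x k r} → Simple (br s x k r) → Simple k
    simple-kid {s} {x} {k} {r} h y = ≤-trans (occ-kid s x k r y) (h y)

    simple-sib : ∀ {s x k r} → Simple (br s x k r) → Simple r
    simple-sib {s} {x} {k} {r} h y = ≤-trans (occ-sib s x k r y) (h y)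

    simple-top : ∀ {s x k r} → Simple (br s x k r) → occ k x ≡ 0 × occ r x ≡ 0
    simple-top {s} {x} {k} {r} h = m+n≡0⇒m≡0 (occ k x) z , m+n≡0⇒n≡0 (occ k x) z
      where
      z : occ k x + occ r x ≡ 0
      z = n≤0⇒n≡0 (≤-pred (subst (λ b → χ b + (occ k x + occ r x) ≤ 1) (==-refl x) (h x)))

    simple-apart : ∀ {s x k r} → Simple (br s x k r) → ∀ y → 1 ≤ occ k y → occ r y ≡ 0
    simple-apart {s} {x} {k} {r} h y y∈k = n≤0⇒n≡0 (+-cancelˡ-≤ 1 _ _ (≤-trans (+-monoˡ-≤ (occ r y) y∈k) (≤-trans (m≤n+m _ (χ (x == y))) (h y))))

    put-off : ∀ f {U p t U′} (ε : Emb U p t U′) y → occ t y ≡ 0 → put f ε y ≡ f y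
    put-off f ∅ y h = refl
    put-off f (br {x = x} {k = k} {r} u _ _ ε δ) y h with occ-zero {x} {y} {occ k y} {occ r y} h
    ... | ne , hk , hr = trans (put-off (put (f [ x ↦ u ]) ε) δ y hr) (trans (put-off (f [ x ↦ u ]) ε y hk) (↦-off f u ne))

    module _ (f : Map) {U U₁ U₂ : Pool} {p x : Fin n} {s : Bool} {k r : Forest n} (u : Fin n) (ε : Emb (U ∖ u) u k U₁) (δ : Emb U₁ p r U₂)
             (simple : Simple (br s x k r)) where

      put-top : put (put (f [ x ↦ u ]) ε) δ x ≡ u
      put-top = trans (put-off (put (f [ x ↦ u ]) ε) δ x (proj₂ (simple-top {s} {x} {k} {r} simple)))
                  (trans (put-off (f [ x ↦ u ]) ε x (proj₁ (simple-top {s} {x} {k} {r} simple))) (↦-at f x u))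

      put-kid : ∀ y → 1 ≤ occ k y → put (put (f [ x ↦ u ]) ε) δ y ≡ put (f [ x ↦ u ]) ε y
      put-kid y y∈k = put-off (put (f [ x ↦ u ]) ε) δ y (simple-apart {s} {x} {k} {r} simple y y∈k)

    Emb-mono-false : ∀ {U p t U′} → Emb U p t U′ → ∀ x → U x ≡ false → U′ x ≡ false
    Emb-mono-false {U′ = U′} ε x h with U′ x in eq
    ... | false = refl
    ... | true = true≢false (Emb-⊆ ε x eq) h

    put-in : ∀ f {U p t U′} (ε : Emb U p t U′) → Simple t → ∀ y → 1 ≤ occ t y → U (put f ε y) ≡ true × U′ (put f ε y) ≡ false
    put-in f ∅ simple y ()
    put-in f {U} {U′ = U′} (br {U₁ = U₁} {p = p} {s} {x} {k} {r} u Uu _ ε δ) simple y y∈ with occ-cases {x} {y} {occ k y} {occ r y} y∈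
    ... | inj₁ refl = subst (λ z → U z ≡ true × U′ z ≡ false) (sym (put-top f {s = s} u ε δ simple))
                        (Uu , Emb-mono-false δ u (Emb-mono-false ε u (∖-self U u)))
    ... | inj₂ (inj₁ y∈k) with put-in (f [ x ↦ u ]) ε (simple-kid {s} {x} {k} {r} simple) y y∈k
    ...   | a , b = subst (λ z → U z ≡ true × U′ z ≡ false) (sym (put-kid f {s = s} u ε δ simple y y∈k)) (∖-⊆ U u _ a , Emb-mono-false δ _ b)
    put-in f {U} (br {s = s} {x} {k} {r} u Uu _ ε δ) simple y y∈ | inj₂ (inj₂ y∈r) with put-in (put (f [ x ↦ u ]) ε) δ (simple-sib {s} {x} {k} {r} simple) y y∈r
    ...   | a , b = ∖-⊆ U u _ (Emb-⊆ ε _ a) , b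

    private
      sides : ∀ {a b : Fin n} {V : Pool} → V a ≡ true → V b ≡ false → a ≡ b → ⊥
      sides h h′ refl = true≢false h h′

    put-inj : ∀ f {U p t U′} (ε : Emb U p t U′) → Simple t → ∀ y z → 1 ≤ occ t y → 1 ≤ occ t z → put f ε y ≡ put f ε z → y ≡ z
    put-inj f ∅ simple y z () _ _
    put-inj f {U} (br {U₁ = U₁} {s = s} {x} {k} {r} u Uu _ ε δ) simple y z y∈ z∈ eq
      with occ-cases {x} {y} {occ k y} {occ r y} y∈ | occ-cases {x} {z} {occ k z} {occ r z} z∈
    ... | inj₁ refl | inj₁ refl = refl
    ... | inj₁ refl | inj₂ (inj₁ z∈k) = ⊥-elim (sides {V = U ∖ u} (proj₁ (put-in (f [ x ↦ u ]) ε (simple-kid {s} {x} {k} {r} simple) z z∈k))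
            (∖-self U u) (trans (sym (put-kid f {s = s} u ε δ simple z z∈k)) (trans (sym eq) (put-top f {s = s} u ε δ simple))))
    ... | inj₁ refl | inj₂ (inj₂ z∈r) = ⊥-elim (sides {V = U₁} (proj₁ (put-in (put (f [ x ↦ u ]) ε) δ (simple-sib {s} {x} {k} {r} simple) z z∈r))
            (Emb-mono-false ε u (∖-self U u)) (trans (sym eq) (put-top f {s = s} u ε δ simple)))
    ... | inj₂ (inj₁ y∈k) | inj₁ refl = ⊥-elim (sides {V = U ∖ u} (proj₁ (put-in (f [ x ↦ u ]) ε (simple-kid {s} {x} {k} {r} simple) y y∈k))
            (∖-self U u) (trans (sym (put-kid f {s = s} u ε δ simple y y∈k)) (trans eq (put-top f {s = s} u ε δ simple))))
    ... | inj₂ (inj₂ y∈r) | inj₁ refl = ⊥-elim (sides {V = U₁} (proj₁ (put-in (put (f [ x ↦ u ]) ε) δ (simple-sib {s} {x} {k} {r} simple) y y∈r))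
            (Emb-mono-false ε u (∖-self U u)) (trans eq (put-top f {s = s} u ε δ simple)))
    ... | inj₂ (inj₁ y∈k) | inj₂ (inj₁ z∈k) = put-inj (f [ x ↦ u ]) ε (simple-kid {s} {x} {k} {r} simple) y z y∈k z∈k
            (trans (sym (put-kid f {s = s} u ε δ simple y y∈k)) (trans eq (put-kid f {s = s} u ε δ simple z z∈k)))
    ... | inj₂ (inj₂ y∈r) | inj₂ (inj₂ z∈r) = put-inj (put (f [ x ↦ u ]) ε) δ (simple-sib {s} {x} {k} {r} simple) y z y∈r z∈r eq
    ... | inj₂ (inj₁ y∈k) | inj₂ (inj₂ z∈r) = ⊥-elim (sides {V = U₁} (proj₁ (put-in (put (f [ x ↦ u ]) ε) δ (simple-sib {s} {x} {k} {r} simple) z z∈r))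
            (proj₂ (put-in (f [ x ↦ u ]) ε (simple-kid {s} {x} {k} {r} simple) y y∈k)) (trans (sym eq) (put-kid f {s = s} u ε δ simple y y∈k)))
    ... | inj₂ (inj₂ y∈r) | inj₂ (inj₁ z∈k) = ⊥-elim (sides {V = U₁} (proj₁ (put-in (put (f [ x ↦ u ]) ε) δ (simple-sib {s} {x} {k} {r} simple) y y∈r))
            (proj₂ (put-in (f [ x ↦ u ]) ε (simple-kid {s} {x} {k} {r} simple) z z∈k)) (trans eq (put-kid f {s = s} u ε δ simple z z∈k)))

    put-edge : ∀ f {U p t U′} (ε : Emb U p t U′) → Simple t → ∀ q → f q ≡ p → occ t q ≡ 0 →
               ∀ s a y → EdgeOf s a y q t → E s (put f ε a) (put f ε y) ≡ true
    put-edge f (br {p = p} {s} {x} {k} {r} u Uu Epu ε δ) simple q fq q∉ .s .q .x top =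
      subst₂ (λ a b → E s a b ≡ true) (sym (trans (put-off f (br {s = s} {x = x} u Uu Epu ε δ) q q∉) fq)) (sym (put-top f {s = s} u ε δ simple)) Epu
    put-edge f (br {p = p} {s} {x} {k} {r} u Uu Epu ε δ) simple q fq q∉ s′ a y (kid e) =
      subst₂ (λ a b → E s′ a b ≡ true) (sym (at-a (proj₂ (EdgeOf-occ e)))) (sym (put-kid f {s = s} u ε δ simple y (proj₁ (EdgeOf-occ e))))
        (put-edge (f [ x ↦ u ]) ε (simple-kid {s} {x} {k} {r} simple) x (↦-at f x u) (proj₁ (simple-top {s} {x} {k} {r} simple)) s′ a y e)
      where
      at-a : a ≡ x ⊎ 1 ≤ occ k a → put (put (f [ x ↦ u ]) ε) δ a ≡ put (f [ x ↦ u ]) ε a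
      at-a (inj₁ refl) = put-off (put (f [ x ↦ u ]) ε) δ x (proj₂ (simple-top {s} {x} {k} {r} simple))
      at-a (inj₂ a∈k) = put-kid f {s = s} u ε δ simple a a∈k
    put-edge f (br {p = p} {s} {x} {k} {r} u Uu Epu ε δ) simple q fq q∉ s′ a y (sib e) with occ-zero {x} {q} {occ k q} {occ r q} q∉
    ... | ne , hk , hr = put-edge (put (f [ x ↦ u ]) ε) δ (simple-sib {s} {x} {k} {r} simple) q
            (trans (put-off (f [ x ↦ u ]) ε q hk) (trans (↦-off f u ne) fq)) hr s′ a y e

    Good : Map → Pool → Fin n → Fin n → Set
    Good f done x y = done x ≡ true × done y ≡ true × E true (f x) (f y) ≡ true

    Pending : List (Item n) → Fin n → Fin n → Set
    Pending work x y = EdgeIn true x y work ⊎ EdgeIn false y x work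

    -- `f` is total but meaningful only on `done`. Every vertex is either done or in exactly one
    -- pending item, and every edge of the tree is either realised or pending. A pending item hangs
    -- below a vertex whose image is fixed, and U has exactly as many vertices as are still to be
    -- embedded.
    record Inv (f : Map) (done U : Pool) (work : List (Item n)) : Set where
      field
        cover : ∀ y → χ (done y) + occW work y ≡ 1
        edges : ∀ x y → eT x y ≡ true → Good f done x y ⊎ Pending work x y
        par   : All (λ it → done (proj₁ it) ≡ true) work
        inj   : ∀ x y → done x ≡ true → done y ≡ true → f x ≡ f y → x ≡ y
        fresh : ∀ x → done x ≡ true → U (f x) ≡ false
        count : cnt U ≡ sizeW work

    module Extend {f done U work} {q : Fin n} {t : Forest n} (inv : Inv f done U ((q , t) ∷ work)) {t′ R} (split : Split q t t′ R)
                  {U′} (ε : Emb U (f q) t′ U′) where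

      open Inv inv
      module S = Split split

      f⁺ : Map
      f⁺ = put f ε

      done⁺ : Pool
      done⁺ y = done y ∨ (1 ≤ᵇ occ t′ y)

      total : ∀ y → χ (done y) + (occ t′ y + (occW R y + occW work y)) ≡ 1
      total y = trans (cong (χ (done y) +_) (trans (sym (+-assoc (occ t′ y) _ _)) (cong (_+ occW work y) (sym (S.occ≡ y))))) (cover y)

      simple : Simple t′
      simple y = ≤-trans (m≤m+n (occ t′ y) (occW R y + occW work y)) (≤-trans (m≤n+m _ (χ (done y))) (≤-reflexive (total y)))

      old : ∀ y → done y ≡ true → occ t′ y ≡ 0
      old y d = m+n≡0⇒m≡0 (occ t′ y) (Data.Nat.Properties.suc-injective (trans (cong (λ b → χ b + (occ t′ y + (occW R y + occW work y))) (sym d)) (total y)))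

      new : ∀ y → 1 ≤ occ t′ y → done y ≡ false
      new y h with done y in d
      ... | false = refl
      ... | true = contradiction (subst (1 ≤_) (old y d) h) λ ()

      f⁺-old : ∀ y → done y ≡ true → f⁺ y ≡ f y
      f⁺-old y d = put-off f ε y (old y d)

      done⁺-old : ∀ y → done y ≡ true → done⁺ y ≡ true
      done⁺-old y d rewrite d = refl

      done⁺-new : ∀ y → 1 ≤ occ t′ y → done⁺ y ≡ true
      done⁺-new y h with done y
      ... | true = refl
      ... | false = go h
        where
        go : ∀ {m} → 1 ≤ m → (1 ≤ᵇ m) ≡ true
        go (s≤s z≤n) = refl

      done⁺-cases : ∀ y → done⁺ y ≡ true → done y ≡ true ⊎ 1 ≤ occ t′ y
      done⁺-cases y h with done y
      ... | true = inj₁ refl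
      ... | false = inj₂ (≤ᵇ⇒≤ 1 _ (subst Data.Bool.T (sym h) tt))

      q-done : done q ≡ true
      q-done with par
      ... | d ∷ _ = d

      extend : Inv f⁺ done⁺ U′ (R ++ work)
      extend = record
        { cover = λ y → trans (cong (χ (done⁺ y) +_) (occW-++ R work y)) (cover⁺ y)
        ; edges = edges⁺
        ; par = All.++⁺ (All.map (λ {it} → parR {it}) S.parents) (parW par)
        ; inj = inj⁺
        ; fresh = fresh⁺
        ; count = +-cancelˡ-≡ (size t′) _ _ (trans (sym (cnt-Emb ε)) (trans count (trans (cong (_+ sizeW work) S.size≡)
                    (trans (+-assoc (size t′) _ _) (cong (size t′ +_) (sym (sizeW-++ R work)))))))
        }
        where
        cover⁺ : ∀ y → χ (done⁺ y) + (occW R y + occW work y) ≡ 1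
        cover⁺ y with done y | occ t′ y | total y
        ... | true  | zero  | h = h
        ... | true  | suc m | ()
        ... | false | zero  | h = h
        ... | false | suc zero | h = h
        ... | false | suc (suc m) | ()
        parR : ∀ {it : Item n} → proj₁ it ≡ q ⊎ 1 ≤ occ t′ (proj₁ it) → done⁺ (proj₁ it) ≡ true
        parR (inj₁ refl) = done⁺-old q q-done
        parR {it} (inj₂ h) = done⁺-new (proj₁ it) h
        parW : All (λ it → done (proj₁ it) ≡ true) ((q , t) ∷ work) → All (λ it → done⁺ (proj₁ it) ≡ true) work
        parW (_ ∷ ps) = All.map (λ {it} → done⁺-old (proj₁ it)) ps
        good⁺ : ∀ s a y → EdgeOf s a y q t′ → done⁺ a ≡ true × done⁺ y ≡ true × E s (f⁺ a) (f⁺ y) ≡ true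
        good⁺ s a y e with EdgeOf-occ e
        ... | y∈ , a∈ = a-done a∈ , done⁺-new y y∈ , put-edge f ε simple q refl (old q q-done) s a y e
          where
          a-done : a ≡ q ⊎ 1 ≤ occ t′ a → done⁺ a ≡ true
          a-done (inj₁ refl) = done⁺-old q q-done
          a-done (inj₂ h) = done⁺-new a h
        edges⁺ : ∀ x y → eT x y ≡ true → Good f⁺ done⁺ x y ⊎ Pending (R ++ work) x y
        edges⁺ x y xy with edges x y xy
        ... | inj₁ (dx , dy , e) = inj₁ (done⁺-old x dx , done⁺-old y dy , subst₂ (λ a b → E true a b ≡ true) (sym (f⁺-old x dx)) (sym (f⁺-old y dy)) e)
        ... | inj₂ (inj₁ (there w)) = inj₂ (inj₁ (Any.++⁺ʳ R w))
        ... | inj₂ (inj₂ (there w)) = inj₂ (inj₂ (Any.++⁺ʳ R w))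
        ... | inj₂ (inj₁ (here w)) with S.edge true x y w
        ...   | inj₁ e = inj₁ (good⁺ true x y e)
        ...   | inj₂ r = inj₂ (inj₁ (Any.++⁺ˡ r))
        edges⁺ x y xy | inj₂ (inj₂ (here w)) with S.edge false y x w
        ...   | inj₂ r = inj₂ (inj₂ (Any.++⁺ˡ r))
        ...   | inj₁ e with good⁺ false y x e
        ...     | dy , dx , e′ = inj₁ (dx , dy , trans (sym (E-flip true (f⁺ y) (f⁺ x))) e′)
        inj⁺ : ∀ x y → done⁺ x ≡ true → done⁺ y ≡ true → f⁺ x ≡ f⁺ y → x ≡ y
        inj⁺ x y dx dy eq with done⁺-cases x dx | done⁺-cases y dy
        ... | inj₁ a | inj₁ b = inj x y a b (trans (sym (f⁺-old x a)) (trans eq (f⁺-old y b)))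
        ... | inj₁ a | inj₂ b = true≢false (proj₁ (put-in f ε simple y b)) (subst (λ z → U z ≡ false) (trans (sym (f⁺-old x a)) eq) (fresh x a))
        ... | inj₂ a | inj₁ b = true≢false (proj₁ (put-in f ε simple x a)) (subst (λ z → U z ≡ false) (trans (sym (f⁺-old y b)) (sym eq)) (fresh y b))
        ... | inj₂ a | inj₂ b = put-inj f ε simple x y a b eq
        fresh⁺ : ∀ x → done⁺ x ≡ true → U′ (f⁺ x) ≡ false
        fresh⁺ x d with done⁺-cases x d
        ... | inj₁ a = subst (λ z → U′ z ≡ false) (sym (f⁺-old x a)) (Emb-mono-false ε (f x) (fresh x a))
        ... | inj₂ a = proj₂ (put-in f ε simple x a)

    -- The almost-spanning phase

    test : Fin (n + n) → Pool
    test i = [ E true , E false ]′ (splitAt n i)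

    test-at : ∀ s v → ∃ λ i → test i ≡ E s v
    test-at true  v = v ↑ˡ n , cong [ E true , E false ]′ (splitAt-↑ˡ n v n)
    test-at false v = n ↑ʳ v , cong [ E true , E false ]′ (splitAt-↑ʳ n n v)

    -- `reserved` holds the vertices that the final phase may move. No pending item hangs below one
    -- of them, so a move never changes the image of a vertex whose children are still to come.
    record Later (reserved : Pool) (f : Map) (done : Pool) (halt : ℕ) : Set where
      field
        {f⁺}    : Map
        {done⁺} : Pool
        {U⁺}    : Pool
        {work⁺} : List (Item n)
        inv     : Inv f⁺ done⁺ U⁺ work⁺
        agree   : ∀ y → done y ≡ true → f⁺ y ≡ f y
        grow    : ∀ y → done y ≡ true → done⁺ y ≡ true
        few     : cnt U⁺ ≤ halt
        aside   : All (λ it → reserved (proj₁ it) ≡ false) work⁺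

    -- k = 18 A and Pmax = (k + 1) n; N₀ vertices are unused initially, and b₀ bounds their non-neighbour counts (shifted by N₀).
    module Run (A l j N₀ b₀ : ℕ) (A>0 : 0 < A) (q≡ : 2 + j ≡ 18 * A * l) (N₀>0 : 0 < N₀) (N₀≤n : N₀ ≤ n) (b₀-small : 4 * A * b₀ + 3 * N₀ ≤ 6 * A * N₀) where

      open Potential test j

      k Pmax Θ₀ : ℕ
      k = 18 * A
      Pmax = suc k * n
      Θ₀ = N₀ * (Pmax ∸ N₀)

      k>0 : 0 < k
      k>0 = *-mono-≤ (s≤s (z≤n {17})) A>0

      n>0 : 0 < n
      n>0 = <-≤-trans N₀>0 N₀≤n

      n+n≤Pmax : n + n ≤ Pmax
      n+n≤Pmax = +-monoʳ-≤ n (≤-trans (≤-reflexive (sym (*-identityˡ n))) (*-monoˡ-≤ n k>0))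

      -- Relative to the ideal size N (Pmax - N), the potential has not grown beyond its initial
      -- bound of 2^l terms b₀ ^ q. The factor Pmax - N grows slowly as N falls and provides for the
      -- accumulated errors.
      Tame : Pool → Set
      Tame U = Ψ U * Θ₀ ^ q ≤ 2 ^ l * b₀ ^ q * (cnt U * (Pmax ∸ cnt U)) ^ q

      tame₀ : ∀ U → cnt U ≡ N₀ → n + n ≤ 2 ^ l → (∀ i → b U i ≤ b₀) → Tame U
      tame₀ U refl log≤ b≤ = *-monoˡ-≤ (Θ₀ ^ q) (≤-trans (∑-mono λ i → ^-monoˡ-≤ q (b≤ i)) (≤-trans (≤-reflexive (∑-const (n + n) _)) (*-monoˡ-≤ (b₀ ^ q) log≤)))

      -- A single term of Ψ is bounded by the whole, and the q-th root is taken. The factor 2^l and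
      -- the growth of Pmax - N each cost at most (k + 1)/k, the two losses that
      -- `density-arithmetic` allows.
      tame-dense : ∀ U → cnt U ≤ n → Tame U → Dense (2 * A) U
      tame-dense U N≤n tame s v with test-at s v
      ... | i , eq = subst (λ p → (2 * A + 2) * N ≤ 2 * (2 * A * cnt (λ x → U x ∧ p x))) eq
                       (lin 0 (+-mono-≤ dense-b (≤-reflexive (cong (4 * A *_) (cnt-split U (test i))))) (ar A N (hits U i) (cnt (λ x → U x ∧ not (test i x)))))
        where
        open ≤-Reasoning
        N = cnt U
        P = Pmax ∸ N
        ar : ∀ A N a c → (2 * A + 2) * N + (6 * A * N + 4 * A * (a + c)) + 0 ≡ 2 * (2 * A * a) + (4 * A * (N + c) + 2 * N + 4 * A * N)
        ar = solve-∀
        root : b U i * Θ₀ * k ≤ suc k * b₀ * (N * P)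
        root = ^-cancelˡ-≤ (suc j) (begin
          (b U i * Θ₀ * k) ^ q                          ≡⟨ trans (^-distrib-* (b U i * Θ₀) k q) (cong (_* k ^ q) (^-distrib-* (b U i) Θ₀ q)) ⟩
          b U i ^ q * Θ₀ ^ q * k ^ q                    ≤⟨ *-monoˡ-≤ (k ^ q) (≤-trans (*-monoˡ-≤ (Θ₀ ^ q) (∑-≥ (λ i → b U i ^ q) i)) tame) ⟩
          2 ^ l * b₀ ^ q * (N * P) ^ q * k ^ q          ≡⟨ ar₁ (2 ^ l) (b₀ ^ q) ((N * P) ^ q) (k ^ q) ⟩
          2 ^ l * k ^ q * (b₀ ^ q * (N * P) ^ q)        ≤⟨ *-monoˡ-≤ (b₀ ^ q * (N * P) ^ q) (subst (λ m → 2 ^ l * k ^ m ≤ suc k ^ m) (sym q≡) (log-growth k l k>0)) ⟩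
          suc k ^ q * (b₀ ^ q * (N * P) ^ q)            ≡⟨ *-assoc (suc k ^ q) (b₀ ^ q) ((N * P) ^ q) ⟨
          suc k ^ q * b₀ ^ q * (N * P) ^ q              ≡⟨ trans (^-distrib-* (suc k * b₀) (N * P) q) (cong (_* (N * P) ^ q) (^-distrib-* (suc k) b₀ q)) ⟨
          (suc k * b₀ * (N * P)) ^ q                    ∎)
          where
          ar₁ : ∀ a b c d → a * b * c * d ≡ a * d * (b * c)
          ar₁ = solve-∀
        dense-b : 4 * A * b U i + 2 * N ≤ 6 * A * N
        dense-b = density-arithmetic A (b U i) b₀ N N₀ A>0 N₀>0 (*-cancelʳ-≤ _ _ n {{>-nonZero n>0}} (begin
          b U i * N₀ * (k * k) * n                 ≡⟨ ar₂ (b U i) N₀ k n ⟩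
          b U i * (N₀ * (k * n)) * k               ≤⟨ *-monoˡ-≤ k (*-monoʳ-≤ (b U i) (*-monoʳ-≤ N₀ kn≤)) ⟩
          b U i * Θ₀ * k                           ≤⟨ root ⟩
          suc k * b₀ * (N * P)                     ≤⟨ *-monoʳ-≤ (suc k * b₀) (*-monoʳ-≤ N (m∸n≤m Pmax N)) ⟩
          suc k * b₀ * (N * (suc k * n))           ≡⟨ ar₃ (suc k) b₀ N n ⟩
          suc k * suc k * b₀ * N * n               ∎)) b₀-small
          where
          ar₂ : ∀ b N k n → b * N * (k * k) * n ≡ b * (N * (k * n)) * k
          ar₂ = solve-∀
          ar₃ : ∀ k b N n → k * b * (N * (k * n)) ≡ k * k * b * N * n
          ar₃ = solve-∀
          kn≤ : k * n ≤ Pmax ∸ N₀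
          kn≤ = subst (_≤ Pmax ∸ N₀) (m+n∸m≡n n (k * n)) (∸-monoʳ-≤ Pmax N₀≤n)

      module Loop (reserved : Pool) (D Δ ℓ z halt : ℕ) (D>0 : 1 ≤ D) where

        L Mmax : ℕ
        L = 2 * D
        Mmax = suc (Δ * L)

        open Cut {n} L

        module _ (ℓ≤ : 2 * A * ℓ ≤ halt) (z≤ : 2 * A * (2 * A * z) ≤ 2 * halt) (ℓ≥ : suc (4 * L) * (L * Mmax) ≤ ℓ) (z≥ : suc (4 * L) * (suc (4 * L) * Mmax) ≤ z)
                 (q≤ : 4 * (q * (Mmax * D)) ≤ halt) (P≤ : Mmax + 3 * Pmax ≤ D * (halt ∸ Mmax)) where

          loop : ∀ fuel {f done U work} → sizeW work < fuel → Inv f done U work → All Heavy work → All (Bounded Δ ∘ proj₂) work → Tame U → cnt U ≤ n →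
                 (∀ y → reserved y ≡ true → done y ≡ true) → All (λ it → reserved (proj₁ it) ≡ false) work → Later reserved f done halt
          loop (suc fuel) {f} {done} {U} {work} lt inv hv bd tame N≤n res par′ with cnt U ≤? halt
          ... | yes small = record { inv = inv ; agree = λ _ _ → refl ; grow = λ _ d → d ; few = small ; aside = par′ }
          loop (suc fuel) {work = []} lt inv hv bd tame N≤n res par′ | no big = contradiction (≤-trans (≤-reflexive (Inv.count inv)) z≤n) big
          loop (suc fuel) {f} {done} {U} {(p , br s x kf ∅) ∷ work} lt inv (heavy L≤ ∷ hv) ((roots≤ , bk , _) ∷ bd) tame N≤n res (p-free ∷ par′) | no big =
            continue (advance-block {2 * A} {U} D ℓ z P s (f p) x (prune kf) (*-mono-≤ (s≤s (z≤n {1})) A>0) D>0 (tame-dense U N≤n tame) half (Short-prune kf)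
                       (subst (λ m → L ≤ suc m) (sym (size-prune kf)) L≤) (≤-trans ℓ≤ halt≤) (≤-trans z≤ (*-monoʳ-≤ 2 halt≤))
                       (≤-trans (*-monoʳ-≤ (suc (4 * L)) (*-monoʳ-≤ L M≤)) ℓ≥) (≤-trans (*-monoʳ-≤ (suc (4 * L)) (*-monoʳ-≤ (suc (4 * L)) M≤)) z≥)
                       (≤-trans (*-monoʳ-≤ 4 (*-monoʳ-≤ q (*-monoˡ-≤ D M≤))) (≤-trans q≤ halt≤)) N≤P
                       (≤-trans (+-mono-≤ M≤ (*-monoʳ-≤ 3 (m∸n≤m Pmax N))) (≤-trans P≤ (*-monoʳ-≤ D (∸-mono halt≤ M≤)))))
            where
            open ≤-Reasoning
            N = cnt U
            P = Pmax ∸ N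
            halt≤ : halt ≤ N
            halt≤ = <⇒≤ (≰⇒> big)
            M≤ : suc (size (prune kf)) ≤ Mmax
            M≤ = s≤s (subst (_≤ Δ * L) (sym (size-prune kf)) (≤-trans (load≤ kf) (*-monoˡ-≤ L roots≤)))
            N≤P : N ≤ P
            N≤P = subst (_≤ P) (m+n∸n≡m N N) (∸-monoˡ-≤ N (≤-trans (+-mono-≤ N≤n N≤n) n+n≤Pmax))
            half : ∀ i → N ≤ 2 * hits U i
            half i = go (splitAt n i) refl
              where
              from : ∀ s v → N ≤ 2 * cnt (λ x → U x ∧ E s v x)
              from s v = *-cancelˡ-≤ (2 * A) {{>-nonZero (*-mono-≤ (s≤s (z≤n {1})) A>0)}} (≤-trans (*-monoˡ-≤ N (m≤m+n (2 * A) 2)) (≤-trans (tame-dense U N≤n tame s v) (≤-reflexive (ar A (cnt (λ x → U x ∧ E s v x))))))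
                where
                ar : ∀ A c → 2 * (2 * A * c) ≡ 2 * A * (2 * c)
                ar = solve-∀
              go : ∀ w → splitAt n i ≡ w → N ≤ 2 * hits U i
              go (inj₁ v) eq rewrite eq = from true v
              go (inj₂ v) eq rewrite eq = from false v
            continue : Advance U (f p) (br s x (prune kf) ∅) P → Later reserved f done halt
            continue (advance {U′} ε decay) = record
              { inv = L₁.inv ; agree = λ y d → trans (L₁.agree y (X.done⁺-old y d)) (X.f⁺-old y d) ; grow = λ y d → L₁.grow y (X.done⁺-old y d) ; few = L₁.few ; aside = L₁.aside }
              where
              module X = Extend inv (cut-item p s x kf) ε
              M = size (br s x (prune kf) ∅)
              N′ = cnt U′
              N≡ : N ≡ M + N′
              N≡ = cnt-Emb ε
              N′≤N : N′ ≤ N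
              N′≤N = ≤-trans (m≤n+m N′ M) (≤-reflexive (sym N≡))
              P+M : P + M ≡ Pmax ∸ N′
              P+M = begin-equality
                (Pmax ∸ N) + M            ≡⟨ cong (λ m → (Pmax ∸ m) + M) N≡ ⟩
                (Pmax ∸ (M + N′)) + M     ≡⟨ cong (_+ M) (trans (cong (Pmax ∸_) (+-comm M N′)) (sym (∸-+-assoc Pmax N′ M))) ⟩
                (Pmax ∸ N′ ∸ M) + M       ≡⟨ m∸n+n≡m (m+n≤o⇒m≤o∸n M (≤-trans (≤-reflexive (sym N≡)) (≤-trans N≤n (≤-trans (m≤m+n n n) n+n≤Pmax)))) ⟩
                Pmax ∸ N′                 ∎
              tame⁺ : Tame U′
              tame⁺ = *-cancelʳ-≤ _ _ ((N * P) ^ q) {{>-nonZero (m^n>0 (N * P) {{>-nonZero (*-mono-≤ N>0 (<-≤-trans N>0 N≤P))}} q)}} (begin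
                Ψ U′ * Θ₀ ^ q * (N * P) ^ q                                     ≡⟨ ar (Ψ U′) (Θ₀ ^ q) ((N * P) ^ q) ⟩
                Ψ U′ * (N * P) ^ q * Θ₀ ^ q                                     ≤⟨ *-monoˡ-≤ (Θ₀ ^ q) decay ⟩
                Ψ U * (N′ * (P + M)) ^ q * Θ₀ ^ q                               ≡⟨ ar (Ψ U) ((N′ * (P + M)) ^ q) (Θ₀ ^ q) ⟩
                Ψ U * Θ₀ ^ q * (N′ * (P + M)) ^ q                               ≤⟨ *-monoˡ-≤ ((N′ * (P + M)) ^ q) tame ⟩
                2 ^ l * b₀ ^ q * (N * P) ^ q * (N′ * (P + M)) ^ q               ≡⟨ ar (2 ^ l * b₀ ^ q) ((N * P) ^ q) ((N′ * (P + M)) ^ q) ⟩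
                2 ^ l * b₀ ^ q * (N′ * (P + M)) ^ q * (N * P) ^ q               ≡⟨ cong (λ m → 2 ^ l * b₀ ^ q * (N′ * m) ^ q * (N * P) ^ q) P+M ⟩
                2 ^ l * b₀ ^ q * (N′ * (Pmax ∸ N′)) ^ q * (N * P) ^ q           ∎)
                where
                ar : ∀ a b c → a * b * c ≡ a * c * b
                ar = solve-∀
                N>0 : 0 < N
                N>0 = ≤-trans (s≤s z≤n) (≤-reflexive (sym N≡))
              shrink : sizeW (rest x kf ++ work) < fuel
              shrink = ≤-pred (≤-trans (s≤s (begin
                suc (sizeW (rest x kf ++ work))    ≡⟨ cong suc (sym (Inv.count X.extend)) ⟩
                suc N′                             ≤⟨ s≤s (m≤n+m N′ _) ⟩
                M + N′                             ≡⟨ N≡ ⟨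
                N                                  ≡⟨ Inv.count inv ⟩
                sizeW ((p , br s x kf ∅) ∷ work)   ∎)) lt)
              free : ∀ {it : Item n} → proj₁ it ≡ p ⊎ 1 ≤ occ (br s x (prune kf) ∅) (proj₁ it) → reserved (proj₁ it) ≡ false
              free (inj₁ eq) = trans (cong reserved eq) p-free
              free {it} (inj₂ new) with reserved (proj₁ it) in r
              ... | false = refl
              ... | true = true≢false (res (proj₁ it) r) (X.new (proj₁ it) new)
              onward : Later reserved X.f⁺ X.done⁺ halt
              onward = loop fuel shrink X.extend (All.++⁺ (rest-heavy x kf) hv) (All.++⁺ (rest-Bounded x kf bk) bd) tame⁺ (≤-trans N′≤N N≤n)
                        (λ y r → X.done⁺-old y (res y r)) (All.++⁺ (All.map (λ {it} → free {it}) (Split.parents (cut-item p s x kf))) par′)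
              module L₁ = Later onward

    -- Planting the reservoir of movable vertices

    open XItem

    tail : Map → Fin n → Maybe (Bool × Fin n) → Bool
    tail f w nothing = true
    tail f w (just (b , z)) = E b w (f z)

    hit : Map → Bool → Fin n → Fin n → XItem n → Bool
    hit f s v w it = E (sign it) (f (above it)) w ∧ (E s v (f (at it)) ∧ tail f w (below it))

    hits : Map → Bool → Fin n → Fin n → List (XItem n) → ℕ
    hits f s v w [] = 0
    hits f s v w (it ∷ its) = χ (hit f s v w it) + hits f s v w its

    Agree : Map → ∀ {U p t U′} → Emb U p t U′ → Set
    Agree f ∅ = ⊤
    Agree f (br {x = x} u _ _ ε δ) = f x ≡ u × Agree f ε × Agree f δ

    agree-cong : ∀ {f g : Map} {U p t U′} (ε : Emb U p t U′) → (∀ y → 1 ≤ occ t y → g y ≡ f y) → Agree f ε → Agree g ε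
    agree-cong ∅ h _ = tt
    agree-cong (br {s = s} {x} {k} {r} u _ _ ε δ) h (fx , a , b) =
      trans (h x (occ-top s x k r)) fx , agree-cong ε (λ y y∈ → h y (≤-trans y∈ (occ-kid s x k r y))) a , agree-cong δ (λ y y∈ → h y (≤-trans y∈ (occ-sib s x k r y))) b

    put-agree : ∀ f {U p t U′} (ε : Emb U p t U′) → Simple t → Agree (put f ε) ε
    put-agree f ∅ _ = tt
    put-agree f (br {s = s} {x} {k} {r} u _ _ ε δ) simple =
      put-top f {s = s} u ε δ simple ,
      agree-cong ε (put-kid f {s = s} u ε δ simple) (put-agree (f [ x ↦ u ]) ε (simple-kid {s} {x} {k} {r} simple)) ,
      put-agree (put (f [ x ↦ u ]) ε) δ (simple-sib {s} {x} {k} {r} simple)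

    -- A test i is a triple (sg i , vv i , ww i): it asks for a low-degree vertex whose image is a sg-neighbour of vv i and
    -- which could be moved to ww i.
    module Seed {I : ℕ} (sg : Fin I → Bool) (vv ww : Fin I → Fin n) (a Δ M′ : ℕ) (n>0 : 0 < n) where

      -- Each movable vertex contributes a factor to the estimator of a test: M once the test has
      -- missed it, v₀ before anything is known, and v₁, v₂, v₃ after one, two and all three
      -- conditions (on parent, vertex, child) have held. A condition holds for a fraction of at
      -- least 1/A of the choices, hence d₂ = A d₁ and d₃ = A d₂. The factor 2 in d₁ and the summand
      -- Δ d₁ of M serve to linearise a product over up to Δ children of one parent.
      A d₁ d₂ d₃ v₀ v₁ v₂ v₃ M : ℕ
      A = suc a
      d₁ = 2 * A
      d₂ = A * d₁
      d₃ = A * d₂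
      M = M′ + d₃ + Δ * d₁
      v₀ = M ∸ 1
      v₁ = M ∸ d₁
      v₂ = M ∸ d₂
      v₃ = M ∸ d₃

      d₁≤d₂ : d₁ ≤ d₂
      d₁≤d₂ = m≤m+n d₁ _

      d₂≤d₃ : d₂ ≤ d₃
      d₂≤d₃ = m≤m+n d₂ _

      d₃≤M : d₃ ≤ M
      d₃≤M = ≤-trans (m≤n+m d₃ M′) (m≤m+n _ _)

      M≡₀ : M ≡ v₀ + 1
      M≡₀ = sym (m∸n+n≡m (≤-trans (s≤s z≤n) (≤-trans d₁≤d₂ (≤-trans d₂≤d₃ d₃≤M))))
      M≡₁ : M ≡ v₁ + d₁
      M≡₁ = sym (m∸n+n≡m (≤-trans d₁≤d₂ (≤-trans d₂≤d₃ d₃≤M)))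
      M≡₂ : M ≡ v₂ + d₂
      M≡₂ = sym (m∸n+n≡m (≤-trans d₂≤d₃ d₃≤M))
      M≡₃ : M ≡ v₃ + d₃
      M≡₃ = sym (m∸n+n≡m d₃≤M)

      M>0 : 0 < M
      M>0 = ≤-trans (s≤s z≤n) (≤-trans d₁≤d₂ (≤-trans d₂≤d₃ d₃≤M))

      gate : Bool → ℕ → ℕ
      gate g v = if g then v else M

      headok : Fin I → ∀ {U u k U′} → Emb U u k U′ → Bool
      headok i ∅ = true
      headok i (br {s = b} u _ _ _ _) = E b (ww i) u

      good : Fin I → Bool → Fin n → Fin n → ∀ {U k U′} (u′ : Fin n) → Emb U u′ k U′ → Bool
      good i s p u u′ ε = E s p (ww i) ∧ (E (sg i) (vv i) u ∧ headok i ε)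

      -- The estimator after all vertices are placed: v₃ for every movable vertex that the test
      -- hits, M for every one it misses.
      fin : Class → Fin I → ∀ {U p t U′} → Emb U p t U′ → ℕ
      fin c i ∅ = 1
      fin c i (br {p = p} {s} {k = k} u _ _ ε δ) = (if own c k then gate (good i s p u u ε) v₃ else 1) * (fin (next c) i ε * fin c i δ)

      -- The estimator for top vertices of class `X` when the image p of their parent is known and
      -- they are not yet placed; the vertices further below still count v₀ each.
      ini : Fin I → Fin n → Forest n → ℕ
      ini i p ∅ = 1
      ini i p (br s x k r) = (if low k then gate (E s p (ww i)) v₁ else 1) * (v₀ ^ movable Z k * ini i p r)

      lowroots deep : Forest n → ℕ
      lowroots ∅ = 0
      lowroots (br s x k r) = χ (low k) + lowroots r
      deep ∅ = 0
      deep (br s x k r) = movable Z k + deep r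

      reach : Fin I → Fin n → Forest n → ℕ
      reach i u ∅ = 0
      reach i u (br s x k r) = χ (low k) * χ (E s u (ww i)) + reach i u r

      movable-X : ∀ k → movable X k ≡ lowroots k + deep k
      movable-X ∅ = refl
      movable-X (br s x k r) = trans (cong (λ z → χ (low k) + (movable Z k + z)) (movable-X r)) (arith (χ (low k)) (movable Z k) (lowroots r) (deep r))
        where
        arith : ∀ a b c d → a + (b + (c + d)) ≡ a + c + (b + d)
        arith = solve-∀

      lowroots≤ : ∀ k → lowroots k ≤ roots k
      lowroots≤ ∅ = z≤n
      lowroots≤ (br s x k r) = +-mono-≤ (χ≤1 (low k)) (lowroots≤ r)

      reach≤ : ∀ i u k → reach i u k ≤ roots k
      reach≤ i u ∅ = z≤n
      reach≤ i u (br s x k r) = +-mono-≤ (*-mono-≤ (χ≤1 (low k)) (χ≤1 (E s u (ww i)))) (reach≤ i u r)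

      -- Linearisation (1 - d₁/M)^S ≤ 1 - d₁ S/(2 M), where S counts the low children whose edge to
      -- the parent would survive a move. It is valid because d₁ S ≤ M, which follows from S ≤ Δ and
      -- the summand Δ d₁ of M.
      ini-linear : ∀ i u k → roots k ≤ Δ →
                   2 * M * ini i u k + d₁ * reach i u k * (M ^ lowroots k * v₀ ^ deep k) ≤ 2 * M * (M ^ lowroots k * v₀ ^ deep k)
      ini-linear i u ∅ _ = ≤-reflexive (arith M d₁)
        where
        arith : ∀ M d → 2 * M * 1 + d * 0 * (1 * 1) ≡ 2 * M * (1 * 1)
        arith = solve-∀
      ini-linear i u (br s x k r) ≤Δ with low k | E s u (ww i) | ini-linear i u r (<⇒≤ ≤Δ)
      ... | false | _ | ih = begin
        2 * M * (1 * (w * ini i u r)) + d₁ * reach i u r * (M ^ lowroots r * v₀ ^ (movable Z k + deep r))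
          ≡⟨ cong (λ z → 2 * M * (1 * (w * ini i u r)) + d₁ * reach i u r * (M ^ lowroots r * z)) (^-distribˡ-+-* v₀ (movable Z k) (deep r)) ⟩
        2 * M * (1 * (w * ini i u r)) + d₁ * reach i u r * (M ^ lowroots r * (w * v₀ ^ deep r))
          ≡⟨ ar M w (ini i u r) (d₁ * reach i u r) (M ^ lowroots r) (v₀ ^ deep r) ⟩
        w * (2 * M * ini i u r + d₁ * reach i u r * (M ^ lowroots r * v₀ ^ deep r))
          ≤⟨ *-monoʳ-≤ w ih ⟩
        w * (2 * M * (M ^ lowroots r * v₀ ^ deep r))
          ≡⟨ ar₂ M w (M ^ lowroots r) (v₀ ^ deep r) ⟩
        2 * M * (M ^ lowroots r * (w * v₀ ^ deep r))
          ≡⟨ cong (λ z → 2 * M * (M ^ lowroots r * z)) (^-distribˡ-+-* v₀ (movable Z k) (deep r)) ⟨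
        2 * M * (M ^ lowroots r * v₀ ^ (movable Z k + deep r)) ∎
        where
        open ≤-Reasoning
        w = v₀ ^ movable Z k
        ar : ∀ M w I S p v → 2 * M * (1 * (w * I)) + S * (p * (w * v)) ≡ w * (2 * M * I + S * (p * v))
        ar = solve-∀
        ar₂ : ∀ M w p v → w * (2 * M * (p * v)) ≡ 2 * M * (p * (w * v))
        ar₂ = solve-∀
      ... | true | e | ih = begin
        2 * M * (gate e v₁ * (w * ini i u r)) + d₁ * (1 * χ e + reach i u r) * (M * M ^ lowroots r * v₀ ^ (movable Z k + deep r))
          ≡⟨ cong (λ z → 2 * M * (gate e v₁ * (w * ini i u r)) + d₁ * (1 * χ e + reach i u r) * (M * M ^ lowroots r * z)) (^-distribˡ-+-* v₀ (movable Z k) (deep r)) ⟩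
        2 * M * (gate e v₁ * (w * ini i u r)) + d₁ * (1 * χ e + reach i u r) * (M * M ^ lowroots r * (w * v₀ ^ deep r))
          ≡⟨ ar M (gate e v₁) w (ini i u r) (d₁ * (1 * χ e + reach i u r)) (M ^ lowroots r) (v₀ ^ deep r) ⟩
        w * (2 * M * (gate e v₁ * ini i u r) + d₁ * (1 * χ e + reach i u r) * (M * (M ^ lowroots r * v₀ ^ deep r)))
          ≤⟨ *-monoʳ-≤ w (core e) ⟩
        w * (2 * M * (M * (M ^ lowroots r * v₀ ^ deep r)))
          ≡⟨ ar₂ M w (M ^ lowroots r) (v₀ ^ deep r) ⟩
        2 * M * (M * M ^ lowroots r * (w * v₀ ^ deep r))
          ≡⟨ cong (λ z → 2 * M * (M * M ^ lowroots r * z)) (^-distribˡ-+-* v₀ (movable Z k) (deep r)) ⟨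
        2 * M * (M * M ^ lowroots r * v₀ ^ (movable Z k + deep r)) ∎
        where
        open ≤-Reasoning
        w = v₀ ^ movable Z k
        B = M ^ lowroots r * v₀ ^ deep r
        S = reach i u r
        t = M ∸ d₁ * S
        M≡ : M ≡ d₁ * S + t
        M≡ = sym (m+[n∸m]≡n (≤-trans (*-monoʳ-≤ d₁ (≤-trans (reach≤ i u r) (<⇒≤ ≤Δ))) (≤-trans (≤-reflexive (*-comm d₁ Δ)) (m≤n+m _ (M′ + d₃)))))
        ar : ∀ M g w I S p v → 2 * M * (g * (w * I)) + S * (M * p * (w * v)) ≡ w * (2 * M * (g * I) + S * (M * (p * v)))
        ar = solve-∀
        ar₂ : ∀ M w p v → w * (2 * M * (M * (p * v))) ≡ 2 * M * (M * p * (w * v))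
        ar₂ = solve-∀
        core : ∀ e → 2 * M * (gate e v₁ * ini i u r) + d₁ * (1 * χ e + S) * (M * B) ≤ 2 * M * (M * B)
        core false = subst₂ _≤_ (ar₃ M (ini i u r) (d₁ * S) B) (ar₄ M B) (*-monoʳ-≤ M ih)
          where
          ar₃ : ∀ M I S B → M * (2 * M * I + S * B) ≡ 2 * M * (M * I) + S * (M * B)
          ar₃ = solve-∀
          ar₄ : ∀ M B → M * (2 * M * B) ≡ 2 * M * (M * B)
          ar₄ = solve-∀
        core true = lin (d₁ * B * t) (*-monoʳ-≤ v₁ ih)
          (subst (λ m → 2 * m * (v₁ * ini i u r) + d₁ * (1 * 1 + S) * (m * B) + v₁ * (2 * m * B) + d₁ * B * t ≡ 2 * m * (m * B) + v₁ * (2 * m * ini i u r + d₁ * S * B))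
            (sym M≡₁) (core-arith v₁ d₁ S t (ini i u r) B (trans (sym M≡₁) M≡)))
          where
          core-arith : ∀ v d S t I B → v + d ≡ d * S + t →
            2 * (v + d) * (v * I) + d * (1 * 1 + S) * ((v + d) * B) + v * (2 * (v + d) * B) + d * B * t ≡ 2 * (v + d) * ((v + d) * B) + v * (2 * (v + d) * I + d * S * B)
          core-arith v d S t I B eq = trans (r₁ v d S t I B) (trans (cong (λ z → 2 * (v + d) * (v * I) + 2 * (v + d) * (v * B) + d * ((v + d) * B) + v * d * S * B + d * B * z) (sym eq)) (r₂ v d S I B))
            where
            r₁ : ∀ v d S t I B → 2 * (v + d) * (v * I) + d * (1 * 1 + S) * ((v + d) * B) + v * (2 * (v + d) * B) + d * B * t ≡
                 2 * (v + d) * (v * I) + 2 * (v + d) * (v * B) + d * ((v + d) * B) + v * d * S * B + d * B * (d * S + t)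
            r₁ = solve-∀
            r₂ : ∀ v d S I B → 2 * (v + d) * (v * I) + 2 * (v + d) * (v * B) + d * ((v + d) * B) + v * d * S * B + d * B * (v + d) ≡
                 2 * (v + d) * ((v + d) * B) + v * (2 * (v + d) * I + d * S * B)
            r₂ = solve-∀

      -- An averaging step: Γ is the set of candidates for the next image.
      Often : Pool → Pool → Set
      Often Γ g = cnt Γ ≤ A * cnt (λ u → Γ u ∧ g u)

      -- One u serves all tests at once: averaging is applied to the weighted sum of the estimators,
      -- where W holds the factors not affected by this choice.
      choose : ∀ (Γ : Pool) (W : Fin I → ℕ) (φ : Fin I → Fin n → ℕ) (ψ : Fin I → ℕ) → 0 < cnt Γ →
               (∀ i → ∑ (λ u → χ (Γ u) * φ i u) ≤ cnt Γ * ψ i) → ∃ λ u → Γ u ≡ true × ∑ (λ i → W i * φ i u) ≤ ∑ (λ i → W i * ψ i)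
      choose Γ W φ ψ pos avg = go (min≤avg-on Γ (λ u → ∑ (λ i → W i * φ i u)) pos)
        where
        open ≤-Reasoning
        go : (∃ λ u → Γ u ≡ true × ∑ (λ i → W i * φ i u) * cnt Γ ≤ ∑ (λ u → χ (Γ u) * ∑ (λ i → W i * φ i u))) → _
        go (u , Γu , le) = u , Γu , *-cancelʳ-≤ _ _ (cnt Γ) {{>-nonZero pos}} (begin
          ∑ (λ i → W i * φ i u) * cnt Γ                       ≤⟨ le ⟩
          ∑ (λ u → χ (Γ u) * ∑ (λ i → W i * φ i u))           ≡⟨ ∑-cong (λ u → sym (∑-*ˡ (χ (Γ u)) _)) ⟩
          ∑ (λ u → ∑ (λ i → χ (Γ u) * (W i * φ i u)))         ≡⟨ ∑-swap _ ⟩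
          ∑ (λ i → ∑ (λ u → χ (Γ u) * (W i * φ i u)))         ≡⟨ ∑-cong (λ i → trans (∑-cong λ u → ar (χ (Γ u)) (W i) (φ i u)) (∑-*ˡ (W i) _)) ⟩
          ∑ (λ i → W i * ∑ (λ u → χ (Γ u) * φ i u))           ≤⟨ ∑-mono (λ i → *-monoʳ-≤ (W i) (avg i)) ⟩
          ∑ (λ i → W i * (cnt Γ * ψ i))                       ≡⟨ trans (∑-cong λ i → ar₂ (W i) (cnt Γ) (ψ i)) (∑-*ʳ (cnt Γ) _) ⟩
          ∑ (λ i → W i * ψ i) * cnt Γ                         ∎)
          where
          ar : ∀ a b c → a * (b * c) ≡ b * (a * c)
          ar = solve-∀
          ar₂ : ∀ a b c → a * (b * c) ≡ a * c * b
          ar₂ = solve-∀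

      -- A gain of A d on at least the A-th part of Γ is an average gain of d.
      gate-avg : ∀ (Γ g : Pool) {v w d} → M ≡ v + d → M ≡ w + A * d → Often Γ g → ∑ (λ u → χ (Γ u) * gate (g u) w) ≤ cnt Γ * v
      gate-avg Γ g {v} {w} {d} eq eq′ often = lin 0 (≤-trans (≤-reflexive balance) (+-monoʳ-≤ _ (*-monoʳ-≤ d often))) (arith _ (cnt Γ) v d A (cnt (λ u → Γ u ∧ g u)))
        where
        each : ∀ u → χ (Γ u) * gate (g u) w + A * d * χ (Γ u ∧ g u) ≡ χ (Γ u) * M
        each u with Γ u | g u
        ... | false | _ = *-zeroʳ (A * d)
        ... | true | true = trans (ar w (A * d)) (cong (1 *_) (sym eq′))
          where
          ar : ∀ w d → 1 * w + d * 1 ≡ 1 * (w + d)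
          ar = solve-∀
        ... | true | false = trans (cong (1 * M +_) (*-zeroʳ (A * d))) (+-identityʳ _)
        balance : ∑ (λ u → χ (Γ u) * gate (g u) w) + A * d * cnt (λ u → Γ u ∧ g u) + d * cnt Γ ≡ cnt Γ * (v + d) + d * cnt Γ
        balance = cong (_+ d * cnt Γ) (trans (cong (∑ (λ u → χ (Γ u) * gate (g u) w) +_) (sym (∑-*ˡ (A * d) _)))
                    (trans (sym (∑-+ _ _)) (trans (∑-cong each) (trans (∑-*ʳ M _) (cong (cnt Γ *_) eq)))))
        arith : ∀ x N v d A c → x + (N * (v + d) + d * (A * c)) + 0 ≡ N * v + (x + A * d * c + d * N)
        arith = solve-∀

      -- On average over u at least r/A of the r low children are reached, so the linear bound of
      -- `ini-linear` averages to 1 - d₁ r/(2 A M), which is 1 - r/M and hence at most (1 - 1/M)^r.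
      ini-avg : ∀ (Γ : Pool) i k → roots k ≤ Δ → (∀ s → Often Γ (λ u → E s u (ww i))) → ∑ (λ u → χ (Γ u) * ini i u k) ≤ cnt Γ * v₀ ^ movable X k
      ini-avg Γ i k ≤Δ often = *-cancelˡ-≤ (2 * M * A) {{>-nonZero (*-mono-≤ (*-mono-≤ (s≤s (z≤n {1})) M>0) (s≤s (z≤n {a})))}} (begin
        2 * M * A * Sini
          ≤⟨ lin 0 (+-mono-≤ (+-mono-≤ (*-monoʳ-≤ A summed) (*-monoʳ-≤ (d₁ * D) reached)) (*-monoʳ-≤ (2 * A * v₀ ^ deep k * c) bern)) (arith M A Sini Srea (M ^ r) (v₀ ^ deep k) (v₀ ^ r) c r) ⟩
        2 * M * A * (c * (v₀ ^ r * v₀ ^ deep k))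
          ≡⟨ cong (λ z → 2 * M * A * (c * z)) (trans (sym (^-distribˡ-+-* v₀ r (deep k))) (cong (v₀ ^_) (sym (movable-X k)))) ⟩
        2 * M * A * (c * v₀ ^ movable X k) ∎)
        where
        open ≤-Reasoning
        c = cnt Γ
        r = lowroots k
        D = M ^ r * v₀ ^ deep k
        Sini = ∑ (λ u → χ (Γ u) * ini i u k)
        Srea = ∑ (λ u → χ (Γ u) * reach i u k)
        reached-gen : ∀ k → c * lowroots k ≤ A * ∑ (λ u → χ (Γ u) * reach i u k)
        reached-gen ∅ = ≤-trans (≤-reflexive (*-zeroʳ c)) z≤n
        reached-gen (br s x k r) = begin
          c * (χ (low k) + lowroots r)
            ≡⟨ ar₁ c (χ (low k)) (lowroots r) ⟩
          χ (low k) * c + c * lowroots r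
            ≤⟨ +-mono-≤ (*-monoʳ-≤ (χ (low k)) (often s)) (reached-gen r) ⟩
          χ (low k) * (A * cnt (λ u → Γ u ∧ E s u (ww i))) + A * ∑ (λ u → χ (Γ u) * reach i u r)
            ≡⟨ ar₂ (χ (low k)) A _ _ ⟩
          A * (χ (low k) * cnt (λ u → Γ u ∧ E s u (ww i)) + ∑ (λ u → χ (Γ u) * reach i u r))
            ≡⟨ cong (A *_) (trans (cong (_+ ∑ (λ u → χ (Γ u) * reach i u r)) (sym (∑-*ˡ (χ (low k)) _))) (trans (sym (∑-+ _ _)) (∑-cong λ u → ar₃ u))) ⟩
          A * ∑ (λ u → χ (Γ u) * (χ (low k) * χ (E s u (ww i)) + reach i u r)) ∎
          where
          ar₁ : ∀ c l r → c * (l + r) ≡ l * c + c * r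
          ar₁ = solve-∀
          ar₂ : ∀ l A x y → l * (A * x) + A * y ≡ A * (l * x + y)
          ar₂ = solve-∀
          ar₃ : ∀ u → χ (low k) * χ (Γ u ∧ E s u (ww i)) + χ (Γ u) * reach i u r ≡ χ (Γ u) * (χ (low k) * χ (E s u (ww i)) + reach i u r)
          ar₃ u = trans (cong (λ z → χ (low k) * z + χ (Γ u) * reach i u r) (χ-∧ (Γ u) (E s u (ww i)))) (ar₄ (χ (low k)) (χ (Γ u)) (χ (E s u (ww i))) (reach i u r))
            where
            ar₄ : ∀ l g e r → l * (g * e) + g * r ≡ g * (l * e + r)
            ar₄ = solve-∀
        reached : c * r ≤ A * Srea
        reached = reached-gen k
        summed : 2 * M * Sini + d₁ * D * Srea ≤ 2 * M * D * c
        summed = begin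
          2 * M * Sini + d₁ * D * Srea
            ≡⟨ cong₂ _+_ (∑-*ˡ (2 * M) _) (∑-*ˡ (d₁ * D) _) ⟨
          ∑ (λ u → 2 * M * (χ (Γ u) * ini i u k)) + ∑ (λ u → d₁ * D * (χ (Γ u) * reach i u k))
            ≡⟨ trans (∑-cong λ u → ar (χ (Γ u)) (2 * M) (ini i u k) d₁ (reach i u k) D) (∑-+ _ _) ⟨
          ∑ (λ u → χ (Γ u) * (2 * M * ini i u k + d₁ * reach i u k * D))
            ≤⟨ ∑-mono (λ u → *-monoʳ-≤ (χ (Γ u)) (ini-linear i u k ≤Δ)) ⟩
          ∑ (λ u → χ (Γ u) * (2 * M * D))
            ≡⟨ trans (∑-*ʳ (2 * M * D) _) (*-comm c (2 * M * D)) ⟩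
          2 * M * D * c ∎
          where
          ar : ∀ g m I d R D → g * (m * I + d * R * D) ≡ m * (g * I) + d * D * (g * R)
          ar = solve-∀
        bern : M ^ r * M ≤ v₀ ^ r * M + r * M ^ r
        bern = subst (λ m → m ^ r * m ≤ v₀ ^ r * m + r * m ^ r) (sym M≡₀) (subst (λ z → (v₀ + 1) ^ r * (v₀ + 1) ≤ v₀ ^ r * (v₀ + 1) + z * (v₀ + 1) ^ r) (*-identityʳ r) (power-loss v₀ 1 r))
        arith : ∀ M A I R p w v c r → 2 * M * A * I + (A * (2 * M * (p * w) * c) + 2 * A * (p * w) * (A * R) + 2 * A * w * c * (v * M + r * p)) + 0
                ≡ 2 * M * A * (c * (v * w)) + (A * (2 * M * I + 2 * A * (p * w) * R) + 2 * A * (p * w) * (c * r) + 2 * A * w * c * (p * M))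
        arith = solve-∀

      -- After m more vertices are placed, at most n/A host vertices are used.
      Cap : Pool → ℕ → Set
      Cap U m = A * (n + m) ≤ n + A * cnt U

      cap-∖ : ∀ {U u m} → U u ≡ true → Cap U (suc m) → Cap (U ∖ u) m
      cap-∖ {U} {u} {m} Uu cap = +-cancelʳ-≤ A _ _ (subst₂ _≤_ (ar A n m) (trans (cong (λ z → n + A * z) (cnt-∖ U u Uu)) (ar₂ n A (cnt (U ∖ u)))) cap)
        where
        ar : ∀ A n m → A * (n + (1 + m)) ≡ A * (n + m) + A
        ar = solve-∀
        ar₂ : ∀ n A c → n + A * (1 + c) ≡ n + A * c + A
        ar₂ = solve-∀

      cap-less : ∀ {U m m′} → m′ ≤ m → Cap U m → Cap U m′
      cap-less le cap = ≤-trans (*-monoʳ-≤ A (+-monoʳ-≤ n le)) cap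

      cap-Emb : ∀ {U p t U′} m → Emb U p t U′ → Cap U (size t + m) → Cap U′ m
      cap-Emb {U} {t = t} {U′} m ε cap = +-cancelʳ-≤ (A * size t) _ _ (subst₂ _≤_ (ar A n (size t) m) (trans (cong (λ z → n + A * z) (cnt-Emb ε)) (ar₂ n A (size t) (cnt U′))) cap)
        where
        ar : ∀ A n s m → A * (n + (s + m)) ≡ A * (n + m) + A * s
        ar = solve-∀
        ar₂ : ∀ n A s c → n + A * (s + c) ≡ n + A * c + A * s
        ar₂ = solve-∀

      module Plant (dense : Dense A (λ _ → true)) where

        open ≤-Reasoning

        candidates : Pool → Bool → Fin n → Pool
        candidates U s p u = U u ∧ E s p u

        -- Two vertices have at least 2 n/A common neighbours in the host, and at most n/A of these
        -- are used.
        common : ∀ U s p s′ w → Cap U 0 → n ≤ A * cnt (λ u → candidates U s p u ∧ E s′ w u)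
        common U s p s′ w cap = lin 0 (+-mono-≤ (+-mono-≤ two (*-monoʳ-≤ A lost)) (+-mono-≤ cap (≤-reflexive (cong (A *_) parts)))) (arith n A C (cnt U) K V)
          where
          C = cnt (λ u → candidates U s p u ∧ E s′ w u)
          K = cnt (λ u → true ∧ (E s p u ∧ E s′ w u))
          V = cnt (λ u → not (U u))
          two : 2 * n ≤ A * K
          two = subst (λ m → 2 * m ≤ A * K) (cnt-true n) (common-neighbours {A} {λ _ → true} dense s p s′ w)
          parts : cnt U + V ≡ n
          parts = trans (sym (cnt-split (λ _ → true) U)) (cnt-true n)
          lost : K ≤ C + V
          lost = ≤-trans (∑-mono λ u → go (U u) (E s p u) (E s′ w u)) (≤-reflexive (∑-+ _ _))
            where
            go : ∀ a b c → χ (b ∧ c) ≤ χ ((a ∧ b) ∧ c) + χ (not a)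
            go false b     c = χ≤1 (b ∧ c)
            go true  false c = z≤n
            go true  true  c = m≤m+n _ _
          arith : ∀ n A C U K V → n + (A * K + A * (C + V) + (n + A * U + A * n)) + 0 ≡ A * C + (2 * n + A * K + (A * (n + 0) + A * (U + V)))
          arith = solve-∀

        often : ∀ U s p → Cap U 0 → ∀ s′ w → Often (candidates U s p) (E s′ w)
        often U s p cap s′ w = ≤-trans (≤-trans (cnt-mono λ _ _ → refl) (≤-reflexive (cnt-true n))) (common U s p s′ w cap)

        some : ∀ U s p → Cap U 0 → 0 < cnt (candidates U s p)
        some U s p cap = n≢0⇒n>0 λ z → <⇒≱ n>0 (≤-trans (common U s p s p cap) (≤-trans (*-monoʳ-≤ A (cnt-mono λ u h → proj₁ (∧-true h))) (≤-reflexive (trans (cong (A *_) z) (*-zeroʳ A)))))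

        greedy : ∀ t p U → Cap U (size t) → ∃ λ U′ → Emb U p t U′
        greedy ∅ p U cap = U , ∅
        greedy (br s x k r) p U cap = first (cnt-pos (candidates U s p) (some U s p (cap-less z≤n cap)))
          where
          first : (∃ λ u → candidates U s p u ≡ true) → ∃ λ U′ → Emb U p (br s x k r) U′
          first (u , h) = second (greedy k u (U ∖ u) (cap-less (m≤m+n _ _) cap′))
            where
            Uu = proj₁ (∧-true h)
            cap′ : Cap (U ∖ u) (size k + size r)
            cap′ = cap-∖ {U} {u} Uu cap
            second : (∃ λ U₁ → Emb (U ∖ u) u k U₁) → ∃ λ U′ → Emb U p (br s x k r) U′
            second (U₁ , ε) = third (greedy r p U₁ (cap-Emb (size r) ε cap′))
              where
              third : (∃ λ U′ → Emb U₁ p r U′) → ∃ λ U′ → Emb U p (br s x k r) U′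
              third (U′ , δ) = U′ , br u Uu (proj₂ (∧-true {U u} h)) ε δ

        record Seeded (c : Class) (W : Fin I → ℕ) (U : Pool) (p : Fin n) (t : Forest n) (bound : Fin I → ℕ) : Set where
          constructor seeded
          field
            {U′} : Pool
            ε    : Emb U p t U′
            le   : ∑ (λ i → W i * fin c i ε) ≤ ∑ (λ i → W i * bound i)

        -- The image of a `Y` vertex decides the first condition for all its children, so it is
        -- chosen by `ini-avg`. An `X` vertex of low degree decides the second condition and its
        -- child the third. A `Z` vertex, unless placed together with its parent, and an `X` vertex
        -- of high degree carry no condition and are placed greedily.
        plant-Y : ∀ t p U W → Bounded Δ t → Cap U (size t) → Seeded Y W U p t (λ i → v₀ ^ movable Y t)
        plant-X : ∀ t p U W → Bounded Δ t → Cap U (size t) → Seeded X W U p t (λ i → ini i p t)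
        plant-Z : ∀ t p U W → Bounded Δ t → Cap U (size t) → Seeded Z W U p t (λ i → v₀ ^ movable Z t)

        plant-X-high : ∀ s x k r p U W → low k ≡ false → Bounded Δ k → Bounded Δ r → Cap U (suc (size k + size r)) → Seeded X W U p (br s x k r) (λ i → ini i p (br s x k r))

        plant-Y ∅ p U W _ _ = seeded ∅ ≤-refl
        plant-Y (br s x k r) p U W (k≤ , bk , brr) cap =
          first (choose (candidates U s p) (λ i → W i * v₀ ^ movable Y r) (λ i u → ini i u k) (λ i → v₀ ^ movable X k) (some U s p cap₀)
                  (λ i → ini-avg (candidates U s p) i k k≤ (λ s′ → flip-often s′ i)))
          where
          cap₀ : Cap U 0
          cap₀ = cap-less z≤n cap
          flip-often : ∀ s′ i → Often (candidates U s p) (λ u → E s′ u (ww i))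
          flip-often s′ i = subst (λ m → cnt (candidates U s p) ≤ A * m) (flip-cnt (candidates U s p) s′ (ww i)) (often U s p cap₀ (not s′) (ww i))
          Goal = Seeded Y W U p (br s x k r) (λ i → v₀ ^ movable Y (br s x k r))
          first : (∃ λ u → candidates U s p u ≡ true × ∑ (λ i → W i * v₀ ^ movable Y r * ini i u k) ≤ ∑ (λ i → W i * v₀ ^ movable Y r * v₀ ^ movable X k)) → Goal
          first (u , h , le) = second (plant-X k u (U ∖ u) (λ i → W i * v₀ ^ movable Y r) bk (cap-less (m≤m+n _ _) cap′))
            where
            Uu = proj₁ (∧-true h)
            cap′ : Cap (U ∖ u) (size k + size r)
            cap′ = cap-∖ {U} {u} Uu cap
            second : Seeded X (λ i → W i * v₀ ^ movable Y r) (U ∖ u) u k (λ i → ini i u k) → Goal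
            second (seeded {U₁} ε leε) = third (plant-Y r p U₁ (λ i → W i * fin X i ε) brr (cap-Emb (size r) ε cap′))
              where
              third : Seeded Y (λ i → W i * fin X i ε) U₁ p r (λ i → v₀ ^ movable Y r) → Goal
              third (seeded δ leδ) = seeded (br u Uu (proj₂ (∧-true {U u} h)) ε δ) (begin
                ∑ (λ i → W i * (1 * (fin X i ε * fin Y i δ)))                 ≡⟨ ∑-cong (λ i → ar₁ (W i) (fin X i ε) (fin Y i δ)) ⟩
                ∑ (λ i → W i * fin X i ε * fin Y i δ)                         ≤⟨ leδ ⟩
                ∑ (λ i → W i * fin X i ε * v₀ ^ movable Y r)                  ≡⟨ ∑-cong (λ i → ar₂ (W i) (fin X i ε) (v₀ ^ movable Y r)) ⟩
                ∑ (λ i → W i * v₀ ^ movable Y r * fin X i ε)                  ≤⟨ leε ⟩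
                ∑ (λ i → W i * v₀ ^ movable Y r * ini i u k)                  ≤⟨ le ⟩
                ∑ (λ i → W i * v₀ ^ movable Y r * v₀ ^ movable X k)           ≡⟨ ∑-cong (λ i → trans (ar₃ (W i) (v₀ ^ movable Y r) (v₀ ^ movable X k)) (cong (W i *_) (sym (^-distribˡ-+-* v₀ (movable X k) (movable Y r))))) ⟩
                ∑ (λ i → W i * v₀ ^ (movable X k + movable Y r))              ∎)
                where
                ar₁ : ∀ w a b → w * (1 * (a * b)) ≡ w * a * b
                ar₁ = solve-∀
                ar₂ : ∀ w a b → w * a * b ≡ w * b * a
                ar₂ = solve-∀
                ar₃ : ∀ w a b → w * a * b ≡ w * (b * a)
                ar₃ = solve-∀

        plant-Z ∅ p U W _ _ = seeded ∅ ≤-refl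
        plant-Z (br s x k r) p U W (k≤ , bk , brr) cap = first (cnt-pos (candidates U s p) (some U s p (cap-less z≤n cap)))
          where
          Goal = Seeded Z W U p (br s x k r) (λ i → v₀ ^ movable Z (br s x k r))
          first : (∃ λ u → candidates U s p u ≡ true) → Goal
          first (u , h) = second (plant-Y k u (U ∖ u) (λ i → W i * v₀ ^ movable Z r) bk (cap-less (m≤m+n _ _) cap′))
            where
            Uu = proj₁ (∧-true h)
            cap′ : Cap (U ∖ u) (size k + size r)
            cap′ = cap-∖ {U} {u} Uu cap
            second : Seeded Y (λ i → W i * v₀ ^ movable Z r) (U ∖ u) u k (λ i → v₀ ^ movable Y k) → Goal
            second (seeded {U₁} ε leε) = third (plant-Z r p U₁ (λ i → W i * fin Y i ε) brr (cap-Emb (size r) ε cap′))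
              where
              third : Seeded Z (λ i → W i * fin Y i ε) U₁ p r (λ i → v₀ ^ movable Z r) → Goal
              third (seeded δ leδ) = seeded (br u Uu (proj₂ (∧-true {U u} h)) ε δ) (begin
                ∑ (λ i → W i * (1 * (fin Y i ε * fin Z i δ)))                 ≡⟨ ∑-cong (λ i → ar₁ (W i) (fin Y i ε) (fin Z i δ)) ⟩
                ∑ (λ i → W i * fin Y i ε * fin Z i δ)                         ≤⟨ leδ ⟩
                ∑ (λ i → W i * fin Y i ε * v₀ ^ movable Z r)                  ≡⟨ ∑-cong (λ i → ar₂ (W i) (fin Y i ε) (v₀ ^ movable Z r)) ⟩
                ∑ (λ i → W i * v₀ ^ movable Z r * fin Y i ε)                  ≤⟨ leε ⟩
                ∑ (λ i → W i * v₀ ^ movable Z r * v₀ ^ movable Y k)           ≡⟨ ∑-cong (λ i → trans (ar₃ (W i) (v₀ ^ movable Z r) (v₀ ^ movable Y k)) (cong (W i *_) (sym (^-distribˡ-+-* v₀ (movable Y k) (movable Z r))))) ⟩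
                ∑ (λ i → W i * v₀ ^ (movable Y k + movable Z r))              ∎)
                where
                ar₁ : ∀ w a b → w * (1 * (a * b)) ≡ w * a * b
                ar₁ = solve-∀
                ar₂ : ∀ w a b → w * a * b ≡ w * b * a
                ar₂ = solve-∀
                ar₃ : ∀ w a b → w * a * b ≡ w * (b * a)
                ar₃ = solve-∀

        plant-X ∅ p U W _ _ = seeded ∅ ≤-refl
        plant-X (br s x ∅ r) p U W (_ , _ , brr) cap =
          first (choose Γ (λ i → W i * ini i p r) (λ i u → gate (E s p (ww i) ∧ (E (sg i) (vv i) u ∧ true)) v₃) (λ i → gate (E s p (ww i)) v₁) (some U s p cap₀) avg)
          where
          Γ = candidates U s p
          cap₀ : Cap U 0
          cap₀ = cap-less z≤n cap
          avg : ∀ i → ∑ (λ u → χ (Γ u) * gate (E s p (ww i) ∧ (E (sg i) (vv i) u ∧ true)) v₃) ≤ cnt Γ * gate (E s p (ww i)) v₁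
          avg i with E s p (ww i)
          ... | false = ≤-reflexive (∑-*ʳ M _)
          ... | true = ≤-trans (∑-mono λ u → *-monoʳ-≤ (χ (Γ u)) (weaken (E (sg i) (vv i) u))) (gate-avg Γ (E (sg i) (vv i)) M≡₁ M≡₂ (often U s p cap₀ (sg i) (vv i)))
            where
            -- A leaf has no third condition, so it passes from v₁ directly to v₃, which is at most
            -- v₂.
            weaken : ∀ g → gate (g ∧ true) v₃ ≤ gate g v₂
            weaken true = ∸-monoʳ-≤ M d₂≤d₃
            weaken false = ≤-refl
          Goal = Seeded X W U p (br s x ∅ r) (λ i → ini i p (br s x ∅ r))
          first : (∃ λ u → Γ u ≡ true × ∑ (λ i → W i * ini i p r * gate (E s p (ww i) ∧ (E (sg i) (vv i) u ∧ true)) v₃) ≤ ∑ (λ i → W i * ini i p r * gate (E s p (ww i)) v₁)) → Goal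
          first (u , h , le) = second (plant-X r p (U ∖ u) (λ i → W i * gate (E s p (ww i) ∧ (E (sg i) (vv i) u ∧ true)) v₃) brr (cap-∖ {U} {u} Uu cap))
            where
            Uu = proj₁ (∧-true h)
            val : Fin I → ℕ
            val i = gate (E s p (ww i) ∧ (E (sg i) (vv i) u ∧ true)) v₃
            second : Seeded X (λ i → W i * val i) (U ∖ u) p r (λ i → ini i p r) → Goal
            second (seeded δ leδ) = seeded (br u Uu (proj₂ (∧-true {U u} h)) ∅ δ) (begin
              ∑ (λ i → W i * (val i * (1 * fin X i δ)))                       ≡⟨ ∑-cong (λ i → ar₁ (W i) (val i) (fin X i δ)) ⟩
              ∑ (λ i → W i * val i * fin X i δ)                               ≤⟨ leδ ⟩
              ∑ (λ i → W i * val i * ini i p r)                               ≡⟨ ∑-cong (λ i → ar₂ (W i) (val i) (ini i p r)) ⟩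
              ∑ (λ i → W i * ini i p r * val i)                               ≤⟨ le ⟩
              ∑ (λ i → W i * ini i p r * gate (E s p (ww i)) v₁)              ≡⟨ ∑-cong (λ i → ar₃ (W i) (ini i p r) (gate (E s p (ww i)) v₁)) ⟩
              ∑ (λ i → W i * (gate (E s p (ww i)) v₁ * (1 * ini i p r)))      ∎)
              where
              ar₁ : ∀ w a b → w * (a * (1 * b)) ≡ w * a * b
              ar₁ = solve-∀
              ar₂ : ∀ w a b → w * a * b ≡ w * b * a
              ar₂ = solve-∀
              ar₃ : ∀ w a b → w * a * b ≡ w * (b * (1 * a))
              ar₃ = solve-∀
        -- The vertex x and its only child z are placed together: the choice for x takes the gate
        -- from v₁ to v₂, the choice for z from v₂ to v₃.
        plant-X (br s x (br b z kz ∅) r) p U W (_ , (_ , bkz , _) , brr) cap =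
          first (choose Γ (λ i → W i * (v₀ ^ mz * ini i p r)) (λ i u → gate (pre i u) v₂) (λ i → gate (E s p (ww i)) v₁) (some U s p cap₀) avg)
          where
          Γ = candidates U s p
          mz = movable Z (br b z kz ∅)
          cap₀ : Cap U 0
          cap₀ = cap-less z≤n cap
          pre : Fin I → Fin n → Bool
          pre i u = E s p (ww i) ∧ E (sg i) (vv i) u
          avg : ∀ i → ∑ (λ u → χ (Γ u) * gate (pre i u) v₂) ≤ cnt Γ * gate (E s p (ww i)) v₁
          avg i with E s p (ww i)
          ... | false = ≤-reflexive (∑-*ʳ M _)
          ... | true = gate-avg Γ (E (sg i) (vv i)) M≡₁ M≡₂ (often U s p cap₀ (sg i) (vv i))
          Goal = Seeded X W U p (br s x (br b z kz ∅) r) (λ i → ini i p (br s x (br b z kz ∅) r))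
          first : (∃ λ u → Γ u ≡ true × ∑ (λ i → W i * (v₀ ^ mz * ini i p r) * gate (pre i u) v₂) ≤ ∑ (λ i → W i * (v₀ ^ mz * ini i p r) * gate (E s p (ww i)) v₁)) → Goal
          first (u , h , le) = second (choose Γ′ (λ i → W i * (v₀ ^ mz * ini i p r)) (λ i u′ → val i u′) (λ i → gate (pre i u) v₂) (some (U ∖ u) b u cap₁) avg′)
            where
            Uu = proj₁ (∧-true h)
            Γ′ = candidates (U ∖ u) b u
            cap′ : Cap (U ∖ u) (suc (size kz + 0) + size r)
            cap′ = cap-∖ {U} {u} Uu cap
            cap₁ : Cap (U ∖ u) 0
            cap₁ = cap-less z≤n cap′
            val : Fin I → Fin n → ℕ
            val i u′ = gate (E s p (ww i) ∧ (E (sg i) (vv i) u ∧ E b (ww i) u′)) v₃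
            avg′ : ∀ i → ∑ (λ u′ → χ (Γ′ u′) * val i u′) ≤ cnt Γ′ * gate (pre i u) v₂
            avg′ i with E s p (ww i) | E (sg i) (vv i) u
            ... | false | _ = ≤-reflexive (∑-*ʳ M _)
            ... | true | false = ≤-reflexive (∑-*ʳ M _)
            ... | true | true = gate-avg Γ′ (E b (ww i)) M≡₂ M≡₃ (often (U ∖ u) b u cap₁ b (ww i))
            second : (∃ λ u′ → Γ′ u′ ≡ true × ∑ (λ i → W i * (v₀ ^ mz * ini i p r) * val i u′) ≤ ∑ (λ i → W i * (v₀ ^ mz * ini i p r) * gate (pre i u) v₂)) → Goal
            second (u′ , h′ , le′) = third (plant-Y kz u′ (U ∖ u ∖ u′) (λ i → W i * ini i p r * val i u′) bkz (cap-less (≤-trans (m≤m+n _ 0) (m≤m+n _ _)) cap₂))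
              where
              Uu′ : (U ∖ u) u′ ≡ true
              Uu′ = proj₁ (∧-true h′)
              cap₂ : Cap (U ∖ u ∖ u′) (size kz + 0 + size r)
              cap₂ = cap-∖ {U ∖ u} {u′} Uu′ cap′
              third : Seeded Y (λ i → W i * ini i p r * val i u′) (U ∖ u ∖ u′) u′ kz (λ i → v₀ ^ movable Y kz) → Goal
              third (seeded {U₁} ε leε) = fourth (plant-X r p U₁ (λ i → W i * val i u′ * fin Y i ε) brr
                                            (cap-Emb (size r) ε (subst (λ m → Cap (U ∖ u ∖ u′) (m + size r)) (+-identityʳ (size kz)) cap₂)))
                where
                fourth : Seeded X (λ i → W i * val i u′ * fin Y i ε) U₁ p r (λ i → ini i p r) → Goal
                fourth (seeded δ leδ) = seeded (br u Uu (proj₂ (∧-true {U u} h)) (br u′ Uu′ (proj₂ (∧-true {(U ∖ u) u′} h′)) ε ∅) δ) (begin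
                  ∑ (λ i → W i * (val i u′ * ((1 * (fin Y i ε * 1)) * fin X i δ)))      ≡⟨ ∑-cong (λ i → ar₁ (W i) (val i u′) (fin Y i ε) (fin X i δ)) ⟩
                  ∑ (λ i → W i * val i u′ * fin Y i ε * fin X i δ)                      ≤⟨ leδ ⟩
                  ∑ (λ i → W i * val i u′ * fin Y i ε * ini i p r)                      ≡⟨ ∑-cong (λ i → ar₂ (W i) (val i u′) (fin Y i ε) (ini i p r)) ⟩
                  ∑ (λ i → W i * ini i p r * val i u′ * fin Y i ε)                      ≤⟨ leε ⟩
                  ∑ (λ i → W i * ini i p r * val i u′ * v₀ ^ movable Y kz)              ≡⟨ ∑-cong (λ i → trans (ar₃ (W i) (ini i p r) (val i u′) (v₀ ^ movable Y kz)) (cong (λ m → W i * (v₀ ^ m * ini i p r) * val i u′) (sym (+-identityʳ (movable Y kz))))) ⟩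
                  ∑ (λ i → W i * (v₀ ^ mz * ini i p r) * val i u′)                      ≤⟨ ≤-trans le′ le ⟩
                  ∑ (λ i → W i * (v₀ ^ mz * ini i p r) * gate (E s p (ww i)) v₁)        ≡⟨ ∑-cong (λ i → ar₄ (W i) (v₀ ^ mz) (ini i p r) (gate (E s p (ww i)) v₁)) ⟩
                  ∑ (λ i → W i * (gate (E s p (ww i)) v₁ * (v₀ ^ mz * ini i p r)))      ∎)
                  where
                  ar₁ : ∀ w a b c → w * (a * ((1 * (b * 1)) * c)) ≡ w * a * b * c
                  ar₁ = solve-∀
                  ar₂ : ∀ w a b c → w * a * b * c ≡ w * c * a * b
                  ar₂ = solve-∀
                  ar₃ : ∀ w a b c → w * a * b * c ≡ w * (c * a) * b
                  ar₃ = solve-∀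
                  ar₄ : ∀ w a b c → w * (a * b) * c ≡ w * (c * (a * b))
                  ar₄ = solve-∀
        plant-X (br s x k@(br _ _ _ (br _ _ _ _)) r) p U W (k≤ , bk , brr) cap = plant-X-high s x k r p U W refl bk brr cap

        plant-X-high s x k r p U W high bk brr cap = first (cnt-pos (candidates U s p) (some U s p (cap-less z≤n cap)))
          where
          Goal = Seeded X W U p (br s x k r) (λ i → ini i p (br s x k r))
          first : (∃ λ u → candidates U s p u ≡ true) → Goal
          first (u , h) = second (plant-Z k u (U ∖ u) (λ i → W i * ini i p r) bk (cap-less (m≤m+n _ _) cap′))
            where
            Uu = proj₁ (∧-true h)
            cap′ : Cap (U ∖ u) (size k + size r)
            cap′ = cap-∖ {U} {u} Uu cap
            second : Seeded Z (λ i → W i * ini i p r) (U ∖ u) u k (λ i → v₀ ^ movable Z k) → Goal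
            second (seeded {U₁} ε leε) = third (plant-X r p U₁ (λ i → W i * fin Z i ε) brr (cap-Emb (size r) ε cap′))
              where
              third : Seeded X (λ i → W i * fin Z i ε) U₁ p r (λ i → ini i p r) → Goal
              third (seeded δ leδ) = seeded (br u Uu (proj₂ (∧-true {U u} h)) ε δ) (begin
                ∑ (λ i → W i * fin X i (br {s = s} {x} u Uu (proj₂ (∧-true {U u} h)) ε δ))
                  ≡⟨ ∑-cong (λ i → trans (cong (λ l → W i * ((if l then gate (good i s p u u ε) v₃ else 1) * (fin Z i ε * fin X i δ))) high) (ar₁ (W i) (fin Z i ε) (fin X i δ))) ⟩
                ∑ (λ i → W i * fin Z i ε * fin X i δ)                         ≤⟨ leδ ⟩
                ∑ (λ i → W i * fin Z i ε * ini i p r)                         ≡⟨ ∑-cong (λ i → ar₂ (W i) (fin Z i ε) (ini i p r)) ⟩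
                ∑ (λ i → W i * ini i p r * fin Z i ε)                         ≤⟨ leε ⟩
                ∑ (λ i → W i * ini i p r * v₀ ^ movable Z k)                  ≡⟨ ∑-cong (λ i → trans (cong (λ l → W i * ((if l then gate (E s p (ww i)) v₁ else 1) * (v₀ ^ movable Z k * ini i p r))) high) (ar₃ (W i) (ini i p r) (v₀ ^ movable Z k))) ⟨
                ∑ (λ i → W i * ini i p (br s x k r))                          ∎)
                where
                ar₁ : ∀ w a b → w * (1 * (a * b)) ≡ w * a * b
                ar₁ = solve-∀
                ar₂ : ∀ w a b → w * a * b ≡ w * b * a
                ar₂ = solve-∀
                ar₃ : ∀ w a b → w * (1 * (b * a)) ≡ w * a * b
                ar₃ = solve-∀

      prod : Map → Fin I → List (XItem n) → ℕ
      prod f i [] = 1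
      prod f i (it ∷ its) = gate (hit f (sg i) (vv i) (ww i) it) v₃ * prod f i its

      prod-++ : ∀ f i xs ys → prod f i (xs ++ ys) ≡ prod f i xs * prod f i ys
      prod-++ f i [] ys = sym (*-identityˡ _)
      prod-++ f i (it ∷ xs) ys = trans (cong (gate (hit f (sg i) (vv i) (ww i) it) v₃ *_) (prod-++ f i xs ys)) (sym (*-assoc (gate (hit f (sg i) (vv i) (ww i) it) v₃) _ _))

      prod-hits : ∀ f i its → prod f i its * M ^ hits f (sg i) (vv i) (ww i) its ≡ v₃ ^ hits f (sg i) (vv i) (ww i) its * M ^ length its
      prod-hits f i [] = refl
      prod-hits f i (it ∷ its) with hit f (sg i) (vv i) (ww i) it
      ... | true = trans (ar v₃ (prod f i its) M (M ^ h)) (trans (cong (v₃ * M *_) (prod-hits f i its)) (ar₂ v₃ M (v₃ ^ h) (M ^ length its)))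
        where
        h = hits f (sg i) (vv i) (ww i) its
        ar : ∀ v p M m → v * p * (M * m) ≡ v * M * (p * m)
        ar = solve-∀
        ar₂ : ∀ v M p q → v * M * (p * q) ≡ v * p * (M * q)
        ar₂ = solve-∀
      ... | false = trans (*-assoc M (prod f i its) _) (trans (cong (M *_) (prod-hits f i its)) (ar M (v₃ ^ hits f (sg i) (vv i) (ww i) its) (M ^ length its)))
        where
        ar : ∀ M p q → M * (p * q) ≡ p * (M * q)
        ar = solve-∀

      headok-tail : ∀ f i {U u k U′} (ε : Emb U u k U′) → Agree f ε → headok i ε ≡ tail f (ww i) (hook k)
      headok-tail f i ∅ _ = refl
      headok-tail f i (br {s = b} u _ _ _ _) (fz , _) = cong (E b (ww i)) (sym fz)

      -- Reads the estimator off the final map, so that it can be compared with the number of hits.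
      fin-prod : ∀ c f i {U p t U′} (ε : Emb U p t U′) q → f q ≡ p → Agree f ε → fin c i ε ≡ prod f i (items c q t)
      fin-prod c f i ∅ q _ _ = refl
      fin-prod c f i (br {p = p} {s} {x} {k} {r} u _ _ ε δ) q fq (fx , a , b) = begin
        (if own c k then gate (good i s p u u ε) v₃ else 1) * (fin (next c) i ε * fin c i δ)
          ≡⟨ cong₂ _*_ (top-own (own c k)) (cong₂ _*_ (fin-prod (next c) f i ε x fx a) (fin-prod c f i δ q fq b)) ⟩
        prod f i (ownItem (own c k) (xitem s q x (hook k))) * (prod f i (items (next c) x k) * prod f i (items c q r))
          ≡⟨ trans (prod-++ f i (ownItem (own c k) (xitem s q x (hook k))) _) (cong (prod f i (ownItem (own c k) (xitem s q x (hook k))) *_) (prod-++ f i (items (next c) x k) _)) ⟨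
        prod f i (items c q (br s x k r)) ∎
        where
        open ≡-Reasoning
        top-own : ∀ o → (if o then gate (good i s p u u ε) v₃ else 1) ≡ prod f i (ownItem o (xitem s q x (hook k)))
        top-own false = refl
        top-own true = trans (cong (λ g → gate g v₃) (cong₂ _∧_ (cong (λ z → E s z (ww i)) (sym fq)) (cong₂ _∧_ (cong (E (sg i) (vv i)) (sym fx)) (headok-tail f i ε a)))) (sym (*-identityʳ _))

    -- The switching phase

    module Finish (its : List (XItem n)) where

      open XItem

      -- The edges at a movable vertex are exactly those its item records, and neither its parent
      -- nor its child is itself movable; so a move can be checked on its own item and leaves the
      -- other items intact.
      record Movable : Set where
        field
          valid-out : ∀ {it} → it ∈ its → ∀ u → eT (at it) u ≡ true → u ≡ above it × sign it ≡ false ⊎ below it ≡ just (true , u)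
          valid-in  : ∀ {it} → it ∈ its → ∀ u → eT u (at it) ≡ true → u ≡ above it × sign it ≡ true ⊎ below it ≡ just (false , u)
          above≢    : ∀ {it it′} → it ∈ its → it′ ∈ its → above it ≢ at it′
          below≢    : ∀ {it it′} → it ∈ its → it′ ∈ its → ∀ b z → below it ≡ just (b , z) → z ≢ at it′
          once      : ∀ y → atCount y its ≤ 1

      record Placed (done : Pool) : Set where
        field
          at-done    : ∀ {it} → it ∈ its → done (at it) ≡ true
          above-done : ∀ {it} → it ∈ its → done (above it) ≡ true
          below-done : ∀ {it} → it ∈ its → ∀ b z → below it ≡ just (b , z) → done z ≡ true

      placed-mono : ∀ {done done⁺} → (∀ y → done y ≡ true → done⁺ y ≡ true) → Placed done → Placed done⁺
      placed-mono h pl = record { at-done = λ m → h _ (at-done m) ; above-done = λ m → h _ (above-done m) ; below-done = λ m b z eq → h z (below-done m b z eq) }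
        where open Placed pl

      hits-agree : ∀ {f g done} → Placed done → (∀ y → done y ≡ true → g y ≡ f y) → ∀ s v w → hits g s v w its ≡ hits f s v w its
      hits-agree {f} {g} pl h s v w = go its (λ m → m)
        where
        open Placed pl
        tails : ∀ m → (∀ b z → m ≡ just (b , z) → g z ≡ f z) → tail g w m ≡ tail f w m
        tails nothing _ = refl
        tails (just (b , z)) e = cong (E b w) (e b z refl)
        go : ∀ xs → (∀ {it} → it ∈ xs → it ∈ its) → hits g s v w xs ≡ hits f s v w xs
        go [] sub = refl
        go (it ∷ xs) sub = cong₂ _+_ (cong χ (cong₂ _∧_ (cong (λ z → E (sign it) z w) (h _ (above-done (sub (here refl)))))
            (cong₂ _∧_ (cong (E s v) (h _ (at-done (sub (here refl))))) (tails (below it) λ b z eq → h z (below-done (sub (here refl)) b z eq)))))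
          (go xs λ m → sub (there m))

      -- The other items mention neither the moved vertex nor its old image, so only the item of the
      -- moved vertex can stop being a hit.
      hits-move : Movable → ∀ f {it₀} → it₀ ∈ its → ∀ u s v w → hits f s v w its ≤ hits (f [ at it₀ ↦ u ]) s v w its + 1
      hits-move mv f {it₀} m₀ u s v w = ≤-trans (go its (λ m → m)) (+-monoʳ-≤ _ (once x₀))
        where
        open Movable mv
        x₀ = at it₀
        g : Map
        g = f [ x₀ ↦ u ]
        tails : ∀ m → (∀ b z → m ≡ just (b , z) → z ≢ x₀) → tail g w m ≡ tail f w m
        tails nothing _ = refl
        tails (just (b , z)) e = cong (E b w) (↦-off f u (e b z refl))
        unmoved : ∀ {it} → it ∈ its → at it ≢ x₀ → hit g s v w it ≡ hit f s v w it
        unmoved {it} m ne = cong₂ _∧_ (cong (λ z → E (sign it) z w) (↦-off f u (above≢ m m₀)))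
                              (cong₂ _∧_ (cong (E s v) (↦-off f u ne)) (tails (below it) (below≢ m m₀)))
        each : ∀ it → it ∈ its → χ (hit f s v w it) ≤ χ (hit g s v w it) + χ (at it == x₀)
        each it m = by (at it ≟ x₀)
          where
          by : (d : Dec (at it ≡ x₀)) → χ (hit f s v w it) ≤ χ (hit g s v w it) + χ ⌊ d ⌋
          by (yes _) = ≤-trans (χ≤1 (hit f s v w it)) (m≤n+m 1 _)
          by (no ne) = ≤-trans (≤-reflexive (cong χ (sym (unmoved m ne)))) (m≤m+n _ 0)
        go : ∀ xs → (∀ {it} → it ∈ xs → it ∈ its) → hits f s v w xs ≤ hits g s v w xs + atCount x₀ xs
        go [] sub = z≤n
        go (it ∷ xs) sub = ≤-trans (+-mono-≤ (each it (sub (here refl))) (go xs λ m → sub (there m))) (≤-reflexive (ar (χ (hit g s v w it)) _ (hits g s v w xs) _))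
          where
          ar : ∀ a b c d → a + b + (c + d) ≡ a + c + (b + d)
          ar = solve-∀

      find-hit : ∀ f s v w xs → 1 ≤ hits f s v w xs → ∃ λ it → it ∈ xs × hit f s v w it ≡ true
      find-hit f s v w (it ∷ xs) h with hit f s v w it in eq
      ... | true = it , here refl , eq
      ... | false with find-hit f s v w xs h
      ...   | it′ , m , e = it′ , there m , e

      module Switch (mv : Movable) {f done U work} (inv : Inv f done U work) {it} (m : it ∈ its) (x₀-done : done (at it) ≡ true) (w : Fin n) (Uw : U w ≡ true)
               (up : E (sign it) (f (above it)) w ≡ true) (down : tail f w (below it) ≡ true) where

        open Movable mv
        open Inv inv

        x₀ u₀ : Fin n
        x₀ = at it
        u₀ = f x₀

        swapped : Pool
        swapped u = (u == u₀) ∨ (U ∖ w) u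

        w≢ : ∀ y → done y ≡ true → w ≢ f y
        w≢ y d eq = true≢false (subst (λ z → U z ≡ true) eq Uw) (fresh y d)

        swapped∖ : ∀ u → (swapped ∖ u₀) u ≡ (U ∖ w) u
        swapped∖ u with u ≟ u₀
        ... | no _ = ∧-true-right (U u ∧ not (u == w))
          where
          ∧-true-right : ∀ b → b ∧ true ≡ b
          ∧-true-right true = refl
          ∧-true-right false = refl
        ... | yes eq = sym (cong (_∧ not (u == w)) (trans (cong U eq) (fresh x₀ x₀-done)))

        cnt-swapped : cnt swapped ≡ cnt U
        cnt-swapped = trans (cnt-∖ swapped u₀ in-u₀) (trans (cong suc (∑-cong λ u → cong χ (swapped∖ u))) (sym (cnt-∖ U w Uw)))
          where
          in-u₀ : swapped u₀ ≡ true
          in-u₀ rewrite ==-refl u₀ = refl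

        move : Inv (f [ x₀ ↦ w ]) done swapped work
        move = record { cover = cover ; edges = edges′ ; par = par ; inj = inj′ ; fresh = fresh′ ; count = trans cnt-swapped count }
          where
          f′ : Map
          f′ = f [ x₀ ↦ w ]
          above-kept : f′ (above it) ≡ f (above it)
          above-kept = ↦-off f w (above≢ m m)
          at-kept : f′ x₀ ≡ w
          at-kept = ↦-at f x₀ w
          lower : ∀ b z → below it ≡ just (b , z) → E b w (f′ z) ≡ true
          lower b z eq = subst (λ y → E b w y ≡ true) (sym (↦-off f w (below≢ m m b z eq))) (go (below it) eq down)
            where
            go : ∀ k → k ≡ just (b , z) → tail f w k ≡ true → E b w (f z) ≡ true
            go _ refl h = h
          edges′ : ∀ x y → eT x y ≡ true → Good f′ done x y ⊎ Pending work x y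
          edges′ x y xy with edges x y xy
          ... | inj₂ p = inj₂ p
          ... | inj₁ (dx , dy , e) = inj₁ (dx , dy , by (x ≟ x₀) (y ≟ x₀))
            where
            out : y ≡ above it × sign it ≡ false ⊎ below it ≡ just (true , y) → E true w (f′ y) ≡ true
            out (inj₁ (refl , sg)) = subst (λ b → E true w b ≡ true) (sym above-kept)
              (trans (sym (E-flip true (f (above it)) w)) (subst (λ s → E s (f (above it)) w ≡ true) sg up))
            out (inj₂ eq) = lower true y eq
            into : x ≡ above it × sign it ≡ true ⊎ below it ≡ just (false , x) → E true (f′ x) w ≡ true
            into (inj₁ (refl , sg)) = subst (λ a → E true a w ≡ true) (sym above-kept) (subst (λ s → E s (f (above it)) w ≡ true) sg up)
            into (inj₂ eq) = trans (sym (E-flip true w (f′ x))) (lower false x eq)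
            by : Dec (x ≡ x₀) → Dec (y ≡ x₀) → E true (f′ x) (f′ y) ≡ true
            by (no nx) (no ny) = subst₂ (λ a b → E true a b ≡ true) (sym (↦-off f w nx)) (sym (↦-off f w ny)) e
            by (yes eq) _ = subst (λ a → E true a (f′ y) ≡ true) (sym (trans (cong f′ eq) at-kept)) (out (valid-out m y (subst (λ z → eT z y ≡ true) eq xy)))
            by (no nx) (yes eq) = subst (λ a → E true (f′ x) a ≡ true) (sym (trans (cong f′ eq) at-kept)) (into (valid-in m x (subst (λ z → eT x z ≡ true) eq xy)))
          inj′ : ∀ x y → done x ≡ true → done y ≡ true → f′ x ≡ f′ y → x ≡ y
          inj′ x y dx dy eq = by (x ≟ x₀) (y ≟ x₀)
            where
            by : Dec (x ≡ x₀) → Dec (y ≡ x₀) → x ≡ y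
            by (yes a) (yes b) = trans a (sym b)
            by (yes a) (no b) = contradiction (trans (sym at-kept) (trans (cong f′ (sym a)) (trans eq (↦-off f w b)))) (w≢ y dy)
            by (no a) (yes b) = contradiction (trans (sym at-kept) (trans (cong f′ (sym b)) (trans (sym eq) (↦-off f w a)))) (w≢ x dx)
            by (no a) (no b) = inj x y dx dy (trans (sym (↦-off f w a)) (trans eq (↦-off f w b)))
          off : ∀ u → u ≢ u₀ → (U ∖ w) u ≡ false → swapped u ≡ false
          off u ne h rewrite ==-≢ ne = h
          fresh′ : ∀ x → done x ≡ true → swapped (f′ x) ≡ false
          fresh′ x dx = by (x ≟ x₀)
            where
            by : Dec (x ≡ x₀) → swapped (f′ x) ≡ false
            by (yes eq) = subst (λ z → swapped z ≡ false) (sym (trans (cong f′ eq) at-kept)) (off w (w≢ x₀ x₀-done) (∖-self U w))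
            by (no nx) = subst (λ z → swapped z ≡ false) (sym (↦-off f w nx))
              (off (f x) (λ eq → nx (inj x x₀ dx x₀-done eq)) (cong (_∧ not (f x == w)) (fresh x dx)))

      drop-empty : ∀ {f done U q work} → Inv f done U ((q , ∅) ∷ work) → Inv f done U work
      drop-empty {f} {done} {U} {q} {work} inv = record { cover = cover ; edges = edges′ ; par = tailAll par ; inj = inj ; fresh = fresh ; count = count }
        where
        open Inv inv
        tailAll : ∀ {P : Item n → Set} {a as} → All P (a ∷ as) → All P as
        tailAll (_ ∷ ps) = ps
        edges′ : ∀ x y → eT x y ≡ true → Good f done x y ⊎ Pending work x y
        edges′ x y xy with edges x y xy
        ... | inj₁ g = inj₁ g
        ... | inj₂ (inj₁ (there w)) = inj₂ (inj₁ w)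
        ... | inj₂ (inj₂ (there w)) = inj₂ (inj₂ w)

      Embedded : Set
      Embedded = ∃ λ (f : Map) → (∀ x y → f x ≡ f y → x ≡ y) × (∀ x y → eT x y ≡ true → E true (f x) (f y) ≡ true)

      Aside : List (Item n) → Set
      Aside = All (λ w → ∀ {it} → it ∈ its → proj₁ w ≢ at it)

      -- Each round embeds one vertex and costs every test at most one hit, so the number of hits
      -- never falls below the number of vertices left. The fuel counts sizes twice and items once:
      -- embedding a vertex adds one item but removes two from the sizes, and dropping an empty item
      -- also counts.
      finish : Movable → ∀ fuel {f done U work} → sizeW work + (sizeW work + length work) < fuel → Inv f done U work → Placed done → Aside work →
               (∀ s v w → sizeW work ≤ hits f s v w its) → Embedded
      finish mv (suc fuel) {f} {done} {U} {[]} lt inv pl aside rich = f , (λ x y → inj x y (all x) (all y)) , all-edges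
        where
        open Inv inv
        all : ∀ x → done x ≡ true
        all x with done x | cover x
        ... | true | _ = refl
        all-edges : ∀ x y → eT x y ≡ true → E true (f x) (f y) ≡ true
        all-edges x y xy with edges x y xy
        ... | inj₁ (_ , _ , e) = e
        ... | inj₂ (inj₁ ())
        ... | inj₂ (inj₂ ())
      finish mv (suc fuel) {work = (q , ∅) ∷ work} lt inv pl (_ ∷ aside) rich =
        finish mv fuel (≤-pred (subst (_≤ suc fuel) (ar (sizeW work) (length work)) lt)) (drop-empty inv) pl aside rich
        where
        ar : ∀ a b → 1 + (a + (a + (1 + b))) ≡ 1 + (1 + (a + (a + b)))
        ar = solve-∀
      finish mv (suc fuel) {f} {done} {U} {(q , br s x k r) ∷ work} lt inv pl (aq ∷ aside) rich =
        go (cnt-pos U (subst (0 <_) (sym (Inv.count inv)) (s≤s z≤n)))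
        where
        go : (∃ λ w → U w ≡ true) → Embedded
        go (w , Uw) = go₂ (find-hit f s (f q) w its (≤-trans (s≤s z≤n) (rich s (f q) w)))
          where
          go₂ : (∃ λ it → it ∈ its × hit f s (f q) w it ≡ true) → Embedded
          go₂ (it , m , h) with ∧-true {E (sign it) (f (above it)) w} h
          ... | up , h′ with ∧-true {E s (f q) (f (at it))} h′
          ...   | new-edge , down = finish mv fuel measure X.extend (placed-mono X.done⁺-old pl) ((λ m′ → x-new m′) ∷ (aq ∷ aside)) rich′
            where
            x₀-done = Placed.at-done pl m
            inv′ = Switch.move mv inv m x₀-done w Uw up down
            f′ : Map
            f′ = f [ at it ↦ w ]
            V : Pool
            V = Switch.swapped mv inv m x₀-done w Uw up down
            u₀-in : V (f (at it)) ≡ true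
            u₀-in rewrite ==-refl (f (at it)) = refl
            ε : Emb V (f′ q) (br s x ∅ ∅) (V ∖ f (at it))
            ε = br (f (at it)) u₀-in (subst (λ z → E s z (f (at it)) ≡ true) (sym (↦-off f w (aq m))) new-edge) ∅ ∅
            module X = Extend inv′ (single q s x k r) ε
            x-new : ∀ {it′} → it′ ∈ its → x ≢ at it′
            x-new {it′} m′ eq = true≢false (Placed.at-done pl m′) (subst (λ z → done z ≡ false) eq (X.new x (occ-top s x ∅ ∅)))
            measure : sizeW ((x , k) ∷ (q , r) ∷ work) + (sizeW ((x , k) ∷ (q , r) ∷ work) + suc (suc (length work))) < fuel
            measure = ≤-pred (subst (_≤ suc fuel) (ar (size k) (size r) (sizeW work) (length work)) lt)
              where
              ar : ∀ a b c l → 1 + (1 + (a + b) + c + (1 + (a + b) + c + (1 + l))) ≡ 1 + (1 + (a + (b + c) + (a + (b + c) + (1 + (1 + l)))))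
              ar = solve-∀
            rich′ : ∀ s′ v w′ → size k + (size r + sizeW work) ≤ hits X.f⁺ s′ v w′ its
            rich′ s′ v w′ = subst (size k + (size r + sizeW work) ≤_) (sym (hits-agree pl X.f⁺-old s′ v w′))
              (+-cancelʳ-≤ 1 _ _ (≤-trans (≤-reflexive (ar (size k) (size r) (sizeW work))) (≤-trans (rich s′ v w′) (hits-move mv f m w s′ v w′))))
              where
              ar : ∀ a b c → a + (b + c) + 1 ≡ 1 + (a + b) + c
              ar = solve-∀

    -- Putting the phases together

    module Assembly (tree : IsOrientedTree T) {a Δ l h μ D : ℕ} (scales : Scales a Δ n l h μ D)
      (deg : ∀ s v → (suc a + 2) * n ≤ 2 * (suc a * cnt (E s v))) (Δ-bound : ∀ x → undDeg T x ≤ Δ) where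

      open Scales scales

      open TreeForest T tree

      n>0 : 0 < n
      n>0 = ≤-trans (*-mono-≤ (≤-trans (s≤s (z≤n {0})) (m≤n+m 1 (2 * A))) (≤-trans μ>0 (≤-trans (m≤m+n μ (μ + 0)) (m≤m+n (2 * μ) h)))) roomy

      I : ℕ
      I = 2 * (n * n)

      sign-of : Fin 2 → Bool
      sign-of zero = true
      sign-of (suc _) = false

      code : Bool → Fin 2
      code true = zero
      code false = suc zero

      sg : Fin I → Bool
      sg i = sign-of (proj₁ (remQuot {2} (n * n) i))

      vv ww : Fin I → Fin n
      vv i = proj₁ (remQuot {n} n (proj₂ (remQuot {2} (n * n) i)))
      ww i = proj₂ (remQuot {n} n (proj₂ (remQuot {2} (n * n) i)))

      index : ∀ s v w → ∃ λ i → sg i ≡ s × vv i ≡ v × ww i ≡ w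
      index s v w = combine (code s) (combine v w) ,
        trans (cong (sign-of ∘ proj₁) eq) (decode s) ,
        trans (cong (λ p → proj₁ (remQuot {n} n (proj₂ p))) eq) (cong proj₁ (remQuot-combine v w)) ,
        trans (cong (λ p → proj₂ (remQuot {n} n (proj₂ p))) eq) (cong proj₂ (remQuot-combine v w))
        where
        eq : remQuot {2} (n * n) (combine (code s) (combine v w)) ≡ (code s , combine v w)
        eq = remQuot-combine (code s) (combine v w)
        decode : ∀ s → sign-of (code s) ≡ s
        decode true = refl
        decode false = refl

      open Seed sg vv ww a Δ d₃ n>0 using (prod; prod-hits; fin-prod; Cap; cap-less; cap-Emb; fin; ini; ini-avg; Often; choose; v₀; v₃; M; M≡₀; M≡₃; module Plant)

      dense : Dense A (λ _ → true)
      dense s v = subst (λ m → (A + 2) * m ≤ 2 * (A * cnt (E s v))) (sym (cnt-true n)) (deg s v)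

      open Plant dense

      all : Pool
      all _ = true

      record Rooted (c : Class) (t : Forest n) : Set where
        field
          u₀   : Fin n
          {U′} : Pool
          ε    : Emb (all ∖ u₀) u₀ t U′
          le   : ∑ (λ i → fin c i ε) ≤ I * v₀ ^ movable c t

      cnt-all∖ : ∀ u → n ≡ suc (cnt (all ∖ u))
      cnt-all∖ u = trans (sym (cnt-true n)) (cnt-∖ all u refl)

      start-cap : ∀ {m} u → A * suc m ≤ n → Cap (all ∖ u) m
      start-cap {m} u le = begin
        A * (n + m)                             ≡⟨ cong (λ z → A * (z + m)) (cnt-all∖ u) ⟩
        A * (suc (cnt (all ∖ u)) + m)           ≡⟨ ar A (cnt (all ∖ u)) m ⟩
        A * suc m + A * cnt (all ∖ u)           ≤⟨ +-monoˡ-≤ (A * cnt (all ∖ u)) le ⟩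
        n + A * cnt (all ∖ u)                   ∎
        where
        open ≤-Reasoning
        ar : ∀ A c m → A * (1 + c + m) ≡ A * (1 + m) + A * c
        ar = solve-∀

      some-vertex : Fin n
      some-vertex = proj₁ (cnt-pos all (subst (0 <_) (sym (cnt-true n)) n>0))

      plant-root : ∀ c t → roots t ≤ Δ → Bounded Δ t → A * suc (size t) ≤ n → Rooted c t
      plant-root c t roots≤ bd le = go c
        where
        ones : Fin I → ℕ
        ones _ = 1
        total : ∀ (g : Fin I → ℕ) → ∑ (λ i → ones i * g i) ≡ ∑ g
        total g = ∑-cong λ i → *-identityˡ (g i)
        ideal : ∀ m → ∑ (λ i → ones i * v₀ ^ m) ≡ I * v₀ ^ m
        ideal m = trans (total (λ _ → v₀ ^ m)) (∑-const I (v₀ ^ m))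
        from : ∀ c u₀ → Seeded c ones (all ∖ u₀) u₀ t (λ _ → v₀ ^ movable c t) → Rooted c t
        from c u₀ (seeded ε le) = record { u₀ = u₀ ; ε = ε ; le = subst₂ _≤_ (total (λ i → fin c i ε)) (ideal (movable c t)) le }
        often-all : ∀ i s → Often all (λ u → E s u (ww i))
        often-all i s = *-cancelˡ-≤ 2 (begin
          2 * cnt all                                 ≤⟨ *-monoˡ-≤ (cnt all) (m≤n+m 2 A) ⟩
          (A + 2) * cnt all                           ≤⟨ dense (not s) (ww i) ⟩
          2 * (A * cnt (λ u → true ∧ E (not s) (ww i) u))   ≡⟨ cong (λ m → 2 * (A * m)) (flip-cnt all s (ww i)) ⟩
          2 * (A * cnt (λ u → true ∧ E s u (ww i)))   ∎)
          where open ≤-Reasoning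
        go : ∀ c → Rooted c t
        go Y = from Y some-vertex (plant-Y t some-vertex (all ∖ some-vertex) ones bd (start-cap some-vertex le))
        go Z = from Z some-vertex (plant-Z t some-vertex (all ∖ some-vertex) ones bd (start-cap some-vertex le))
        -- With class `X` at the top the cut vertex v acts as their `Y` parent, so its own image
        -- must be chosen by averaging; for the other classes any vertex will do.
        go X = choose-root (choose all ones (λ i u → ini i u t) (λ i → v₀ ^ movable X t) (subst (0 <_) (sym (cnt-true n)) n>0)
                             (λ i → ini-avg all i t roots≤ (often-all i)))
          where
          choose-root : (∃ λ u → true ≡ true × ∑ (λ i → ones i * ini i u t) ≤ ∑ (λ i → ones i * v₀ ^ movable X t)) → Rooted X t
          choose-root (u₀ , _ , le₀) = finish-root (plant-X t u₀ (all ∖ u₀) ones bd (start-cap u₀ le))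
            where
            finish-root : Seeded X ones (all ∖ u₀) u₀ t (λ i → ini i u₀ t) → Rooted X t
            finish-root (seeded ε leε) = from X u₀ (seeded ε (≤-trans leε le₀))

      Copy : Set
      Copy = ∃ λ (f : Map) → (∀ x y → f x ≡ f y → x ≡ y) × (∀ x y → eT x y ≡ true → E true (f x) (f y) ≡ true)

      module _ {v : Fin n} {t₁ t₂ : Forest n} (rep : Rep v (t₁ ⊕ t₂)) (μ≤ : μ ≤ size t₁) (<2μ : size t₁ < 2 * μ) where

        open Rep rep

        label : ∀ y → χ (v == y) + (occ t₁ y + occ t₂ y) ≡ 1
        label y = trans (cong (χ (v == y) +_) (sym (occ-⊕ t₁ t₂ y))) (occ≡ y)

        simple₁ : ∀ y → occ t₁ y ≤ 1
        simple₁ y = ≤-trans (≤-trans (m≤m+n _ (occ t₂ y)) (m≤n+m _ (χ (v == y)))) (≤-reflexive (label y))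

        simple₂ : ∀ y → occ t₂ y ≤ 1
        simple₂ y = ≤-trans (≤-trans (m≤n+m _ (occ t₁ y)) (m≤n+m _ (χ (v == y)))) (≤-reflexive (label y))

        v∉ : occ t₁ v + occ t₂ v ≡ 0
        v∉ = Data.Nat.Properties.suc-injective (trans (cong (λ b → χ b + (occ t₁ v + occ t₂ v)) (sym (==-refl v))) (label v))

        v∉₁ : occ t₁ v ≡ 0
        v∉₁ = m+n≡0⇒m≡0 (occ t₁ v) v∉

        apart : ∀ y → 1 ≤ occ t₁ y → 1 ≤ occ t₂ y → ⊥
        apart y a b = <⇒≱ (+-mono-≤ a b) (≤-trans (m≤n+m _ (χ (v == y))) (≤-reflexive (label y)))

        edge₁ : ∀ s p y → EdgeOf s p y v t₁ → undAdj T p y ≡ true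
        edge₁ s p y e = edge-und rep s p y (⊕-EdgeOfˡ t₂ e)

        edge₂ : ∀ s p y → EdgeOf s p y v t₂ → undAdj T p y ≡ true
        edge₂ s p y e = edge-und rep s p y (⊕-EdgeOfʳ t₁ e)

        roots₁ : roots t₁ ≤ Δ
        roots₁ = ≤-trans (roots≤deg v t₁ simple₁ edge₁) (Δ-bound v)

        roots₂ : roots t₂ ≤ Δ
        roots₂ = ≤-trans (roots≤deg v t₂ simple₂ edge₂) (Δ-bound v)

        sizes : suc (size t₁ + size t₂) ≡ n
        sizes = trans (cong suc (sym (size-⊕ t₁ t₂))) (rep-size rep)

        open Cut {n} L

        load₂ : size (prune t₂) ≤ h
        load₂ = ≤-trans (≤-reflexive (size-prune t₂)) (≤-trans (load≤ t₂) (≤-trans (*-monoˡ-≤ L roots₂) small))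

        used : ℕ
        used = suc (size t₁ + size (prune t₂))

        used-small : (2 * A + 1) * used ≤ n
        used-small = ≤-trans (*-monoʳ-≤ (2 * A + 1) (+-mono-≤ <2μ load₂)) roomy

        A-used : A * used ≤ n
        A-used = ≤-trans (*-monoˡ-≤ used (≤-trans (m≤m+n A (A + 0)) (m≤m+n (2 * A) 1))) used-small

        module Seeding (c : Class) (c-rich : size t₁ ≤ 6 * movable c t₁) (u₀ : Fin n) {U₁ : Pool} (ε : Emb (all ∖ u₀) u₀ t₁ U₁)
                       (ε-le : ∑ (λ i → fin c i ε) ≤ I * v₀ ^ movable c t₁) where

          its : List (XItem n)
          its = items c v t₁

          open Finish its hiding (module Switch)
          open XItem

          f₀ : Map
          f₀ _ = u₀

          done₀ : Pool
          done₀ y = v == y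

          inv₀ : Inv f₀ done₀ (all ∖ u₀) ((v , t₁) ∷ (v , t₂) ∷ [])
          inv₀ = record
            { cover = λ y → trans (cong (λ m → χ (v == y) + (occ t₁ y + m)) (+-identityʳ _)) (label y)
            ; edges = λ x y xy → inj₂ (pend (adj-edge rep x y xy))
            ; par = ==-refl v ∷ ==-refl v ∷ []
            ; inj = λ x y dx dy _ → trans (sym (==-≡ dx)) (==-≡ dy)
            ; fresh = λ x _ → ∖-self all u₀
            ; count = Data.Nat.Properties.suc-injective (trans (sym (cnt-all∖ u₀)) (trans (sym sizes) (cong (λ m → suc (size t₁ + m)) (sym (+-identityʳ _))))) }
            where
            side : ∀ {s p y} → EdgeOf s p y v (t₁ ⊕ t₂) → EdgeIn s p y ((v , t₁) ∷ (v , t₂) ∷ [])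
            side e with EdgeOf-⊕ t₁ t₂ e
            ... | inj₁ a = here a
            ... | inj₂ b = there (here b)
            pend : ∀ {x y} → EdgeOf true x y v (t₁ ⊕ t₂) ⊎ EdgeOf false y x v (t₁ ⊕ t₂) → Pending ((v , t₁) ∷ (v , t₂) ∷ []) x y
            pend (inj₁ e) = inj₁ (side e)
            pend (inj₂ e) = inj₂ (side e)

          module X₁ = Extend inv₀ (whole v t₁) ε

          f₁ : Map
          f₁ = X₁.f⁺

          inv₁ : Inv f₁ X₁.done⁺ U₁ ((v , t₂) ∷ [])
          inv₁ = X₁.extend

          -- One term of the estimator sum is at most the whole, so `few-hits` applies to each test.
          -- There are 2 n² tests, hence 2 l in place of l.
          hits₁ : ∀ s u w → h ≤ hits f₁ s u w its
          hits₁ s u w = go (index s u w)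
            where
            go : (∃ λ i → sg i ≡ s × vv i ≡ u × ww i ≡ w) → h ≤ hits f₁ s u w its
            go (i , refl , refl , refl) = few-hits I (2 * l) v₀ M v₃ d₃ (length its) h (hits f₁ (sg i) (vv i) (ww i) its) (prod f₁ i its)
                (trans M≡₀ (+-comm v₀ 1)) v₀>0 M≡₃ 2d₃≤M tests long (prod-hits f₁ i its)
                (subst₂ _≤_ (fin-prod c f₁ i ε v f₁v (put-agree f₀ ε simple₁)) (cong (λ m → I * v₀ ^ m) (sym (length-items c v t₁)))
                  (≤-trans (∑-≥ (λ i → fin c i ε) i) ε-le))
              where
              f₁v : f₁ v ≡ u₀
              f₁v = put-off f₀ ε v v∉₁
              2d₃≤M : 2 * d₃ ≤ M
              2d₃≤M = ≤-trans (≤-reflexive (cong (d₃ +_) (+-identityʳ d₃))) (m≤m+n (d₃ + d₃) (Δ * (2 * A)))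
              v₀>0 : 1 ≤ v₀
              v₀>0 = ≤-pred (subst (2 ≤_) (trans M≡₀ (+-comm v₀ 1)) (≤-trans (*-monoʳ-≤ 2 {1} {d₃} (s≤s z≤n)) 2d₃≤M))
              long : 2 * d₃ * h + v₀ * (2 * l) ≤ length its
              long = *-cancelˡ-≤ 6 (begin
                6 * (2 * d₃ * h + v₀ * (2 * l))    ≤⟨ *-monoʳ-≤ 6 (+-monoʳ-≤ (2 * d₃ * h) (*-monoˡ-≤ (2 * l) (m∸n≤m M 1))) ⟩
                6 * (2 * d₃ * h + M * (2 * l))     ≤⟨ rich ⟩
                μ                                  ≤⟨ μ≤ ⟩
                size t₁                            ≤⟨ c-rich ⟩
                6 * movable c t₁                   ≡⟨ cong (6 *_) (length-items c v t₁) ⟨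
                6 * length its                     ∎)
                where open ≤-Reasoning

          in-t₁ : ∀ {d y} → 1 ≤ occC d c t₁ y → 1 ≤ occ t₁ y
          in-t₁ {d} {y} le = ≤-trans le (≤-trans (class≤ d) (≤-reflexive (occC-total c t₁ y)))
            where
            class≤ : ∀ d → occC d c t₁ y ≤ occC Y c t₁ y + occC X c t₁ y + occC Z c t₁ y
            class≤ Y = ≤-trans (m≤m+n _ (occC X c t₁ y)) (m≤m+n _ (occC Z c t₁ y))
            class≤ X = ≤-trans (m≤n+m _ (occC Y c t₁ y)) (m≤m+n _ (occC Z c t₁ y))
            class≤ Z = m≤n+m _ _

          one-class : ∀ y → occC Y c t₁ y + occC X c t₁ y + occC Z c t₁ y ≤ 1
          one-class y = ≤-trans (≤-reflexive (occC-total c t₁ y)) (simple₁ y)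

          mv : Movable
          mv = record { valid-out = λ m u e → out m u (adj-edge rep _ u e) ; valid-in = λ m u e → into m u (adj-edge rep u _ e)
                      ; above≢ = above≢ ; below≢ = below≢ ; once = λ y → ≤-trans (atCount≤ y c v t₁) (≤-trans (≤-trans (m≤n+m _ (occC Y c t₁ y)) (m≤m+n _ (occC Z c t₁ y))) (one-class y)) }
            where
            at₁ : ∀ {it} → it ∈ its → 1 ≤ occ t₁ (at it)
            at₁ {it} m = in-t₁ {X} {at it} (item-at c v t₁ m)
            at≢v : ∀ {it} → it ∈ its → at it ≢ v
            at≢v m eq = <⇒≱ (subst (λ z → 1 ≤ occ t₁ z) eq (at₁ m)) (≤-reflexive v∉₁)
            not₂ : ∀ {it} → it ∈ its → ∀ s p y → EdgeOf s p y v t₂ → at it ≢ p × at it ≢ y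
            not₂ {it} m s p y e = by (proj₂ (EdgeOf-occ e)) , λ eq → apart (at it) (at₁ m) (subst (λ z → 1 ≤ occ t₂ z) (sym eq) (proj₁ (EdgeOf-occ e)))
              where
              by : p ≡ v ⊎ 1 ≤ occ t₂ p → at it ≢ p
              by (inj₁ pv) eq = at≢v m (trans eq pv)
              by (inj₂ p∈) eq = apart (at it) (at₁ m) (subst (λ z → 1 ≤ occ t₂ z) (sym eq) p∈)
            out : ∀ {it} → it ∈ its → ∀ u → EdgeOf true (at it) u v (t₁ ⊕ t₂) ⊎ EdgeOf false u (at it) v (t₁ ⊕ t₂) → u ≡ above it × sign it ≡ false ⊎ below it ≡ just (true , u)
            out {it} m u (inj₁ e) with EdgeOf-⊕ t₁ t₂ e
            ... | inj₁ e₁ = inj₂ (proj₂ (incident c v t₁ simple₁ v∉₁ m true (at it) u e₁) refl)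
            ... | inj₂ e₂ = contradiction refl (proj₁ (not₂ m true (at it) u e₂))
            out {it} m u (inj₂ e) with EdgeOf-⊕ t₁ t₂ e
            ... | inj₁ e₁ = inj₁ (Data.Product.map₂ sym (proj₁ (incident c v t₁ simple₁ v∉₁ m false u (at it) e₁) refl))
            ... | inj₂ e₂ = contradiction refl (proj₂ (not₂ m false u (at it) e₂))
            into : ∀ {it} → it ∈ its → ∀ u → EdgeOf true u (at it) v (t₁ ⊕ t₂) ⊎ EdgeOf false (at it) u v (t₁ ⊕ t₂) → u ≡ above it × sign it ≡ true ⊎ below it ≡ just (false , u)
            into {it} m u (inj₁ e) with EdgeOf-⊕ t₁ t₂ e
            ... | inj₁ e₁ = inj₁ (Data.Product.map₂ sym (proj₁ (incident c v t₁ simple₁ v∉₁ m true u (at it) e₁) refl))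
            ... | inj₂ e₂ = contradiction refl (proj₂ (not₂ m true u (at it) e₂))
            into {it} m u (inj₂ e) with EdgeOf-⊕ t₁ t₂ e
            ... | inj₁ e₁ = inj₂ (proj₂ (incident c v t₁ simple₁ v∉₁ m false (at it) u e₁) refl)
            ... | inj₂ e₂ = contradiction refl (proj₁ (not₂ m false (at it) u e₂))
            above≢ : ∀ {it it′} → it ∈ its → it′ ∈ its → above it ≢ at it′
            above≢ {it} {it′} m m′ eq with item-above c v t₁ m
            ... | inj₁ (av , _) = at≢v m′ (trans (sym eq) av)
            ... | inj₂ y∈ = <⇒≱ (+-mono-≤ (subst (λ z → 1 ≤ occC Y c t₁ z) eq y∈) (item-at c v t₁ m′)) (≤-trans (m≤m+n _ (occC Z c t₁ (at it′))) (one-class (at it′)))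
            below≢ : ∀ {it it′} → it ∈ its → it′ ∈ its → ∀ b z → below it ≡ just (b , z) → z ≢ at it′
            below≢ {it} {it′} m m′ b z eqb eq = <⇒≱ (+-mono-≤ (≤-trans (item-at c v t₁ m′) (m≤n+m _ (occC Y c t₁ (at it′)))) (subst (λ z → 1 ≤ occC Z c t₁ z) eq (item-below c v t₁ m b z eqb))) (one-class (at it′))

          placed₁ : Placed X₁.done⁺
          placed₁ = record { at-done = λ {it} m → X₁.done⁺-new (at it) (in-t₁ {X} {at it} (item-at c v t₁ m))
                           ; above-done = λ {it} m → up it (item-above c v t₁ m)
                           ; below-done = λ {it} m b z eq → X₁.done⁺-new z (in-t₁ {Z} {z} (item-below c v t₁ m b z eq)) }
            where
            up : ∀ it → above it ≡ v × c ≡ X ⊎ 1 ≤ occC Y c t₁ (above it) → X₁.done⁺ (above it) ≡ true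
            up it (inj₁ (eq , _)) = subst (λ z → X₁.done⁺ z ≡ true) (sym eq) (X₁.done⁺-old v (==-refl v))
            up it (inj₂ le) = X₁.done⁺-new (above it) (in-t₁ {Y} {above it} le)

          -- Only the movable vertices, not all of t₁; the cut vertex v, below which t₂ hangs, is
          -- not among them.
          reserved : Pool
          reserved y = 1 ≤ᵇ atCount y its

          reserved-t₁ : ∀ y → reserved y ≡ true → 1 ≤ occ t₁ y
          reserved-t₁ y r = in-t₁ {X} {y} (≤-trans (1≤ᵇ-true r) (atCount≤ y c v t₁))

          unreserved : ∀ {y} → reserved y ≡ false → ∀ {it} → it ∈ its → y ≢ at it
          unreserved {y} r {it} m refl = <⇒≱ (found its m) (≤-reflexive (1≤ᵇ-false r))
            where
            found : ∀ xs → it ∈ xs → 1 ≤ atCount (at it) xs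
            found (_ ∷ xs) (here refl) = ≤-trans (≤-reflexive (cong χ (sym (==-refl (at it))))) (m≤m+n _ _)
            found (it′ ∷ xs) (there m) = ≤-trans (found xs m) (m≤n+m _ (χ (at it′ == at it)))

          module Completion {U₂ : Pool} (δ : Emb U₁ (f₁ v) (prune t₂) U₂) where

            module X₂ = Extend inv₁ (cut v t₂) δ

            -- b₀ is the largest value that `b₀-small` admits; it corresponds to a density of at
            -- least 1/2 + 3/(4 A) in every neighbourhood.
            N₀ b₀ : ℕ
            N₀ = cnt U₂
            b₀ = (6 * A * N₀ ∸ 3 * N₀) / (4 * A)

            n≡ : n ≡ used + N₀
            n≡ = trans (cnt-all∖ u₀) (cong suc (trans (cnt-Emb ε) (trans (cong (size t₁ +_) (cnt-Emb δ)) (sym (+-assoc (size t₁) _ _)))))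

            N₀-large : 2 * A * used ≤ N₀
            N₀-large = +-cancelʳ-≤ used _ _ (begin
              2 * A * used + used      ≡⟨ ar A used ⟩
              (2 * A + 1) * used       ≤⟨ used-small ⟩
              n                        ≡⟨ trans n≡ (+-comm used N₀) ⟩
              N₀ + used                ∎)
              where
              open ≤-Reasoning
              ar : ∀ A u → 2 * A * u + u ≡ (2 * A + 1) * u
              ar = solve-∀

            N₀>0 : 0 < N₀
            N₀>0 = ≤-trans (s≤s z≤n) N₀-large

            3≤6 : 3 * N₀ ≤ 6 * A * N₀
            3≤6 = *-monoˡ-≤ N₀ (≤-trans (s≤s (s≤s (s≤s (z≤n {3})))) (m≤m*n 6 A))

            b₀-small : 4 * A * b₀ + 3 * N₀ ≤ 6 * A * N₀
            b₀-small = ≤-trans (+-monoˡ-≤ (3 * N₀) (≤-trans (≤-reflexive (*-comm (4 * A) b₀)) (m/n*n≤m (6 * A * N₀ ∸ 3 * N₀) (4 * A)))) (≤-reflexive (m∸n+n≡m 3≤6))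

            j : ℕ
            j = 18 * A * l ∸ 2

            q≡ : 2 + j ≡ 18 * A * l
            q≡ = m+[n∸m]≡n (≤-trans (s≤s (s≤s (z≤n {16}))) (≤-trans (m≤m*n 18 A) (m≤m*n (18 * A) l {{>-nonZero l>0}})))

            open Run A l j N₀ b₀ (s≤s z≤n) q≡ N₀>0 (≤-trans (m≤n+m N₀ used) (≤-reflexive (sym n≡))) b₀-small
            open Potential test j using (b)

            far≤ : ∀ s u → 4 * A * cnt (λ x → U₂ x ∧ not (E s u x)) + 3 * N₀ ≤ 2 * A * N₀
            far≤ s u = +-cancelʳ-≤ N₀ _ _ (begin
              4 * A * x + 3 * N₀ + N₀        ≡⟨ ar₁ A x N₀ ⟩
              4 * A * x + 4 * N₀             ≤⟨ +-monoʳ-≤ (4 * A * x) (*-monoʳ-≤ 4 (≤-trans (m≤n+m N₀ used) (≤-reflexive (sym n≡)))) ⟩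
              4 * A * x + 4 * n              ≤⟨ lin 0 (+-mono-≤ (+-mono-≤ (*-monoʳ-≤ (4 * A) outside) (*-monoʳ-≤ 2 (deg s u))) (≤-reflexive (cong (4 * A *_) parts))) (ar₂ A x n F W) ⟩
              2 * A * n                      ≡⟨ cong (2 * A *_) n≡ ⟩
              2 * A * (used + N₀)            ≡⟨ *-distribˡ-+ (2 * A) used N₀ ⟩
              2 * A * used + 2 * A * N₀      ≤⟨ +-monoˡ-≤ (2 * A * N₀) N₀-large ⟩
              N₀ + 2 * A * N₀                ≡⟨ +-comm N₀ (2 * A * N₀) ⟩
              2 * A * N₀ + N₀                ∎)
              where
              open ≤-Reasoning
              x = cnt (λ x → U₂ x ∧ not (E s u x))
              F = cnt (E s u)
              W = cnt (λ x → not (E s u x))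
              outside : x ≤ W
              outside = cnt-mono λ x h → proj₂ (∧-true {U₂ x} h)
              parts : F + W ≡ n
              parts = trans (sym (cnt-split all (E s u))) (cnt-true n)
              ar₁ : ∀ A x N → 4 * A * x + 3 * N + N ≡ 4 * A * x + 4 * N
              ar₁ = solve-∀
              ar₂ : ∀ A x n F W → 4 * A * x + 4 * n + (4 * A * W + 2 * (2 * (A * F)) + 4 * A * n) + 0 ≡ 2 * A * n + (4 * A * x + 2 * ((A + 2) * n) + 4 * A * (F + W))
              ar₂ = solve-∀

            b≤b₀ : ∀ i → b U₂ i ≤ b₀
            b≤b₀ i = go (splitAt n i) refl
              where
              open ≤-Reasoning
              from : ∀ s u → N₀ + cnt (λ x → U₂ x ∧ not (E s u x)) ≤ b₀
              from s u = subst (_≤ b₀) (m*n/n≡m y (4 * A)) (/-monoˡ-≤ (4 * A) (m+n≤o⇒m≤o∸n (y * (4 * A)) (begin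
                y * (4 * A) + 3 * N₀                                                     ≡⟨ ar A N₀ (cnt (λ x → U₂ x ∧ not (E s u x))) ⟩
                4 * A * N₀ + (4 * A * cnt (λ x → U₂ x ∧ not (E s u x)) + 3 * N₀)         ≤⟨ +-monoʳ-≤ (4 * A * N₀) (far≤ s u) ⟩
                4 * A * N₀ + 2 * A * N₀                                                  ≡⟨ ar₂ A N₀ ⟩
                6 * A * N₀                                                               ∎)))
                where
                y = N₀ + cnt (λ x → U₂ x ∧ not (E s u x))
                ar : ∀ A N x → (N + x) * (4 * A) + 3 * N ≡ 4 * A * N + (4 * A * x + 3 * N)
                ar = solve-∀
                ar₂ : ∀ A N → 4 * A * N + 2 * A * N ≡ 6 * A * N
                ar₂ = solve-∀
              go : ∀ w → splitAt n i ≡ w → b U₂ i ≤ b₀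
              go (inj₁ u) eq rewrite eq = from true u
              go (inj₂ u) eq rewrite eq = from false u

            open Loop reserved D Δ (suc (4 * L) * (L * Mmax)) (suc (4 * L) * (suc (4 * L) * Mmax)) h D>0 using (loop)

            reserved-done : ∀ y → reserved y ≡ true → X₂.done⁺ y ≡ true
            reserved-done y r = X₂.done⁺-old y (X₁.done⁺-new y (reserved-t₁ y r))

            pending-free : All (λ it → reserved (proj₁ it) ≡ false) (rest v t₂ ++ [])
            pending-free = All.++⁺ (All.map (λ {it} → free {it}) (Split.parents (cut v t₂))) []
              where
              not-reserved : ∀ y → (1 ≤ occ t₁ y → ⊥) → reserved y ≡ false
              not-reserved y h with reserved y in r
              ... | false = refl
              ... | true = ⊥-elim (h (reserved-t₁ y r))
              free : ∀ {it : Item n} → proj₁ it ≡ v ⊎ 1 ≤ occ (prune t₂) (proj₁ it) → reserved (proj₁ it) ≡ false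
              free (inj₁ eq) = not-reserved _ λ h → <⇒≱ (subst (λ z → 1 ≤ occ t₁ z) eq h) (≤-reflexive v∉₁)
              free {it} (inj₂ h) = not-reserved _ λ h₁ → apart (proj₁ it) h₁ (≤-trans h (≤-trans (m≤m+n _ (occW (rest v t₂) (proj₁ it))) (≤-reflexive (sym (Split.occ≡ (cut v t₂) (proj₁ it))))))

            almost : Later reserved X₂.f⁺ X₂.done⁺ h
            almost = loop cut₁ cut₂ ≤-refl ≤-refl (subst (λ m → 4 * (m * (Mmax * D)) ≤ h) (sym q≡) cut₃) cut₄
              (suc (sizeW (rest v t₂ ++ []))) ≤-refl X₂.extend (All.++⁺ (rest-heavy v t₂) []) (All.++⁺ (rest-Bounded v t₂ (bounded Δ v t₂ Δ-bound simple₂ edge₂)) [])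
              (tame₀ U₂ refl n≤2^l b≤b₀) (≤-trans (m≤n+m N₀ used) (≤-reflexive (sym n≡))) reserved-done pending-free

            completion : Later reserved X₂.f⁺ X₂.done⁺ h → Copy
            completion lt = finish mv (suc (sizeW work⁺ + (sizeW work⁺ + length work⁺))) ≤-refl inv (placed-mono grow′ placed₁)
                (All.map (λ r {it} m → unreserved r {it} m) aside)
                (λ s u w → ≤-trans (≤-trans (≤-reflexive (sym (Inv.count inv))) few) (≤-trans (hits₁ s u w) (≤-reflexive (sym (hits-agree placed₁ agree′ s u w)))))
              where
              open Later lt
              grow′ : ∀ y → X₁.done⁺ y ≡ true → done⁺ y ≡ true
              grow′ y d = grow y (X₂.done⁺-old y d)
              agree′ : ∀ y → X₁.done⁺ y ≡ true → f⁺ y ≡ f₁ y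
              agree′ y d = trans (agree y (X₂.done⁺-old y d)) (X₂.f⁺-old y d)

          copy₂ : (∃ λ U₂ → Emb U₁ (f₁ v) (prune t₂) U₂) → Copy
          copy₂ (U₂ , δ) = Completion.completion δ (Completion.almost δ)

          copy₁ : Copy
          copy₁ = copy₂ (greedy (prune t₂) (f₁ v) U₁ (cap-Emb (size (prune t₂)) ε (start-cap u₀ A-used)))

        copy₀ : (∃ λ c → size t₁ ≤ 6 * movable c t₁) → Copy
        copy₀ (c , c-rich) = go (plant-root c t₁ roots₁ (bounded Δ v t₁ Δ-bound simple₁ edge₁) (≤-trans (*-monoʳ-≤ A (s≤s (m≤m+n (size t₁) _))) A-used))
          where
          go : Rooted c t₁ → Copy
          go R = Seeding.copy₁ c c-rich (Rooted.u₀ R) (Rooted.ε R) (Rooted.le R)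

      copy : Copy
      copy = go (halves μ μ>0 some-vertex (begin
          suc μ                          ≤⟨ +-monoˡ-≤ μ μ>0 ⟩
          μ + μ                          ≡⟨ cong (μ +_) (+-identityʳ μ) ⟨
          2 * μ                          ≤⟨ m≤m+n (2 * μ) h ⟩
          2 * μ + h                      ≤⟨ m≤n*m (2 * μ + h) (2 * A + 1) {{>-nonZero (m≤n+m 1 (2 * A))}} ⟩
          (2 * A + 1) * (2 * μ + h)      ≤⟨ roomy ⟩
          n                              ∎))
        where
        open ≤-Reasoning
        go : Halves μ → Copy
        go H = copy₀ (Halves.rep H) (Halves.lower H) (Halves.upper H) (best-class (Halves.t₁ H))

  -- Choice of the constants

  module Choice (a : ℕ) where

    A d₃ : ℕ
    A = suc a
    d₃ = A * (A * (2 * A))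

    -- The sizes are h = n / H and μ = C₂ h. C₂ comes from `rich`, H from `roomy`, and D from
    -- `cut₄`, where n is at most 2 h H. Opaque, so that these large numerals are never computed.
    opaque
      C₂ H D : ℕ
      C₂ = 12 * d₃ + 12
      H = suc ((2 * A + 1) * (2 * C₂ + 1))
      D = 2 + 12 * (suc (18 * A) * H)

      C₂≡ : C₂ ≡ 12 * d₃ + 12
      C₂≡ = refl

      H≡ : H ≡ suc ((2 * A + 1) * (2 * C₂ + 1))
      H≡ = refl

      D≡ : D ≡ 2 + 12 * (suc (18 * A) * H)
      D≡ = refl

    L : ℕ
    L = 2 * D

    opaque
      k₁ k₂ k₃ k₅ : ℕ
      k₁ = 2 * A * (suc (4 * L) * (L * suc L))
      k₂ = 2 * A * (2 * A * (suc (4 * L) * (suc (4 * L) * suc L)))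
      k₃ = 72 * A * D * suc L
      k₅ = 2 * d₃ + 2 * A

      k₁≡ : k₁ ≡ 2 * A * (suc (4 * L) * (L * suc L))
      k₁≡ = refl

      k₂≡ : k₂ ≡ 2 * A * (2 * A * (suc (4 * L) * (suc (4 * L) * suc L)))
      k₂≡ = refl

      k₃≡ : k₃ ≡ 72 * A * D * suc L
      k₃≡ = refl

      k₅≡ : k₅ ≡ 2 * d₃ + 2 * A
      k₅≡ = refl

    -- C₁ dominates every multiple of Δ l that some condition asks of h: k₁, k₂, k₃ for the first
    -- three cuts, k₄ for 2 Mmax ≤ h, k₅ for `rich` and L for `small`. C adds the factor H between h
    -- and n and a 2 for passing from the logarithm to l.
    k₄ C₁ C′ C : ℕ
    k₄ = 2 * suc L
    C₁ = k₁ + (k₂ + (k₃ + (k₄ + (k₅ + L))))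
    C′ = 2 * (C₁ * H)
    C = suc C′

    instance
      H≢0 : NonZero H
      H≢0 = subst NonZero (sym H≡) _

    module _ {n Δ : ℕ} (n≥4 : 4 ≤ n) (Δ≥1 : 1 ≤ Δ) (sparse : Δ * (⌊log₂ n ⌋ * C) ≤ n) where

      open ≤-Reasoning

      lg l h μ : ℕ
      lg = ⌊log₂ n ⌋
      -- One more than needed for n < 2 ^ (1 + lg), so that both n + n and the 2 n² switching tests
      -- are covered. From n ≥ 4 it is at most twice the logarithm.
      l = 2 + lg
      h = n / H
      μ = C₂ * h

      lg≥2 : 2 ≤ lg
      lg≥2 = ⌊log₂⌋-mono-≤ n≥4

      base : C₁ * (Δ * l) ≤ h
      base = subst (_≤ h) (m*n/n≡m (C₁ * (Δ * l)) H) (/-monoˡ-≤ H (begin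
        C₁ * (Δ * (2 + lg)) * H          ≤⟨ *-monoˡ-≤ H (*-monoʳ-≤ C₁ (*-monoʳ-≤ Δ (+-monoˡ-≤ lg lg≥2))) ⟩
        C₁ * (Δ * (lg + lg)) * H         ≡⟨ ar C₁ Δ lg H ⟩
        Δ * (lg * (2 * (C₁ * H)))        ≤⟨ *-monoʳ-≤ Δ (*-monoʳ-≤ lg (n≤1+n _)) ⟩
        Δ * (lg * C)                     ≤⟨ sparse ⟩
        n                                ∎))
        where
        ar : ∀ c d g h → c * (d * (g + g)) * h ≡ d * (g * (2 * (c * h)))
        ar = solve-∀

      fits : ∀ {k} → k ≤ C₁ → k * (Δ * l) ≤ h
      fits le = ≤-trans (*-monoˡ-≤ (Δ * l) le) base

      Δ≤Δl : Δ ≤ Δ * l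
      Δ≤Δl = m≤m*n Δ l

      fitsΔ : ∀ {k} → k ≤ C₁ → k * Δ ≤ h
      fitsΔ {k} le = ≤-trans (*-monoʳ-≤ k Δ≤Δl) (fits le)

      Mmax : ℕ
      Mmax = suc (Δ * L)

      Mmax≤ : Mmax ≤ suc L * Δ
      Mmax≤ = ≤-trans (+-monoˡ-≤ (Δ * L) Δ≥1) (≤-reflexive (cong (Δ +_) (*-comm Δ L)))

      in₁ : k₁ ≤ C₁
      in₁ = m≤m+n k₁ _
      in₂ : k₂ ≤ C₁
      in₂ = ≤-trans (m≤m+n k₂ _) (m≤n+m _ k₁)
      in₃ : k₃ ≤ C₁
      in₃ = ≤-trans (≤-trans (m≤m+n k₃ _) (m≤n+m _ k₂)) (m≤n+m _ k₁)
      in₄ : k₄ ≤ C₁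
      in₄ = ≤-trans (≤-trans (≤-trans (m≤m+n k₄ _) (m≤n+m _ k₃)) (m≤n+m _ k₂)) (m≤n+m _ k₁)
      in₅ : k₅ ≤ C₁
      in₅ = ≤-trans (≤-trans (≤-trans (≤-trans (m≤m+n k₅ _) (m≤n+m _ k₄)) (m≤n+m _ k₃)) (m≤n+m _ k₂)) (m≤n+m _ k₁)
      in₆ : L ≤ C₁
      in₆ = ≤-trans (≤-trans (≤-trans (≤-trans (m≤n+m L k₅) (m≤n+m _ k₄)) (m≤n+m _ k₃)) (m≤n+m _ k₂)) (m≤n+m _ k₁)

      h≥1 : 1 ≤ h
      h≥1 = ≤-trans (≤-trans Δ≥1 (≤-trans (m≤n*m Δ k₄) ≤-refl)) (fitsΔ in₄)

      n<2^ : n < 2 ^ (1 + lg)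
      n<2^ = n<2^[1+log] n

      cut-small : ∀ i j → i * suc L ≤ j → j ≤ C₁ → i * Mmax ≤ h
      cut-small i j le in₀ = begin
        i * Mmax            ≤⟨ *-monoʳ-≤ i Mmax≤ ⟩
        i * (suc L * Δ)     ≡⟨ *-assoc i (suc L) Δ ⟨
        i * suc L * Δ       ≤⟨ *-monoˡ-≤ Δ le ⟩
        j * Δ               ≤⟨ fitsΔ in₀ ⟩
        h                   ∎

      scales : Scales a Δ n l h μ D
      scales = record
        { D>0 = subst (1 ≤_) (sym D≡) (s≤s z≤n)
        ; μ>0 = *-mono-≤ {1} {C₂} (subst (1 ≤_) (sym C₂≡) (≤-trans (s≤s z≤n) (m≤n+m 12 (12 * d₃)))) h≥1
        ; n≤2^l = ≤-trans (+-mono-≤ (<⇒≤ n<2^) (<⇒≤ n<2^)) (≤-reflexive (cong (2 ^ (1 + lg) +_) (sym (+-identityʳ _))))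
        ; tests = begin-strict
            2 * (n * n)                              <⟨ *-monoʳ-< 2 (*-mono-< n<2^ n<2^) ⟩
            2 * (2 ^ (1 + lg) * 2 ^ (1 + lg))        ≤⟨ m≤n*m _ 2 ⟩
            2 * (2 * (2 ^ (1 + lg) * 2 ^ (1 + lg)))  ≡⟨ squares (2 ^ (1 + lg)) ⟩
            2 ^ (2 + lg) * 2 ^ (2 + lg)              ≡⟨ ^-distribˡ-+-* 2 l l ⟨
            2 ^ (l + l)                              ≡⟨ cong (λ m → 2 ^ (l + m)) (+-identityʳ l) ⟨
            2 ^ (2 * l)                              ∎
        ; l>0 = s≤s z≤n
        ; rich = begin
            6 * (2 * d₃ * h + (d₃ + d₃ + Δ * (2 * A)) * (2 * l))
              ≤⟨ *-monoʳ-≤ 6 (+-monoʳ-≤ (2 * d₃ * h) (begin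
                   (d₃ + d₃ + Δ * (2 * A)) * (2 * l)        ≤⟨ *-monoˡ-≤ (2 * l) (+-monoˡ-≤ (Δ * (2 * A)) (m≤n*m (d₃ + d₃) Δ {{>-nonZero Δ≥1}})) ⟩
                   (Δ * (d₃ + d₃) + Δ * (2 * A)) * (2 * l)  ≡⟨ trans (ar₁ Δ d₃ A l) (cong (λ k → 2 * (k * (Δ * l))) (sym k₅≡)) ⟩
                   2 * (k₅ * (Δ * l))                       ≤⟨ *-monoʳ-≤ 2 (fits in₅) ⟩
                   2 * h                                    ∎)) ⟩
            6 * (2 * d₃ * h + 2 * h)
              ≡⟨ trans (ar₂ d₃ h) (cong (_* h) (sym C₂≡)) ⟩
            C₂ * h ∎
        ; roomy = begin
            (2 * A + 1) * (2 * (C₂ * h) + h)     ≡⟨ ar₃ (2 * A + 1) C₂ h ⟩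
            h * ((2 * A + 1) * (2 * C₂ + 1))     ≤⟨ *-monoʳ-≤ h (≤-trans (n≤1+n _) (≤-reflexive (sym H≡))) ⟩
            h * H                                ≤⟨ m/n*n≤m n H ⟩
            n                                    ∎
        ; small = ≤-trans (≤-reflexive (*-comm Δ L)) (fitsΔ in₆)
        ; cut₁ = ≤-trans (≤-reflexive (ar₄ (2 * A) (suc (4 * L)) L Mmax)) (cut-small (2 * A * (suc (4 * L) * L)) k₁ (≤-reflexive (trans (ar₅ (2 * A) (suc (4 * L)) L (suc L)) (sym k₁≡))) in₁)
        ; cut₂ = ≤-trans (≤-reflexive (ar₆ (2 * A) (suc (4 * L)) Mmax)) (≤-trans (cut-small (2 * A * (2 * A * (suc (4 * L) * suc (4 * L)))) k₂ (≤-reflexive (trans (ar₇ (2 * A) (suc (4 * L)) (suc L)) (sym k₂≡))) in₂) (m≤m+n h _))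
        ; cut₃ = begin
            4 * (18 * A * l * (Mmax * D))        ≡⟨ ar₈ A l Mmax D ⟩
            72 * A * D * l * Mmax                ≤⟨ *-monoʳ-≤ (72 * A * D * l) Mmax≤ ⟩
            72 * A * D * l * (suc L * Δ)         ≡⟨ trans (ar₉ (72 * A * D) l (suc L) Δ) (cong (_* (Δ * l)) (sym k₃≡)) ⟩
            k₃ * (Δ * l)                         ≤⟨ fits in₃ ⟩
            h                                    ∎
        ; cut₄ = *-cancelˡ-≤ 2 (begin
            2 * (Mmax + 3 * (suc (18 * A) * n))          ≡⟨ *-distribˡ-+ 2 Mmax _ ⟩
            2 * Mmax + 2 * (3 * (suc (18 * A) * n))      ≤⟨ +-mono-≤ 2Mmax≤h (*-monoʳ-≤ 2 (*-monoʳ-≤ 3 (*-monoʳ-≤ (suc (18 * A)) n≤2hH))) ⟩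
            h + 2 * (3 * (suc (18 * A) * (2 * (h * H)))) ≤⟨ m≤n+m _ h ⟩
            h + (h + 2 * (3 * (suc (18 * A) * (2 * (h * H))))) ≡⟨ trans (ar₁₀ h (suc (18 * A)) H) (cong (_* h) (sym D≡)) ⟩
            D * h                                        ≤⟨ *-monoʳ-≤ D half ⟩
            D * (2 * (h ∸ Mmax))                         ≡⟨ ar₁₁ D (h ∸ Mmax) ⟩
            2 * (D * (h ∸ Mmax))                         ∎)
        }
        where
        squares : ∀ x → 2 * (2 * (x * x)) ≡ 2 * x * (2 * x)
        squares = solve-∀
        ar₁ : ∀ Δ d A l → (Δ * (d + d) + Δ * (2 * A)) * (2 * l) ≡ 2 * ((2 * d + 2 * A) * (Δ * l))
        ar₁ = solve-∀
        ar₂ : ∀ d h → 6 * (2 * d * h + 2 * h) ≡ (12 * d + 12) * h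
        ar₂ = solve-∀
        ar₃ : ∀ A C h → A * (2 * (C * h) + h) ≡ h * (A * (2 * C + 1))
        ar₃ = solve-∀
        ar₄ : ∀ A k L M → A * (k * (L * M)) ≡ A * (k * L) * M
        ar₄ = solve-∀
        ar₅ : ∀ A k L M → A * (k * L) * M ≡ A * (k * (L * M))
        ar₅ = solve-∀
        ar₆ : ∀ A k M → A * (A * (k * (k * M))) ≡ A * (A * (k * k)) * M
        ar₆ = solve-∀
        ar₇ : ∀ A k M → A * (A * (k * k)) * M ≡ A * (A * (k * (k * M)))
        ar₇ = solve-∀
        ar₈ : ∀ A l M D → 4 * (18 * A * l * (M * D)) ≡ 72 * A * D * l * M
        ar₈ = solve-∀
        ar₉ : ∀ k l L Δ → k * l * (L * Δ) ≡ k * L * (Δ * l)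
        ar₉ = solve-∀
        ar₁₀ : ∀ h c H → h + (h + 2 * (3 * (c * (2 * (h * H))))) ≡ (2 + 12 * (c * H)) * h
        ar₁₀ = solve-∀
        ar₁₁ : ∀ D x → D * (2 * x) ≡ 2 * (D * x)
        ar₁₁ = solve-∀
        2Mmax≤h : 2 * Mmax ≤ h
        2Mmax≤h = cut-small 2 k₄ ≤-refl in₄
        half : h ≤ 2 * (h ∸ Mmax)
        half = +-cancelʳ-≤ (2 * Mmax) _ _ (begin
          h + 2 * Mmax                    ≤⟨ +-monoʳ-≤ h 2Mmax≤h ⟩
          h + h                           ≡⟨ cong (λ m → m + m) (m∸n+n≡m (≤-trans (m≤m+n Mmax _) 2Mmax≤h)) ⟨
          (h ∸ Mmax + Mmax) + (h ∸ Mmax + Mmax)    ≡⟨ ar₁₂ (h ∸ Mmax) Mmax ⟩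
          2 * (h ∸ Mmax) + 2 * Mmax       ∎)
          where
          ar₁₂ : ∀ x M → (x + M) + (x + M) ≡ 2 * x + 2 * M
          ar₁₂ = solve-∀
        n≤2hH : n ≤ 2 * (h * H)
        n≤2hH = begin
          n                   ≡⟨ m≡m%n+[m/n]*n n H ⟩
          n % H + h * H       ≤⟨ +-monoˡ-≤ (h * H) (≤-trans (<⇒≤ (m%n<n n H)) (m≤n*m H h {{>-nonZero h≥1}})) ⟩
          h * H + h * H       ≡⟨ cong (h * H +_) (+-identityʳ (h * H)) ⟨
          2 * (h * H)         ∎

  -- Serves to show Δ ≥ 1: a vertex of positive degree that obeys the degree hypothesis forces n to
  -- be at least the divisor K.
  some-degree : ∀ {n} (T : Digraph n) → IsOrientedTree T → 2 ≤ n → ∃ λ x → 1 ≤ undDeg T x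
  some-degree {suc zero} T tree (s≤s ())
  some-degree {suc (suc m)} T tree 2≤n = go (IsOrientedTree.connected tree zero (suc zero))
    where
    go : Star (λ a b → undAdj T a b ≡ true) zero (suc zero) → ∃ λ x → 1 ≤ undDeg T x
    go (_◅_ {j = b} e _) = zero , subst (1 ≤_) (sym (countFin≡cnt _ (undAdj T zero)))
      (≤-trans (≤-reflexive (sym (cong χ e))) (∑-≥ (λ y → χ (undAdj T zero y)) b))

  spanning-tree : ∀ a n → 4 ≤ n → (G : Digraph n) → (∀ v → (suc a + 2) * n ≤ 2 * (suc a * outdeg G v)) → (∀ v → (suc a + 2) * n ≤ 2 * (suc a * indeg G v)) →
                  (T : Digraph n) → IsOrientedTree T → (∀ x → undDeg T x * (⌊log₂ n ⌋ * Choice.C a) ≤ n) → ContainsCopy G T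
  spanning-tree a n n≥4 G out into T tree sparse = go (Host.Assembly.copy T (host G) (host-flip G) tree (Choice.scales a n≥4 Δ≥1 (m/n*n≤m n K)) deg Δ-bound)
    where
    lg≥2 : 2 ≤ ⌊log₂ n ⌋
    lg≥2 = ⌊log₂⌋-mono-≤ n≥4
    K : ℕ
    K = ⌊log₂ n ⌋ * Choice.C a
    instance
      K≢0 : NonZero K
      K≢0 = >-nonZero (*-mono-≤ {1} (≤-trans (s≤s z≤n) lg≥2) (s≤s z≤n))
    -- The largest degree the hypothesis permits, not the maximum degree of T. When n is below K it
    -- would be 0, but then no tree satisfies the hypothesis; so n ≥ 4 is a sufficient threshold for
    -- every α.
    Δ : ℕ
    Δ = n / K
    Δ-bound : ∀ x → undDeg T x ≤ Δ
    Δ-bound x = subst (_≤ Δ) (m*n/n≡m (undDeg T x) K) (/-monoˡ-≤ K (sparse x))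
    Δ≥1 : 1 ≤ Δ
    Δ≥1 = from (some-degree T tree (≤-trans (s≤s (s≤s z≤n)) n≥4))
      where
      from : (∃ λ x → 1 ≤ undDeg T x) → 1 ≤ Δ
      from (x , h) = ≤-trans h (Δ-bound x)
    deg : ∀ s v → (suc a + 2) * n ≤ 2 * (suc a * cnt (host G s v))
    deg true v = subst (λ m → (suc a + 2) * n ≤ 2 * (suc a * m)) (countFin≡cnt n (adj G v)) (out v)
    deg false v = subst (λ m → (suc a + 2) * n ≤ 2 * (suc a * m)) (countFin≡cnt n (λ u → adj G u v)) (into v)
    go : (∃ λ (f : Fin n → Fin n) → (∀ x y → f x ≡ f y → x ≡ y) × (∀ x y → adj T x y ≡ true → adj G (f x) (f y) ≡ true)) → ContainsCopy G T
    go (f , inj , edges) = f , (λ {x} {y} → inj x y) , edges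

open import Data.Nat using (ℕ; _≥_)
open import Data.Nat.Logarithm using (⌊log₂_⌋)
open import Data.Fin using (Fin)
open import Data.Product using (Σ; _×_)
open import Data.Integer using (+_)
open import Data.Rational using (ℚ; 0ℚ; ½; _+_; _*_; _≤_; _<_; _/_)
open import Data.Integer using (-[1+_])
open import Data.Nat using (suc; zero; z≤n; s≤s)
open import Data.Nat.Tactic.RingSolver using (solve-∀)
open import Data.Product using (∃; _,_; proj₁; proj₂)
open import Data.Rational using (mkℚ; toℚᵘ; *<*)
open import Relation.Binary.PropositionalEquality using (_≡_; refl; sym; trans; cong; cong₂)
import Data.Integer as ℤ
import Data.Integer.Properties as ℤ
import Data.Nat as ℕ
import Data.Nat.Properties as ℕ
import Data.Rational.Properties as ℚ
import Data.Rational.Unnormalised as ℚᵘ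
import Data.Rational.Unnormalised.Properties as ℚᵘ
open Spanning using (spanning-tree; module Choice)

-- From rational hypotheses to inequalities between naturals

whole : ℕ → ℚᵘ.ℚᵘ
whole n = ℚᵘ.mkℚᵘ (+ n) 0

toℚᵘ-whole : ∀ n → toℚᵘ ((+ n) / 1) ℚᵘ.≃ whole n
toℚᵘ-whole n = ℚ.toℚᵘ-fromℚᵘ (whole n)

nat-≤ : ∀ {x y : ℤ.ℤ} {m n} → x ≡ + m → y ≡ + n → x ℤ.≤ y → m ℕ.≤ n
nat-≤ refl refl le = ℤ.drop‿+≤+ le

-- A positive rational is at least the reciprocal of its denominator `suc a`, so A can be taken to
-- be that denominator.
reciprocal-below : (α : ℚ) → 0ℚ < α → ∃ λ a → ∀ n d → (½ + α) * ((+ n) / 1) ≤ (+ d) / 1 → (suc a ℕ.+ 2) ℕ.* n ℕ.≤ 2 ℕ.* (suc a ℕ.* d)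
reciprocal-below (mkℚ (+ zero) a c) (*<* (ℤ.+<+ ()))
reciprocal-below (mkℚ -[1+ m ] a c) (*<* ())
reciprocal-below α@(mkℚ (+ suc m) a c) _ = a , λ n d h → ℕ.≤-trans (ℕ.*-monoˡ-≤ n (ℕ.+-monoʳ-≤ (suc a) (ℕ.*-monoˡ-≤ 2 (s≤s (z≤n {m})))))
    (ℕ.≤-trans (ℕ.≤-reflexive (arith₁ (suc a) (suc m) n)) (ℕ.≤-trans (nat-≤ (lhs n) (rhs d) (ℚᵘ.drop-*≤* (unnormalised n d h))) (ℕ.≤-reflexive (arith₂ (suc a) d))))
  where
  αᵘ : ℚᵘ.ℚᵘ
  αᵘ = ℚᵘ.mkℚᵘ (+ suc m) a
  ½ᵘ : ℚᵘ.ℚᵘ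
  ½ᵘ = ℚᵘ.mkℚᵘ (+ 1) 1
  unnormalised : ∀ n d → (½ + α) * ((+ n) / 1) ≤ (+ d) / 1 → (½ᵘ ℚᵘ.+ αᵘ) ℚᵘ.* whole n ℚᵘ.≤ whole d
  unnormalised n d h = ℚᵘ.≤-respʳ-≃ (toℚᵘ-whole d) (ℚᵘ.≤-respˡ-≃
    (ℚᵘ.≃-trans (ℚ.toℚᵘ-homo-* (½ + α) ((+ n) / 1)) (ℚᵘ.*-cong (ℚ.toℚᵘ-homo-+ ½ α) (toℚᵘ-whole n))) (ℚ.toℚᵘ-mono-≤ h))
  lhs : ∀ n → (+ 1 ℤ.* + suc a ℤ.+ + suc m ℤ.* + 2) ℤ.* + n ℤ.* + 1 ≡ + ((1 ℕ.* suc a ℕ.+ suc m ℕ.* 2) ℕ.* n ℕ.* 1)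
  lhs n = trans (cong (ℤ._* + 1) (trans (cong (ℤ._* + n) (trans (cong₂ ℤ._+_ (sym (ℤ.pos-* 1 (suc a))) (sym (ℤ.pos-* (suc m) 2))) (sym (ℤ.pos-+ (1 ℕ.* suc a) (suc m ℕ.* 2))))) (sym (ℤ.pos-* (1 ℕ.* suc a ℕ.+ suc m ℕ.* 2) n))))
            (sym (ℤ.pos-* ((1 ℕ.* suc a ℕ.+ suc m ℕ.* 2) ℕ.* n) 1))
  rhs : ∀ d → + d ℤ.* + (2 ℕ.* suc a ℕ.* 1) ≡ + (d ℕ.* (2 ℕ.* suc a ℕ.* 1))
  rhs d = sym (ℤ.pos-* d (2 ℕ.* suc a ℕ.* 1))
  arith₁ : ∀ A m n → (A ℕ.+ m ℕ.* 2) ℕ.* n ≡ (1 ℕ.* A ℕ.+ m ℕ.* 2) ℕ.* n ℕ.* 1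
  arith₁ = solve-∀
  arith₂ : ∀ A d → d ℕ.* (2 ℕ.* A ℕ.* 1) ≡ 2 ℕ.* (A ℕ.* d)
  arith₂ = solve-∀

reciprocal-positive : ∀ k → 0ℚ < (+ 1) / suc k
reciprocal-positive k = ℚ.toℚᵘ-cancel-< (ℚᵘ.<-respʳ-≃ (ℚᵘ.≃-sym (ℚ.toℚᵘ-fromℚᵘ (ℚᵘ.mkℚᵘ (+ 1) k))) (ℚᵘ.*<* (ℤ.+<+ (s≤s z≤n))))

clear-reciprocal : ∀ k d l n → ((+ d) / 1) * ((+ l) / 1) ≤ (+ 1) / suc k * ((+ n) / 1) → d ℕ.* (l ℕ.* suc k) ℕ.≤ n
clear-reciprocal k d l n h = ℕ.≤-trans (ℕ.≤-reflexive (arith₁ d l (suc k))) (ℕ.≤-trans (nat-≤ lhs rhs (ℚᵘ.drop-*≤* unnormalised)) (ℕ.≤-reflexive (arith₂ n)))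
  where
  unnormalised : whole d ℚᵘ.* whole l ℚᵘ.≤ ℚᵘ.mkℚᵘ (+ 1) k ℚᵘ.* whole n
  unnormalised = ℚᵘ.≤-respʳ-≃ (ℚᵘ.≃-trans (ℚ.toℚᵘ-homo-* ((+ 1) / suc k) ((+ n) / 1)) (ℚᵘ.*-cong (ℚ.toℚᵘ-fromℚᵘ (ℚᵘ.mkℚᵘ (+ 1) k)) (toℚᵘ-whole n)))
    (ℚᵘ.≤-respˡ-≃ (ℚᵘ.≃-trans (ℚ.toℚᵘ-homo-* ((+ d) / 1) ((+ l) / 1)) (ℚᵘ.*-cong (toℚᵘ-whole d) (toℚᵘ-whole l))) (ℚ.toℚᵘ-mono-≤ h))
  lhs : + d ℤ.* + l ℤ.* + (suc k ℕ.* 1) ≡ + (d ℕ.* l ℕ.* (suc k ℕ.* 1))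
  lhs = trans (cong (ℤ._* + (suc k ℕ.* 1)) (sym (ℤ.pos-* d l))) (sym (ℤ.pos-* (d ℕ.* l) (suc k ℕ.* 1)))
  rhs : + 1 ℤ.* + n ℤ.* + (1 ℕ.* 1) ≡ + (1 ℕ.* n ℕ.* (1 ℕ.* 1))
  rhs = trans (cong (ℤ._* + (1 ℕ.* 1)) (sym (ℤ.pos-* 1 n))) (sym (ℤ.pos-* (1 ℕ.* n) (1 ℕ.* 1)))
  arith₁ : ∀ d l k → d ℕ.* (l ℕ.* k) ≡ d ℕ.* l ℕ.* (k ℕ.* 1)
  arith₁ = solve-∀
  arith₂ : ∀ n → 1 ℕ.* n ℕ.* (1 ℕ.* 1) ≡ n
  arith₂ = solve-∀

theorem1p1 : (α : ℚ) → 0ℚ < α →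
    Σ ℚ λ c → 0ℚ < c × Σ ℕ λ n₀ → (n : ℕ) → n ≥ n₀ →
    (D : Digraph n) →
    (∀ v → ((½ + α) * ((+ n) / 1) ≤ (+ outdeg D v) / 1) × ((½ + α) * ((+ n) / 1) ≤ (+ indeg D v) / 1)) →
    (T : Digraph n) → IsOrientedTree T →
    (∀ x → ((+ undDeg T x) / 1) * ((+ ⌊log₂ n ⌋) / 1) ≤ c * ((+ n) / 1)) →
    ContainsCopy D T
theorem1p1 α α>0 = (+ 1) / suc (Choice.C′ a) , reciprocal-positive (Choice.C′ a) , 4 , λ n n≥4 D deg T tree sparse →
  spanning-tree a n n≥4 D (λ v → dense n (outdeg D v) (proj₁ (deg v))) (λ v → dense n (indeg D v) (proj₂ (deg v))) T tree
    (λ x → clear-reciprocal (Choice.C′ a) (undDeg T x) ⌊log₂ n ⌋ n (sparse x))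
  where
  a : ℕ
  a = proj₁ (reciprocal-below α α>0)
  dense : ∀ n d → (½ + α) * ((+ n) / 1) ≤ (+ d) / 1 → (suc a ℕ.+ 2) ℕ.* n ℕ.≤ 2 ℕ.* (suc a ℕ.* d)
  dense = proj₂ (reciprocal-below α α>0)
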